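{- Let $n\ge0$ and let $(\gamma_\alpha)_\alpha$ be a family of nonnegative real numbers indexed by the compositions $\alpha$ of $n$. Let $\mathbb{k}$ be an ordered field of characteristic $0$ containing the numbers $\gamma_\alpha$ (e.g. $\mathbb{k}=\mathbb{R}$). Put $B_\gamma=\sum_\alpha\gamma_\alpha B_\alpha\in\mathbb{k}S_n$ and $\widetilde{n}_\gamma(F)=\sum_\alpha\gamma_\alpha\widetilde{n}_\alpha(F)$ for $F\in\Sigma_n$. Then the minimal polynomial of $w_0B_\gamma$ in $\mathbb{k}S_n$ is \[ \prod_{k\in\widetilde{n}_\gamma(\Sigma_n)}(x-k), \] where $\widetilde{n}_\gamma(\Sigma_n)=\{\widetilde{n}_\gamma(F):F\in\Sigma_n\}$ and the product is over its distinct elements.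
   Context: $[n]=\{1,\ldots,n\}$; $S_n$ the symmetric group with $(\sigma\tau)(i)=\sigma(\tau(i))$, $\mathbb{k}S_n$ its group algebra, $w_0(i)=n+1-i$. For a composition $\alpha=(\alpha_1,\ldots,\alpha_k)$ of $n$ let $D(\alpha)=\{\alpha_1,\ldots,\alpha_1+\cdots+\alpha_{k-1}\}$ and $B_\alpha=\sum_{w\in S_n:\operatorname{Des}w\subseteq D(\alpha)}w$, where $\operatorname{Des}w=\{i\in[n-1]:w(i)>w(i+1)\}$. A set composition of $[n]$ is a tuple $F=(F_1,\ldots,F_m)$ of nonempty pairwise disjoint sets with union $[n]$; $\ell(F)=m$, $\operatorname{type}F=(|F_1|,\ldots,|F_m|)$; $\Sigma_n$ is the set of all of them. $F\preceq G$ means each block of $F$ lies in some block of $G$. $n_\alpha(F)=\#\{G\in\Sigma_n:F\preceq G,\ \operatorname{type}G=\alpha\}$, $\widetilde{n}_\alpha(F)=(-1)^{n-\ell(F)}n_\alpha(F)$. -}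

module Defs where

open import Level using (Level; _⊔_) renaming (suc to lsuc)
open import Algebra.Bundles using (CommutativeRing)
open import Relation.Binary.Structures using (IsTotalOrder)
open import Relation.Binary.Core using (Rel)
open import Relation.Nullary using (¬_; does)
open import Data.Product using (Σ; ∃; _×_; _,_; proj₁; proj₂)
open import Data.Nat as ℕ using (ℕ; zero; suc)
open import Data.Bool using (Bool; true; false; if_then_else_; _∧_; _∨_; not)
open import Data.Fin as Fin using (Fin; toℕ)
open import Data.Fin.Properties using () renaming (_≟_ to _≟F_)
open import Data.Vec as Vec using (Vec; []; _∷_; lookup; tabulate)
open import Data.List as List using (List; []; _∷_; length; filter; map; concatMap; foldr; allFin; upTo; or)
open import Data.Bool.ListAction using (and) renaming (any to anyB)
open import Data.List.Membership.Propositional using (_∈_)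
import Data.Vec.Properties as VecP

-- Ordered fields (as in the paper: an ordered field; characteristic 0
-- is automatic for ordered fields).

record OrderedField (c ℓ₁ ℓ₂ : Level) : Set (lsuc (c ⊔ ℓ₁ ⊔ ℓ₂)) where
  field
    commRing : CommutativeRing c ℓ₁
  open CommutativeRing commRing public
  field
    _≤_         : Rel Carrier ℓ₂
    isTotalOrder : IsTotalOrder _≈_ _≤_
    +-mono-≤    : ∀ {x y} z → x ≤ y → (x + z) ≤ (y + z)
    *-nonneg    : ∀ {x y} → 0# ≤ x → 0# ≤ y → 0# ≤ (x * y)
    0≉1         : ¬ (0# ≈ 1#)
    inverse     : ∀ x → ¬ (x ≈ 0#) → Σ Carrier λ y → (x * y) ≈ 1#

allVecs : (m n : ℕ) → List (Vec (Fin m) n)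
allVecs m zero    = [] ∷ []
allVecs m (suc n) = concatMap (λ x → map (x ∷_) (allVecs m n)) (allFin m)

eqFinB : ∀ {m} → Fin m → Fin m → Bool
eqFinB i j = does (i ≟F j)

eqVecB : ∀ {m n} → Vec (Fin m) n → Vec (Fin m) n → Bool
eqVecB []       []       = true
eqVecB (x ∷ xs) (y ∷ ys) = eqFinB x y ∧ eqVecB xs ys

isInjB : ∀ {m n} → Vec (Fin m) n → Bool
isInjB {n = n} w =
  and (map (λ i → and (map (λ j → not (eqFinB (lookup w i) (lookup w j)) ∨ eqFinB i j) (allFin n))) (allFin n))

-- S_n: permutations w of [n] represented by (w(1),…,w(n)) (0-indexed)
perms : (n : ℕ) → List (Vec (Fin n) n)
perms n = filter (λ w → Data.Bool._≟_ (isInjB w) true) (allVecs n n)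
  where import Data.Bool

_∘ₚ_ : ∀ {n} → Vec (Fin n) n → Vec (Fin n) n → Vec (Fin n) n
σ ∘ₚ τ = tabulate (λ i → lookup σ (lookup τ i))

w₀ : (n : ℕ) → Vec (Fin n) n
w₀ n = tabulate Fin.opposite

compsF : ℕ → ℕ → List (List ℕ)
compsF fuel    zero    = [] ∷ []
compsF zero    (suc n) = []
compsF (suc f) (suc n) =
  concatMap (λ k → map (suc k ∷_) (compsF f (n ℕ.∸ k))) (upTo (suc n))

compositions : ℕ → List (List ℕ)
compositions n = compsF n n

partialSums : ℕ → List ℕ → List ℕ
partialSums s []           = []
partialSums s (a ∷ [])     = []
partialSums s (a ∷ b ∷ as) = (s ℕ.+ a) ∷ partialSums (s ℕ.+ a) (b ∷ as)

D : List ℕ → List ℕ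
D = partialSums 0

memℕB : ℕ → List ℕ → Bool
memℕB x = anyB (λ y → does (x ℕ.≟ y))

ltFinB : ∀ {m} → Fin m → Fin m → Bool
ltFinB i j = does (toℕ i ℕ.<? toℕ j)

-- Des w ⊆ D(α), with Des w = {i ∈ [n-1] : w(i) > w(i+1)} (1-indexed)
desSubB : ∀ {n} → Vec (Fin n) n → List ℕ → Bool
desSubB {n} w α = go 1 (Vec.toList w)
  where
  go : ℕ → List (Fin n) → Bool
  go i []           = true
  go i (x ∷ [])     = true
  go i (x ∷ y ∷ xs) = ((not (ltFinB y x)) ∨ memℕB i (D α)) ∧ go (suc i) (y ∷ xs)

-- Set compositions: F = (F₁,…,F_m) of [n] is represented by the map
-- f : [n] → [m] with F_j = f⁻¹(j); it is a set composition iff f is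
-- surjective (blocks nonempty).

SetComp : ℕ → Set
SetComp n = Σ ℕ λ m → Vec (Fin m) n

IsSetComp : ∀ {n} → SetComp n → Set
IsSetComp {n} (m , f) = ∀ (j : Fin m) → ∃ λ (i : Fin n) → lookup f i ≡ j
  where open import Relation.Binary.PropositionalEquality using (_≡_)

blockSize : ∀ {k n} → Vec (Fin k) n → Fin k → ℕ
blockSize {n = n} g j = length (filter (λ i → lookup g i Fin.≟ j) (allFin n))

hasTypeB : ∀ {n} (α : List ℕ) → Vec (Fin (length α)) n → Bool
hasTypeB α g = and (map (λ j → does (blockSize g j ℕ.≟ List.lookup α j)) (allFin (length α)))

-- F ⪯ G : every block of F lies in some block of G,
-- i.e. f i = f i' implies g i = g i'
refinesB : ∀ {m k n} → Vec (Fin m) n → Vec (Fin k) n → Bool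
refinesB {n = n} f g =
  and (map (λ i → and (map (λ i' → not (eqFinB (lookup f i) (lookup f i')) ∨ eqFinB (lookup g i) (lookup g i')) (allFin n))) (allFin n))

-- n_α(F) = #{G ∈ Σ_n : F ⪯ G, type G = α}
-- (a G with type α, α a composition, has k = ℓ(α) nonempty blocks)
nα : ∀ {n} → List ℕ → SetComp n → ℕ
nα {n} α (m , f) =
  length (List.filter (λ g → Data.Bool._≟_ (hasTypeB α g ∧ refinesB f g) true)
                      (allVecs (length α) n))
  where import Data.Bool

module _ {c ℓ₁ ℓ₂} (K : OrderedField c ℓ₁ ℓ₂) where
  open OrderedField K

  ℕ→K : ℕ → Carrier
  ℕ→K zero    = 0#
  ℕ→K (suc k) = 1# + ℕ→K k

  sumK : List Carrier → Carrier
  sumK = foldr _+_ 0#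

  signK : ℕ → Carrier → Carrier
  signK zero          x = x
  signK (suc zero)    x = - x
  signK (suc (suc k)) x = signK k x

  ñα : ∀ {n} → List ℕ → SetComp n → Carrier
  ñα {n} α F = signK (n ℕ.∸ proj₁ F) (ℕ→K (nα α F))

  ñγ : ∀ {n} → (List ℕ → Carrier) → SetComp n → Carrier
  ñγ {n} γ F = sumK (map (λ α → γ α * ñα α F) (compositions n))

  -- The group algebra 𝕜S_n: an element is its coefficient function on
  -- S_n (values off S_n are irrelevant; equality is tested on S_n).

  GA : ℕ → Set c
  GA n = Vec (Fin n) n → Carrier

  _≈GA_ : ∀ {n} → GA n → GA n → Set ℓ₁
  _≈GA_ {n} a b = ∀ w → w ∈ perms n → a w ≈ b w

  0GA : ∀ {n} → GA n
  0GA _ = 0#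

  δ : ∀ {n} → Vec (Fin n) n → GA n
  δ v w = if eqVecB v w then 1# else 0#

  1GA : ∀ {n} → GA n
  1GA {n} = δ (tabulate (λ i → i))

  _+GA_ : ∀ {n} → GA n → GA n → GA n
  (a +GA b) w = a w + b w

  _·GA_ : ∀ {n} → Carrier → GA n → GA n
  (k ·GA a) w = k * a w

  _*GA_ : ∀ {n} → GA n → GA n → GA n
  _*GA_ {n} a b ρ =
    sumK (concatMap (λ σ → map (λ τ → if eqVecB (σ ∘ₚ τ) ρ then a σ * b τ else 0#)
                               (perms n))
                    (perms n))

  Bα : ∀ {n} → List ℕ → GA n
  Bα α w = if desSubB w α then 1# else 0#

  Bγ : ∀ n → (List ℕ → Carrier) → GA n
  Bγ n γ = foldr (λ α acc → (γ α ·GA Bα α) +GA acc) 0GA (compositions n)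

  -- Polynomials over 𝕜 as coefficient lists (constant term first)

  Poly : Set c
  Poly = List Carrier

  evalGA : ∀ {n} → Poly → GA n → GA n
  evalGA []       a = 0GA
  evalGA (p ∷ ps) a = (p ·GA 1GA) +GA (a *GA evalGA ps a)

  addP : Poly → Poly → Poly
  addP []       q        = q
  addP (p ∷ ps) []       = p ∷ ps
  addP (p ∷ ps) (q ∷ qs) = (p + q) ∷ addP ps qs

  linMul : Carrier → Poly → Poly
  linMul k p = addP (0# ∷ p) (map (λ c → - k * c) p)

  prodLin : List Carrier → Poly
  prodLin = foldr linMul (1# ∷ [])

  -- P is the minimal polynomial of a: P is monic, P(a) = 0, and every
  -- monic polynomial Q (written cs ++ [1], degree length cs) with
  -- Q(a) = 0 has degree ≥ deg P.
  IsMinPoly : ∀ {n} → Poly → GA n → Set (c ⊔ ℓ₁)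
  IsMinPoly {n} P a =
    (Σ (List Carrier) λ cs → (P ≡ cs List.++ (1# ∷ [])) ×
        (evalGA P a ≈GA 0GA) ×
        (∀ ds → evalGA (ds List.++ (1# ∷ [])) a ≈GA 0GA → length cs ℕ.≤ length ds))
    where open import Relation.Binary.PropositionalEquality using (_≡_)

{-# OPTIONS --safe #-}

-- Identify a permutation with the word of its inverse.  Left multiplication by w₀ B_γ then
-- becomes U: a function x of words is sent to r ↦ Σ_α γ_α Σ_g x(sort_g (reverse r)), where g
-- runs over the set compositions of type α (colourings of the letters) and sort_g is the stable
-- sort by colour.  Let P_T be the product in the free algebra of the Lie brackets given by the
-- binary trees of a forest T whose leaves are 1, …, n.  Reversal sends P_T to
-- (-1)^(n - |T|) P_{reverse T}; and sort_g kills P_T unless g is constant on every tree of T, in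
-- which case it only reorders the factors.  Reordering costs brackets of factors of different
-- colours, that is, coarser forests with which g is no longer compatible.
--
-- Annihilation.  Let λ_T be the γ-weighted number of colourings compatible with T.  On
-- P_T + P_{reverse T} the operator is triangular with diagonal entry (-1)^(n - |T|) λ_T = ñ_γ(T),
-- and an off-diagonal entry from T to T' carries a factor γ_α with λ_T' + γ_α ≤ λ_T.  Since γ ≥ 0,
-- a path between two forests with the same eigenvalue has coefficient 0, so every eigenvalue is
-- needed only once.
--
-- Minimality.  For a set composition F take the forest of its blocks.  Its reorderings span a
-- subspace on which the functional φ, equal to 1 on each of them, is an eigenvector with
-- eigenvalue ñ_γ(F); hence every ñ_γ(F) is a root of every annihilating polynomial.

module Submission where

open import Defs
open import Level using (_⊔_)
open import Function.Base using (_∘_; id; case_of_)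
open import Data.Nat as ℕ using (ℕ; zero; suc; z≤n; s≤s; z<s; s<s)
import Data.Nat.Properties as ℕₚ
open import Data.Bool using (Bool; true; false; if_then_else_; _∧_; _∨_; not)
import Data.Bool.Properties as Boolₚ
open import Data.Fin as Fin using (Fin; toℕ)
import Data.Fin.Properties as Finₚ
open import Data.Vec as Vec using (Vec)
import Data.Vec.Properties as Vecₚ
open import Data.List using (List; []; _∷_; _++_; [_]; length; filter; map; concatMap; foldr; allFin; upTo; reverse; replicate)
import Data.List as List
import Data.List.Properties as Listₚ
open import Data.List.Membership.Propositional using (_∈_; _∉_; find)
import Data.List.Membership.Propositional.Properties as ∈ₚ
open import Data.List.Relation.Unary.All as All using (All; []; _∷_)
import Data.List.Relation.Unary.All.Properties as Allₚ
open import Data.List.Relation.Unary.Any as Any using (Any; here; there; _─_)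
import Data.List.Relation.Unary.Any.Properties as Anyₚ
open import Data.List.Relation.Unary.AllPairs as AllPairs using (AllPairs; []; _∷_)
import Data.List.Relation.Unary.AllPairs.Properties as AllPairsₚ
open import Data.List.Relation.Unary.Linked using (Linked; []; [-]; _∷_)
import Data.List.Relation.Unary.Linked.Properties as Linkedₚ
open import Data.List.Relation.Unary.Unique.Propositional using (Unique)
import Data.List.Relation.Unary.Unique.Propositional.Properties as Uniqueₚ
open import Data.List.Relation.Binary.Permutation.Propositional as ↭ using (_↭_; ↭-refl; ↭-sym; ↭-trans; ↭-reflexive)
import Data.List.Relation.Binary.Permutation.Propositional.Properties as ↭ₚ
open import Data.Product using (Σ; ∃; _×_; _,_; proj₁; proj₂)
open import Data.Sum using (_⊎_; inj₁; inj₂)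
open import Data.Empty using (⊥; ⊥-elim)
open import Data.Unit using (⊤; tt)
open import Relation.Nullary using (¬_; Dec; yes; no; does; contradiction)
open import Relation.Nullary.Decidable using (dec-true; dec-false)
open import Relation.Unary using (Pred)
open import Relation.Binary.PropositionalEquality as ≡ using (_≡_; _≢_; refl; cong; cong₂; subst)
open import Relation.Binary.Structures using (IsTotalOrder)
import Algebra.Properties.Ring as RingProperties
import Algebra.Properties.AbelianGroup as AbelianGroupProperties
import Algebra.Properties.CommutativeSemigroup as CommutativeSemigroupProperties
import Relation.Binary.Reasoning.Setoid as SetoidReasoning
open import Function.Bundles using (mk⇔)
import Data.List.Relation.Binary.Permutation.Setoid.Properties as PermutationSetoidProperties
open import Data.List.Relation.Binary.BagAndSetEquality using (∼bag⇒↭)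
open import Data.List.Membership.Propositional.Properties.WithK using (unique∧set⇒bag)
open import Data.Bool.ListAction using (and)
open import Data.List.Relation.Binary.Disjoint.Propositional using (Disjoint)
open import Data.Nat.ListAction using (sum)

-- Why symmetrise: moving reverse T back to T produces coarser forests whose coefficients need not
-- be matched by any drop in weight, so a repeated eigenvalue along such an edge could not be
-- excluded. On P_T + P_{reverse T} reversal is exact, and the only corrections left come from
-- sorting, where a colouring of type α that is lost accounts for both the factor γ_α and the drop.
-- The price is a division by 2 when passing back from symmetrised to plain forests.
--
-- Equality in K is not assumed decidable, so the induction cannot ask whether some γ_α vanishes. It
-- carries a scalar d instead, the product of the coefficients γ_α along the path followed so far,
-- and shows that d times the value is 0. If an eigenvalue already used up reappears, the last γ_α
-- is proved to be 0, and so is d. Signs matter here: equal eigenvalues may belong to weights of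
-- opposite sign, and then nonnegativity makes both weights vanish.
--
-- Forests are handled as functionals on functions of words, so identities of the free algebra
-- become identities between finite signed sums.

-- Stable sorting of words by colour.

module _ {A : Set} (col : A → ℕ) where

  -- A new letter goes in front of the letters of its own colour. As `foldr` inserts from the right,
  -- equal colours keep their order and the sort is stable.
  insertBy : A → List A → List A
  insertBy a [] = a ∷ []
  insertBy a (b ∷ l) with col a ℕ.≤? col b
  ... | yes _ = a ∷ b ∷ l
  ... | no  _ = b ∷ insertBy a l

  sortBy : List A → List A
  sortBy = foldr insertBy []

  insertBy-≤ : ∀ {a b} l → col a ℕ.≤ col b → insertBy a (b ∷ l) ≡ a ∷ b ∷ l
  insertBy-≤ {a} {b} l a≤b with col a ℕ.≤? col b
  ... | yes _  = refl
  ... | no a≰b = contradiction a≤b a≰b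

  insertBy-> : ∀ {a b} l → col b ℕ.< col a → insertBy a (b ∷ l) ≡ b ∷ insertBy a l
  insertBy-> {a} {b} l b<a with col a ℕ.≤? col b
  ... | yes a≤b = contradiction a≤b (ℕₚ.<⇒≱ b<a)
  ... | no  _   = refl

  insertBy-comm-< : ∀ {a b} l → col a ℕ.< col b →
                    insertBy a (insertBy b l) ≡ insertBy b (insertBy a l)
  insertBy-comm-< {a} {b} [] a<b =
    ≡.trans (insertBy-≤ [] (ℕₚ.<⇒≤ a<b)) (≡.sym (insertBy-> [] a<b))
  insertBy-comm-< {a} {b} (c ∷ l) a<b with ℕₚ.≤-<-connex (col b) (col c) | ℕₚ.≤-<-connex (col a) (col c)
  ... | inj₁ b≤c | inj₂ c<a = contradiction (ℕₚ.<-≤-trans a<b b≤c) (ℕₚ.<⇒≯ c<a)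
  ... | inj₁ b≤c | inj₁ a≤c
    rewrite insertBy-≤ l b≤c | insertBy-≤ l a≤c | insertBy-≤ (c ∷ l) (ℕₚ.<⇒≤ a<b)
          | insertBy-> (c ∷ l) a<b | insertBy-≤ l b≤c = refl
  ... | inj₂ c<b | inj₁ a≤c
    rewrite insertBy-> l c<b | insertBy-≤ l a≤c | insertBy-≤ (insertBy b l) a≤c
          | insertBy-> (c ∷ l) a<b | insertBy-> l c<b = refl
  ... | inj₂ c<b | inj₂ c<a
    rewrite insertBy-> l c<b | insertBy-> l c<a | insertBy-> (insertBy b l) c<a
          | insertBy-> (insertBy a l) c<b = cong (c ∷_) (insertBy-comm-< l a<b)

  insertBy-comm : ∀ {a b} l → col a ≢ col b →
                  insertBy a (insertBy b l) ≡ insertBy b (insertBy a l)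
  insertBy-comm {a} {b} l a≢b = case ℕₚ.≤-<-connex (col a) (col b) of λ where
    (inj₁ a≤b) → insertBy-comm-< l (ℕₚ.≤∧≢⇒< a≤b a≢b)
    (inj₂ b<a) → ≡.sym (insertBy-comm-< l b<a)

  insertBy-↭ : ∀ a l → insertBy a l ↭ a ∷ l
  insertBy-↭ a [] = ↭-refl
  insertBy-↭ a (b ∷ l) with col a ℕ.≤? col b
  ... | yes _ = ↭-refl
  ... | no  _ = ↭-trans (↭.prep b (insertBy-↭ a l)) (↭.swap b a ↭-refl)

  sortBy-↭ : ∀ l → sortBy l ↭ l
  sortBy-↭ []      = ↭-refl
  sortBy-↭ (a ∷ l) = ↭-trans (insertBy-↭ a (sortBy l)) (↭.prep a (sortBy-↭ l))

  sortBy-fixed : ∀ {l} → AllPairs (λ a b → col a ℕ.≤ col b) l → sortBy l ≡ l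
  sortBy-fixed [] = refl
  sortBy-fixed (_∷_ {x = a} [] []) = refl
  sortBy-fixed (_∷_ {x = a} (a≤b ∷ _) s@(_∷_ {xs = l} _ _)) =
    ≡.trans (cong (insertBy a) (sortBy-fixed s)) (insertBy-≤ l a≤b)

  module _ {ℓ} (R : A → A → Set ℓ) where

    Lex : A → A → Set ℓ
    Lex a b = col a ℕ.< col b ⊎ (col a ≡ col b × R a b)

    Lex⇒≤ : ∀ {a b} → Lex a b → col a ℕ.≤ col b
    Lex⇒≤ (inj₁ a<b)       = ℕₚ.<⇒≤ a<b
    Lex⇒≤ (inj₂ (a≡b , _)) = ℕₚ.≤-reflexive a≡b

    ≤⇒Lex : ∀ {a b} → col a ℕ.≤ col b → R a b → Lex a b
    ≤⇒Lex a≤b r = case ℕₚ.m≤n⇒m<n∨m≡n a≤b of λ where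
      (inj₁ a<b) → inj₁ a<b
      (inj₂ a≡b) → inj₂ (a≡b , r)

    insertBy-lex : ∀ {a l} → All (R a) l → AllPairs Lex l → AllPairs Lex (insertBy a l)
    insertBy-lex [] [] = [] ∷ []
    insertBy-lex {a} {b ∷ l} (r ∷ rs) (p ∷ ps) with col a ℕ.≤? col b
    ... | yes a≤b = (≤⇒Lex a≤b r ∷ All.zipWith (λ (x , y) → ≤⇒Lex (ℕₚ.≤-trans a≤b (Lex⇒≤ x)) y) (p , rs))
                    ∷ p ∷ ps
    ... | no a≰b  = ↭ₚ.All-resp-↭ (↭-sym (insertBy-↭ a l)) (inj₁ (ℕₚ.≰⇒> a≰b) ∷ p)
                    ∷ insertBy-lex rs ps

    -- This is stability. With R the order of positions in the input, `Lex` is strict and pins down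
    -- the sorted word by `sorted-unique`.
    sortBy-lex : ∀ {l} → AllPairs R l → AllPairs Lex (sortBy l)
    sortBy-lex [] = []
    sortBy-lex (_∷_ {xs = l} r rs) =
      insertBy-lex (↭ₚ.All-resp-↭ (↭-sym (sortBy-↭ l)) r) (sortBy-lex rs)

  sortBy-sorted : ∀ l → AllPairs (λ a b → col a ℕ.≤ col b) (sortBy l)
  sortBy-sorted l =
    AllPairs.map (Lex⇒≤ (λ _ _ → ⊤)) (sortBy-lex (λ _ _ → ⊤) (trivial l))
    where
    trivial : ∀ l → AllPairs (λ (_ _ : A) → ⊤) l
    trivial []      = []
    trivial (_ ∷ l) = All.universal (λ _ → tt) l ∷ trivial l

  infix 4 _≋_
  -- Quantifying over every accumulator, instead of comparing `sortBy v` and `sortBy w`, makes this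
  -- a congruence for concatenation on both sides.
  record _≋_ (v w : List A) : Set where
    constructor foldr-≡
    field foldr≡ : ∀ l → foldr insertBy l v ≡ foldr insertBy l w
  open _≋_

  ≋⇒sortBy≡ : ∀ {v w} → v ≋ w → sortBy v ≡ sortBy w
  ≋⇒sortBy≡ v≋w = foldr≡ v≋w []

  ≋-++ʳ : ∀ {v w} z → v ≋ w → v ++ z ≋ w ++ z
  ≋-++ʳ {v} {w} z v≋w = foldr-≡ λ l →
    ≡.trans (Listₚ.foldr-++ insertBy l v z)
            (≡.trans (foldr≡ v≋w _) (≡.sym (Listₚ.foldr-++ insertBy l w z)))

  ≋-++ˡ : ∀ {v w} z → v ≋ w → z ++ v ≋ z ++ w
  ≋-++ˡ {v} {w} z v≋w = foldr-≡ λ l →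
    ≡.trans (Listₚ.foldr-++ insertBy l z v)
            (≡.trans (cong (λ m → foldr insertBy m z) (foldr≡ v≋w l))
                     (≡.sym (Listₚ.foldr-++ insertBy l z w)))

  insertBy-foldr-comm : ∀ {a} w → All (λ b → col a ≢ col b) w →
    ∀ l → insertBy a (foldr insertBy l w) ≡ foldr insertBy (insertBy a l) w
  insertBy-foldr-comm []      []         l = refl
  insertBy-foldr-comm (b ∷ w) (a≢b ∷ ps) l =
    ≡.trans (insertBy-comm (foldr insertBy l w) a≢b)
            (cong (insertBy b) (insertBy-foldr-comm w ps l))

  -- Insertions of letters of different colours commute. This is what annihilates the bracket of two
  -- differently coloured trees.
  ++-comm-≋ : ∀ v w → All (λ a → All (λ b → col a ≢ col b) w) v → v ++ w ≋ w ++ v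
  ++-comm-≋ [] w [] = foldr-≡ λ l → cong (foldr insertBy l) (≡.sym (Listₚ.++-identityʳ w))
  ++-comm-≋ (a ∷ v) w (p ∷ ps) = foldr-≡ λ l →
    ≡.trans (cong (insertBy a) (≡.trans (foldr≡ (++-comm-≋ v w ps) l) (Listₚ.foldr-++ insertBy l w v)))
            (≡.trans (insertBy-foldr-comm w p (foldr insertBy l v))
                     (≡.sym (Listₚ.foldr-++ insertBy l w (a ∷ v))))

-- If the heads a and b differed, each would lie in the tail of the other list, giving both R a b
-- and S b a. Two relations are allowed because in the applications one order is strict and the
-- other weak.
sorted-unique : ∀ {A : Set} {r s} {R : A → A → Set r} {S : A → A → Set s} →
  (∀ {a b} → R a b → S b a → ⊥) → ∀ {l m} → AllPairs R l → AllPairs S m → l ↭ m → l ≡ m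
sorted-unique asym [] ms l↭m = ≡.sym (↭ₚ.↭-empty-inv (↭-sym l↭m))
sorted-unique asym (l ∷ ls) [] l↭m = contradiction l↭m ↭ₚ.¬x∷xs↭[]
sorted-unique asym {a ∷ l} {b ∷ m} (p ∷ ps) (q ∷ qs) l↭m
  with ↭ₚ.∈-resp-↭ l↭m (here refl) | ↭ₚ.∈-resp-↭ (↭-sym l↭m) (here refl)
... | here refl | _          = cong (a ∷_) (sorted-unique asym ps qs (↭ₚ.drop-∷ l↭m))
... | there _   | here refl  = cong (a ∷_) (sorted-unique asym ps qs (↭ₚ.drop-∷ l↭m))
... | there a∈m | there b∈l  = ⊥-elim (asym (All.lookup p b∈l) (All.lookup q a∈m))

-- Trees, forests, and the coarser forests left behind by reordering.

infixr 6 _∙_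
data Tree (A : Set) : Set where
  leaf : A → Tree A
  _∙_  : Tree A → Tree A → Tree A

module _ {A : Set} where

  leaves : Tree A → List A
  leaves (leaf a) = a ∷ []
  leaves (t ∙ u)  = leaves t ++ leaves u

  firstLeaf : Tree A → A
  firstLeaf (leaf a) = a
  firstLeaf (t ∙ u)  = firstLeaf t

  firstLeaf∈leaves : ∀ t → firstLeaf t ∈ leaves t
  firstLeaf∈leaves (leaf a) = here refl
  firstLeaf∈leaves (t ∙ u)  = ∈ₚ.∈-++⁺ˡ (firstLeaf∈leaves t)

  leavesF : List (Tree A) → List A
  leavesF = concatMap leaves

  leavesF-map-leaf : ∀ r → leavesF (map leaf r) ≡ r
  leavesF-map-leaf []      = refl
  leavesF-map-leaf (a ∷ r) = cong (a ∷_) (leavesF-map-leaf r)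

  leavesF-↭ : ∀ {S T} → S ↭ T → leavesF S ↭ leavesF T
  leavesF-↭ ↭.refl = ↭-refl
  leavesF-↭ (↭.prep t p) = ↭ₚ.++⁺ˡ (leaves t) (leavesF-↭ p)
  leavesF-↭ (↭.swap t u p) =
    ↭-trans (↭ₚ.shifts (leaves t) (leaves u)) (↭ₚ.++⁺ˡ (leaves u) (↭ₚ.++⁺ˡ (leaves t) (leavesF-↭ p)))
  leavesF-↭ (↭.trans p q) = ↭-trans (leavesF-↭ p) (leavesF-↭ q)

  module _ (col : A → ℕ) where

    Mono : Tree A → Set
    Mono t = All (λ a → col a ≡ col (firstLeaf t)) (leaves t)

    Compat : List (Tree A) → Set
    Compat = All Mono

    mono? : ∀ t → Dec (Mono t)
    mono? t = All.all? (λ a → col a ℕ.≟ col (firstLeaf t)) (leaves t)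

    compat? : ∀ T → Dec (Compat T)
    compat? = All.all? mono?

    mono-∙⁻ : ∀ {t u} → Mono (t ∙ u) → Mono t × Mono u
    mono-∙⁻ {t} {u} m =
      Allₚ.++⁻ˡ (leaves t) m ,
      All.map (λ e → ≡.trans e (≡.sym (All.lookup mu (firstLeaf∈leaves u)))) mu
      where mu = Allₚ.++⁻ʳ (leaves t) m

    mono-∙⇒≡ : ∀ {t u} → Mono (t ∙ u) → col (firstLeaf t) ≡ col (firstLeaf u)
    mono-∙⇒≡ {t} {u} m = ≡.sym (All.lookup (Allₚ.++⁻ʳ (leaves t) m) (firstLeaf∈leaves u))

    mono-∙⁺ : ∀ {t u} → Mono t → Mono u → col (firstLeaf t) ≡ col (firstLeaf u) → Mono (t ∙ u)
    mono-∙⁺ mt mu e = Allₚ.++⁺ mt (All.map (λ p → ≡.trans p (≡.sym e)) mu)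

  -- The transpositions are kept as data because each interchange of t and u leaves a correction,
  -- the forest with t and u bracketed, which `residuals` collects. P restricts the admissible
  -- interchanges: different colours for sorting, no restriction for undoing a reversal.
  data Reorder (P : Tree A → Tree A → Set) : List (Tree A) → List (Tree A) → Set where
    done  : ∀ {T} → Reorder P T T
    prep  : ∀ t {S T} → Reorder P S T → Reorder P (t ∷ S) (t ∷ T)
    swap  : ∀ t u T → P t u → Reorder P (t ∷ u ∷ T) (u ∷ t ∷ T)
    _then_ : ∀ {R S T} → Reorder P R S → Reorder P S T → Reorder P R T

  residuals : ∀ {P S T} → Reorder P S T → List (List (Tree A))
  residuals done           = []
  residuals (prep t r)     = map (t ∷_) (residuals r)
  residuals (swap t u T _) = [ (t ∙ u) ∷ T ]
  residuals (r then s)     = residuals r ++ residuals s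

  Reorder⇒↭ : ∀ {P S T} → Reorder P S T → S ↭ T
  Reorder⇒↭ done           = ↭-refl
  Reorder⇒↭ (prep t r)     = ↭.prep t (Reorder⇒↭ r)
  Reorder⇒↭ (swap t u T _) = ↭.swap t u ↭-refl
  Reorder⇒↭ (r then s)     = ↭-trans (Reorder⇒↭ r) (Reorder⇒↭ s)

  ↭⇒Reorder : ∀ {S T} → S ↭ T → Reorder (λ _ _ → ⊤) S T
  ↭⇒Reorder ↭.refl = done
  ↭⇒Reorder (↭.prep t p) = prep t (↭⇒Reorder p)
  ↭⇒Reorder (↭.swap t u p) = swap t u _ tt then prep u (prep t (↭⇒Reorder p))
  ↭⇒Reorder (↭.trans p q) = ↭⇒Reorder p then ↭⇒Reorder q

  -- T is coarser than S. No sequence of mergers is recorded, only its two consequences: validity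
  -- passes from S to T, and the compatible colourings become fewer.
  record _⊑_ (S T : List (Tree A)) : Set where
    field
      leaves-↭  : leavesF T ↭ leavesF S
      compat-⇐  : ∀ col → Compat col T → Compat col S
  open _⊑_ public

  ⊑-refl : ∀ {T} → T ⊑ T
  ⊑-refl = record { leaves-↭ = ↭-refl ; compat-⇐ = λ _ p → p }

  ⊑-trans : ∀ {R S T} → R ⊑ S → S ⊑ T → R ⊑ T
  ⊑-trans p q = record
    { leaves-↭ = ↭-trans (leaves-↭ q) (leaves-↭ p)
    ; compat-⇐ = λ col → compat-⇐ p col ∘ compat-⇐ q col }

  ↭⇒⊑ : ∀ {S T} → S ↭ T → S ⊑ T
  ↭⇒⊑ p = record
    { leaves-↭ = leavesF-↭ (↭-sym p)
    ; compat-⇐ = λ col → ↭ₚ.All-resp-↭ (↭-sym p) }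

  ⊑-prep : ∀ t {S T} → S ⊑ T → (t ∷ S) ⊑ (t ∷ T)
  ⊑-prep t p = record
    { leaves-↭ = ↭ₚ.++⁺ˡ (leaves t) (leaves-↭ p)
    ; compat-⇐ = λ { col (m ∷ ms) → m ∷ compat-⇐ p col ms } }

  ⊑-merge : ∀ t u T → (t ∷ u ∷ T) ⊑ ((t ∙ u) ∷ T)
  ⊑-merge t u T = record
    { leaves-↭ = ↭-reflexive (Listₚ.++-assoc (leaves t) (leaves u) (leavesF T))
    ; compat-⇐ = λ { col (m ∷ ms) → let mt , mu = mono-∙⁻ col {t} {u} m in mt ∷ mu ∷ ms } }

  residuals-⊑ : ∀ {P S T} (r : Reorder P S T) → All (S ⊑_) (residuals r)
  residuals-⊑ done           = []
  residuals-⊑ (prep t r)     = Allₚ.map⁺ (All.map (⊑-prep t) (residuals-⊑ r))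
  residuals-⊑ (swap t u T _) = ⊑-merge t u T ∷ []
  residuals-⊑ (r then s)     =
    Allₚ.++⁺ (residuals-⊑ r) (All.map (⊑-trans (↭⇒⊑ (Reorder⇒↭ r))) (residuals-⊑ s))

  -- A merger lowers the number of trees, which makes recursion along residuals terminate.
  residuals-length : ∀ {P S T} (r : Reorder P S T) → All (λ R → length R ℕ.< length S) (residuals r)
  residuals-length done           = []
  residuals-length (prep t r)     = Allₚ.map⁺ (All.map s<s (residuals-length r))
  residuals-length (swap t u T _) = ℕₚ.≤-refl ∷ []
  residuals-length (r then s)     =
    Allₚ.++⁺ (residuals-length r)
             (All.map (λ p → ℕₚ.≤-trans p (ℕₚ.≤-reflexive (≡.sym (↭ₚ.↭-length (Reorder⇒↭ r))))) (residuals-length s))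

  module _ (col : A → ℕ) where

    DiffCol : Tree A → Tree A → Set
    DiffCol t u = col (firstLeaf t) ≢ col (firstLeaf u)

    -- Each residual contains a tree formed by bracketing two trees whose first leaves have
    -- different colours, and further mergers or reorderings never separate them.
    residuals-¬compat : ∀ {S T} (r : Reorder DiffCol S T) → All (λ R → ¬ Compat col R) (residuals r)
    residuals-¬compat done           = []
    residuals-¬compat (prep t r)     = Allₚ.map⁺ (All.map (λ ¬c c → ¬c (All.tail c)) (residuals-¬compat r))
    residuals-¬compat (swap t u T d) = (λ c → d (mono-∙⇒≡ col {t} {u} (All.head c))) ∷ []
    residuals-¬compat (r then s)     = Allₚ.++⁺ (residuals-¬compat r) (residuals-¬compat s)

    sortF : List (Tree A) → List (Tree A)
    sortF = sortBy (col ∘ firstLeaf)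

    insert-reorder : ∀ t T → Reorder DiffCol (t ∷ T) (insertBy (col ∘ firstLeaf) t T)
    insert-reorder t [] = done
    insert-reorder t (u ∷ T) with col (firstLeaf t) ℕ.≤? col (firstLeaf u)
    ... | yes _  = done
    ... | no t≰u = swap t u T (λ e → t≰u (ℕₚ.≤-reflexive e)) then prep u (insert-reorder t T)

    sort-reorder : ∀ T → Reorder DiffCol T (sortF T)
    sort-reorder []      = done
    sort-reorder (t ∷ T) = prep t (sort-reorder T) then insert-reorder t (sortF T)

  -- A superset of the words in the expansion of the product: each factor may be any arrangement of
  -- the leaves of its tree, whatever the bracketing.
  data IsWord : List (Tree A) → List A → Set where
    []  : IsWord [] []
    _∷_ : ∀ {t T v w} → v ↭ leaves t → IsWord T w → IsWord (t ∷ T) (v ++ w)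

  IsWord⇒↭ : ∀ {T w} → IsWord T w → w ↭ leavesF T
  IsWord⇒↭ []       = ↭-refl
  IsWord⇒↭ (p ∷ ps) = ↭ₚ.++⁺ p (IsWord⇒↭ ps)

  IsWord-sorted : ∀ col {T w} → Compat col T →
    AllPairs (λ t u → col (firstLeaf t) ℕ.≤ col (firstLeaf u)) T →
    IsWord T w → AllPairs (λ a b → col a ℕ.≤ col b) w
  IsWord-sorted col [] [] [] = []
  IsWord-sorted col {t ∷ T} (m ∷ ms) (p ∷ ps) (_∷_ {v = v} {w} v↭ ws) =
    AllPairsₚ.++⁺ (constant v mv) (IsWord-sorted col ms ps ws)
      (All.map (λ e → All.map (λ q → ℕₚ.≤-trans (ℕₚ.≤-reflexive e) q) above) mv)
    where
    mv : All (λ a → col a ≡ col (firstLeaf t)) v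
    mv = ↭ₚ.All-resp-↭ (↭-sym v↭) m

    constant : ∀ v → All (λ a → col a ≡ col (firstLeaf t)) v → AllPairs (λ a b → col a ℕ.≤ col b) v
    constant []      []       = []
    constant (a ∷ v) (e ∷ es) =
      All.map (λ e′ → ℕₚ.≤-reflexive (≡.trans e (≡.sym e′))) es ∷ constant v es

    above : All (λ a → col (firstLeaf t) ℕ.≤ col a) w
    above = ↭ₚ.All-resp-↭ (↭-sym (IsWord⇒↭ ws)) (Allₚ.concat⁺ (Allₚ.map⁺
      (All.zipWith (λ (q , mu) → All.map (λ e → ℕₚ.≤-trans q (ℕₚ.≤-reflexive (≡.sym e))) mu) (p , ms))))

-- Signs, finite sums and linear functionals over an ordered field.

module FieldSums {c ℓ₁ ℓ₂} (K : OrderedField c ℓ₁ ℓ₂) where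

  open OrderedField K public
    renaming (refl to ≈-refl; sym to ≈-sym; trans to ≈-trans; reflexive to ≈-reflexive; _≤_ to infix 4 _≤_)
    hiding (zero)
  open RingProperties ring public
    using (-1*x≈-x; -‿distribˡ-*; x[y-z]≈xy-xz; [y-z]x≈yx-zx)
  open AbelianGroupProperties +-abelianGroup public
    using () renaming (⁻¹-∙-comm to -‿+-comm; ⁻¹-involutive to -‿involutive; ε⁻¹≈ε to -0≈0;
                       x∙y⁻¹≈ε⇒x≈y to x-y≈0⇒x≈y; xyx⁻¹≈y to x+y-x≈y)
  open CommutativeSemigroupProperties +-commutativeSemigroup public
    using () renaming (interchange to +-interchange)
  open CommutativeSemigroupProperties *-commutativeSemigroup public
    using () renaming (x∙yz≈y∙xz to x*yz≈y*xz)
  open IsTotalOrder isTotalOrder public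
    using (total; antisym; ≤-respˡ-≈; ≤-respʳ-≈)
    renaming (refl to ≤-refl; trans to ≤-trans; reflexive to ≤-reflexive)
  open SetoidReasoning setoid public

  Fun : Set → Set c
  Fun W = W → Carrier

  -‿interchange : ∀ a b c d → (a + b) - (c + d) ≈ (a - c) + (b - d)
  -‿interchange a b c d =
    ≈-trans (+-congˡ (≈-sym (-‿+-comm c d))) (+-interchange a b (- c) (- d))

  x+[y-x]≈y : ∀ x y → x + (y - x) ≈ y
  x+[y-x]≈y x y = ≈-trans (≈-sym (+-assoc x y (- x))) (x+y-x≈y x y)

  0-cong : ∀ {x y} → x ≈ 0# → y ≈ 0# → x + y ≈ 0#
  0-cong p q = ≈-trans (+-cong p q) (+-identityˡ 0#)

  *-zeroʳ-cong : ∀ {x y} → y ≈ 0# → x * y ≈ 0#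
  *-zeroʳ-cong p = ≈-trans (*-congˡ p) (zeroʳ _)

  *-zeroˡ-cong : ∀ {x y} → x ≈ 0# → x * y ≈ 0#
  *-zeroˡ-cong p = ≈-trans (*-congʳ p) (zeroˡ _)

  +-mono : ∀ {w x y z} → w ≤ x → y ≤ z → w + y ≤ x + z
  +-mono {w} {x} {y} {z} p q = ≤-trans (+-mono-≤ y p)
    (≤-respˡ-≈ (+-comm y x) (≤-respʳ-≈ (+-comm z x) (+-mono-≤ x q)))

  x≤0⇒0≤-x : ∀ {x} → x ≤ 0# → 0# ≤ - x
  x≤0⇒0≤-x {x} p = ≤-respˡ-≈ (-‿inverseʳ x) (≤-respʳ-≈ (+-identityˡ (- x)) (+-mono-≤ (- x) p))

  0≤-x⇒x≤0 : ∀ {x} → 0# ≤ - x → x ≤ 0#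
  0≤-x⇒x≤0 {x} p = ≤-respˡ-≈ (+-identityˡ x) (≤-respʳ-≈ (-‿inverseˡ x) (+-mono-≤ x p))

  0≤1 : 0# ≤ 1#
  0≤1 with total 0# 1#
  ... | inj₁ p = p
  ... | inj₂ p = ≤-respʳ-≈ (begin
    - 1# * - 1#    ≈⟨ -1*x≈-x (- 1#) ⟩
    - (- 1#)       ≈⟨ -‿involutive 1# ⟩
    1#             ∎) (*-nonneg (x≤0⇒0≤-x p) (x≤0⇒0≤-x p))

  *-monoˡ-≤ : ∀ {a x y} → 0# ≤ a → x ≤ y → a * x ≤ a * y
  *-monoˡ-≤ {a} {x} {y} 0≤a x≤y =
    ≤-respˡ-≈ (+-identityˡ (a * x)) (≤-respʳ-≈ (begin
      a * (y - x) + a * x      ≈⟨ distribˡ a (y - x) x ⟨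
      a * ((y - x) + x)        ≈⟨ *-congˡ (≈-trans (+-comm _ _) (x+[y-x]≈y x y)) ⟩
      a * y                    ∎)
    (+-mono-≤ (a * x) (*-nonneg 0≤a 0≤y-x)))
    where
    0≤y-x : 0# ≤ y - x
    0≤y-x = ≤-respˡ-≈ (-‿inverseʳ x) (+-mono-≤ (- x) x≤y)

  -- The order makes 2 invertible. Needed because a symmetrised forest is twice the plain one modulo
  -- coarser forests.
  x+x≈0⇒x≈0 : ∀ {x} → x + x ≈ 0# → x ≈ 0#
  x+x≈0⇒x≈0 {x} p with inverse (1# + 1#) 2≉0
    where
    2≉0 : ¬ (1# + 1# ≈ 0#)
    2≉0 q = 0≉1 (antisym 0≤1 (≤-respˡ-≈ (+-identityʳ 1#) (≤-respʳ-≈ q (+-mono ≤-refl 0≤1))))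
  ... | h , e = begin
    x                    ≈⟨ *-identityˡ x ⟨
    1# * x               ≈⟨ *-congʳ e ⟨
    (1# + 1#) * h * x    ≈⟨ *-congʳ (*-comm _ h) ⟩
    h * (1# + 1#) * x    ≈⟨ *-assoc h _ x ⟩
    h * ((1# + 1#) * x)  ≈⟨ *-congˡ (distribʳ x 1# 1#) ⟩
    h * (1# * x + 1# * x) ≈⟨ *-congˡ (+-cong (*-identityˡ x) (*-identityˡ x)) ⟩
    h * (x + x)          ≈⟨ *-zeroʳ-cong p ⟩
    0#                   ∎

  signK-sign : ∀ k → (∀ x → signK K k x ≡ x) ⊎ (∀ x → signK K k x ≡ - x)
  signK-sign zero          = inj₁ (λ _ → refl)
  signK-sign (suc zero)    = inj₂ (λ _ → refl)
  signK-sign (suc (suc k)) = signK-sign k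

  signK-suc : ∀ k x → signK K (suc k) x ≈ - signK K k x
  signK-suc zero          x = ≈-refl
  signK-suc (suc zero)    x = ≈-sym (-‿involutive x)
  signK-suc (suc (suc k)) x = signK-suc k x

  sgn : ℕ → Carrier
  sgn k = signK K k 1#

  signK≈sgn* : ∀ k x → signK K k x ≈ sgn k * x
  signK≈sgn* k x with signK-sign k
  ... | inj₁ p rewrite p x | p 1# = ≈-sym (*-identityˡ x)
  ... | inj₂ p rewrite p x | p 1# = ≈-sym (-1*x≈-x x)

  sgn-+ : ∀ j k → sgn (j ℕ.+ k) ≈ sgn j * sgn k
  sgn-+ zero    k = ≈-sym (*-identityˡ _)
  sgn-+ (suc j) k = begin
    sgn (suc (j ℕ.+ k))  ≈⟨ signK-suc (j ℕ.+ k) 1# ⟩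
    - sgn (j ℕ.+ k)      ≈⟨ -‿cong (sgn-+ j k) ⟩
    - (sgn j * sgn k)    ≈⟨ -‿distribˡ-* _ _ ⟩
    - sgn j * sgn k      ≈⟨ *-congʳ (signK-suc j 1#) ⟨
    sgn (suc j) * sgn k  ∎

  when : Bool → Carrier → Carrier
  when b x = if b then x else 0#

  when-* : ∀ b x → when b x ≈ when b 1# * x
  when-* true  x = ≈-sym (*-identityˡ x)
  when-* false x = ≈-sym (zeroˡ x)

  when-∧ : ∀ b b′ x → when (b ∧ b′) x ≡ when b (when b′ x)
  when-∧ true  b′ x = refl
  when-∧ false b′ x = refl

  when-cong : ∀ b {x y} → x ≈ y → when b x ≈ when b y
  when-cong true  p = p
  when-cong false p = ≈-refl

  module _ {a} {A : Set a} where

    ∑ : List A → (A → Carrier) → Carrier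
    ∑ l f = sumK K (map f l)

    ∑-cong : ∀ l {f g} → (∀ {x} → x ∈ l → f x ≈ g x) → ∑ l f ≈ ∑ l g
    ∑-cong []      p = ≈-refl
    ∑-cong (_ ∷ l) p = +-cong (p (here refl)) (∑-cong l (p ∘ there))

    ∑-zero : ∀ l {f} → (∀ {x} → x ∈ l → f x ≈ 0#) → ∑ l f ≈ 0#
    ∑-zero []      p = ≈-refl
    ∑-zero (_ ∷ l) p = 0-cong (p (here refl)) (∑-zero l (p ∘ there))

    ∑-+ : ∀ l f g → ∑ l (λ x → f x + g x) ≈ ∑ l f + ∑ l g
    ∑-+ []      f g = ≈-sym (+-identityˡ 0#)
    ∑-+ (x ∷ l) f g = ≈-trans (+-congˡ (∑-+ l f g)) (+-interchange _ _ _ _)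

    ∑-* : ∀ k l f → k * ∑ l f ≈ ∑ l (λ x → k * f x)
    ∑-* k []      f = zeroʳ k
    ∑-* k (x ∷ l) f = ≈-trans (distribˡ k _ _) (+-congˡ (∑-* k l f))

    ∑-*ʳ : ∀ k l f → ∑ l f * k ≈ ∑ l (λ x → f x * k)
    ∑-*ʳ k l f = ≈-trans (*-comm _ k) (≈-trans (∑-* k l f) (∑-cong l (λ _ → *-comm k _)))

    ∑-++ : ∀ l m f → ∑ (l ++ m) f ≈ ∑ l f + ∑ m f
    ∑-++ []      m f = ≈-sym (+-identityˡ _)
    ∑-++ (x ∷ l) m f = ≈-trans (+-congˡ (∑-++ l m f)) (≈-sym (+-assoc _ _ _))

    ∑-single : ∀ {l a f} → Unique l → a ∈ l → (∀ {x} → x ∈ l → x ≢ a → f x ≈ 0#) → ∑ l f ≈ f a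
    ∑-single {x ∷ l} (x∉ ∷ u) (here refl) p =
      ≈-trans (+-congˡ (∑-zero l (λ y∈ → p (there y∈) (All.lookup x∉ y∈ ∘ ≡.sym)))) (+-identityʳ _)
    ∑-single {x ∷ l} (x∉ ∷ u) (there a∈) p =
      ≈-trans (+-congʳ (p (here refl) (All.lookup x∉ a∈)))
              (≈-trans (+-identityˡ _) (∑-single u a∈ (p ∘ there)))

    ∑-mono : ∀ l {f g} → (∀ {x} → x ∈ l → f x ≤ g x) → ∑ l f ≤ ∑ l g
    ∑-mono []      p = ≤-refl
    ∑-mono (_ ∷ l) p = +-mono (p (here refl)) (∑-mono l (p ∘ there))

    -- Strict monotonicity with an explicit gap k, since the gap will be γ α, about which only
    -- nonnegativity is known.
    ∑-mono-+ : ∀ {l a f g k} → a ∈ l → (∀ {x} → x ∈ l → f x ≤ g x) → f a + k ≤ g a → ∑ l f + k ≤ ∑ l g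
    ∑-mono-+ {x ∷ l} {f = f} {g} {k} (here refl) p q =
      ≤-respˡ-≈ (begin
        (f x + k) + ∑ l f    ≈⟨ +-assoc (f x) k _ ⟩
        f x + (k + ∑ l f)    ≈⟨ +-congˡ (+-comm k _) ⟩
        f x + (∑ l f + k)    ≈⟨ +-assoc (f x) _ k ⟨
        (f x + ∑ l f) + k    ∎) (+-mono q (∑-mono l (p ∘ there)))
    ∑-mono-+ {x ∷ l} (there a∈) p q =
      ≤-respˡ-≈ (≈-sym (+-assoc _ _ _)) (+-mono (p (here refl)) (∑-mono-+ a∈ (p ∘ there) q))

    ∑-nonneg : ∀ l {f} → (∀ {x} → x ∈ l → 0# ≤ f x) → 0# ≤ ∑ l f
    ∑-nonneg []      p = ≤-refl
    ∑-nonneg (x ∷ l) p = ≤-respˡ-≈ (+-identityˡ 0#) (+-mono (p (here refl)) (∑-nonneg l (p ∘ there)))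

    ∑-length-filter : ∀ {P : A → Bool} l →
      ℕ→K K (length (filter (λ x → P x Boolₚ.≟ true) l)) ≈ ∑ l (λ x → when (P x) 1#)
    ∑-length-filter []      = ≈-refl
    ∑-length-filter {P} (x ∷ l) with P x
    ... | true  = +-congˡ (∑-length-filter l)
    ... | false = ≈-trans (∑-length-filter l) (≈-sym (+-identityˡ _))

  module _ {a b} {A : Set a} {B : Set b} where

    ∑-swap : ∀ (l : List A) (m : List B) (f : A → B → Carrier) → ∑ l (λ x → ∑ m (f x)) ≈ ∑ m (λ y → ∑ l (λ x → f x y))
    ∑-swap []      m f = ≈-sym (∑-zero m (λ _ → ≈-refl))
    ∑-swap (x ∷ l) m f =
      ≈-trans (+-congˡ (∑-swap l m f)) (≈-sym (∑-+ m (f x) (λ y → ∑ l (λ x → f x y))))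

    sumK-concatMap : ∀ (l : List A) (m : List B) (f : A → B → Carrier) →
      sumK K (concatMap (λ x → map (f x) m) l) ≈ ∑ l (λ x → ∑ m (f x))
    sumK-concatMap []      m f = ≈-refl
    sumK-concatMap (x ∷ l) m f = ≈-trans (sumK-++ (map (f x) m) _) (+-congˡ (sumK-concatMap l m f))
      where
      sumK-++ : ∀ k l → sumK K (k ++ l) ≈ sumK K k + sumK K l
      sumK-++ []      l = ≈-sym (+-identityˡ _)
      sumK-++ (x ∷ k) l = ≈-trans (+-congˡ (sumK-++ k l)) (≈-sym (+-assoc _ _ _))

    ∑-map : ∀ (f : A → B) l g → ∑ (map f l) g ≡ ∑ l (g ∘ f)
    ∑-map f []      g = refl
    ∑-map f (x ∷ l) g = cong (g (f x) +_) (∑-map f l g)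

  record Linear {W : Set} (L : Fun W → Carrier) : Set (c ⊔ ℓ₁) where
    field
      L-cong : ∀ {x y : Fun W} → (∀ w → x w ≈ y w) → L x ≈ L y
      L-+    : ∀ x y → L (λ w → x w + y w) ≈ L x + L y
      L-*    : ∀ k x → L (λ w → k * x w) ≈ k * L x

    L-0 : L (λ _ → 0#) ≈ 0#
    L-0 = ≈-trans (L-cong (λ _ → ≈-sym (zeroˡ 0#))) (≈-trans (L-* 0# (λ _ → 0#)) (zeroˡ _))

    L-neg : ∀ x → L (λ w → - x w) ≈ - L x
    L-neg x = ≈-trans (L-cong (λ w → ≈-sym (-1*x≈-x (x w)))) (≈-trans (L-* (- 1#) x) (-1*x≈-x _))

    L-sub : ∀ x y → L (λ w → x w - y w) ≈ L x - L y
    L-sub x y = ≈-trans (L-+ x (λ w → - y w)) (+-congˡ (L-neg y))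

    L-∑ : ∀ {a} {A : Set a} (l : List A) (f : A → Fun W) →
          L (λ w → ∑ l (λ i → f i w)) ≈ ∑ l (λ i → L (f i))
    L-∑ []      f = L-0
    L-∑ (i ∷ l) f = ≈-trans (L-+ (f i) _) (+-congˡ (L-∑ l f))

    L-when : ∀ b x → L (λ w → when b (x w)) ≈ when b (L x)
    L-when true  x = ≈-refl
    L-when false x = L-0
  open Linear public

-- Forests as products of Lie brackets: reversal, reordering and sorting.

module TreeEvaluation {c ℓ₁ ℓ₂} (K : OrderedField c ℓ₁ ℓ₂) {A : Set} where

  open FieldSums K

  Forest : Set
  Forest = List (Tree A)

  -- A tree is the Lie bracketing of its leaves, a forest the product of its trees in the
  -- free associative algebra; evalT and evalF extend x linearly and evaluate it there.
  evalT : Tree A → Fun (List A) → Carrier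
  evalT (leaf a) x = x [ a ]
  evalT (t ∙ u)  x = evalT t (λ v → evalT u (λ w → x (v ++ w) - x (w ++ v)))

  evalF : Forest → Fun (List A) → Carrier
  evalF []      x = x []
  evalF (t ∷ T) x = evalT t (λ v → evalF T (λ w → x (v ++ w)))

  evalT-cong : ∀ t {x y} → (∀ v → v ↭ leaves t → x v ≈ y v) → evalT t x ≈ evalT t y
  evalT-cong (leaf a) p = p [ a ] ↭-refl
  evalT-cong (t ∙ u)  p = evalT-cong t λ v v↭ → evalT-cong u λ w w↭ →
    +-cong (p (v ++ w) (↭ₚ.++⁺ v↭ w↭))
           (-‿cong (p (w ++ v) (↭-trans (↭ₚ.++-comm w v) (↭ₚ.++⁺ v↭ w↭))))

  evalT-+ : ∀ t x y → evalT t (λ w → x w + y w) ≈ evalT t x + evalT t y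
  evalT-+ (leaf a) x y = ≈-refl
  evalT-+ (t ∙ u)  x y = ≈-trans
    (evalT-cong t λ v _ → ≈-trans (evalT-cong u λ w _ → -‿interchange _ _ _ _) (evalT-+ u _ _))
    (evalT-+ t _ _)

  evalT-* : ∀ t k x → evalT t (λ w → k * x w) ≈ k * evalT t x
  evalT-* (leaf a) k x = ≈-refl
  evalT-* (t ∙ u)  k x = ≈-trans
    (evalT-cong t λ v _ → ≈-trans (evalT-cong u λ w _ → ≈-sym (x[y-z]≈xy-xz k _ _)) (evalT-* u k _))
    (evalT-* t k _)

  evalT-linear : ∀ t → Linear (evalT t)
  evalT-linear t = record
    { L-cong = λ p → evalT-cong t (λ v _ → p v) ; L-+ = evalT-+ t ; L-* = evalT-* t }

  evalF-cong : ∀ T {x y} → (∀ {w} → IsWord T w → x w ≈ y w) → evalF T x ≈ evalF T y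
  evalF-cong []      p = p []
  evalF-cong (t ∷ T) p = evalT-cong t λ v v↭ → evalF-cong T λ ws → p (v↭ ∷ ws)

  evalF-linear : ∀ T → Linear (evalF T)
  evalF-linear []      = record { L-cong = λ p → p [] ; L-+ = λ _ _ → ≈-refl ; L-* = λ _ _ → ≈-refl }
  evalF-linear (t ∷ T) = record
    { L-cong = λ p → evalF-cong (t ∷ T) (λ {w} _ → p w)
    ; L-+    = λ x y → ≈-trans (evalT-cong t λ v _ → L-+ (evalF-linear T) _ _) (evalT-+ t _ _)
    ; L-*    = λ k x → ≈-trans (evalT-cong t λ v _ → L-* (evalF-linear T) k _) (evalT-* t k _) }

  -- Evaluation at a tree is a finite signed sum of point evaluations, so it commutes with every
  -- linear functional.
  evalT-fubini : ∀ t {W : Set} {L : Fun W → Carrier} → Linear L → (h : List A → Fun W) →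
    evalT t (λ v → L (h v)) ≈ L (λ w → evalT t (λ v → h v w))
  evalT-fubini (leaf a) lin h = ≈-refl
  evalT-fubini (t ∙ u)  lin h = ≈-trans
    (evalT-cong t λ v _ → ≈-trans (evalT-cong u λ w _ → ≈-sym (L-sub lin _ _)) (evalT-fubini u lin _))
    (evalT-fubini t lin _)

  evalF-map-leaf : ∀ r x → evalF (map leaf r) x ≡ x r
  evalF-map-leaf []      x = refl
  evalF-map-leaf (a ∷ r) x = evalF-map-leaf r (x ∘ (a ∷_))

  evalF-∷ʳ : ∀ T t x → evalF (T ++ [ t ]) x ≈ evalT t (λ v → evalF T (λ w → x (w ++ v)))
  evalF-∷ʳ [] t x = evalT-cong t λ v _ → ≈-reflexive (cong x (Listₚ.++-identityʳ v))
  evalF-∷ʳ (u ∷ T) t x = ≈-trans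
    (evalT-cong u λ v _ → evalF-∷ʳ T t (λ w → x (v ++ w)))
    (≈-trans (evalT-fubini u (evalT-linear t) _)
      (evalT-cong t λ w _ → evalT-cong u λ v _ → evalF-cong T λ {z} _ →
        ≈-reflexive (cong x (≡.sym (Listₚ.++-assoc v z w)))))

  nodes : Tree A → ℕ
  nodes (leaf _) = 0
  nodes (t ∙ u)  = suc (nodes t ℕ.+ nodes u)

  nodesF : Forest → ℕ
  nodesF []      = 0
  nodesF (t ∷ T) = nodes t ℕ.+ nodesF T

  length-leaves : ∀ t → length (leaves t) ≡ suc (nodes t)
  length-leaves (leaf a) = refl
  length-leaves (t ∙ u)
    rewrite Listₚ.length-++ (leaves t) {leaves u} | length-leaves t | length-leaves u =
    cong suc (ℕₚ.+-suc (nodes t) (nodes u))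

  length-leavesF : ∀ T → length (leavesF T) ≡ nodesF T ℕ.+ length T
  length-leavesF [] = refl
  length-leavesF (t ∷ T)
    rewrite Listₚ.length-++ (leaves t) {leavesF T} | length-leaves t | length-leavesF T
          | ℕₚ.+-suc (nodes t ℕ.+ nodesF T) (length T) = cong suc (≡.sym (ℕₚ.+-assoc (nodes t) _ _))

  -- Reversal is an antiautomorphism of the free algebra, hence sends [t, u] to minus the bracket of
  -- the reversed factors: one sign per node.
  evalT-reverse : ∀ t x → evalT t (x ∘ reverse) ≈ sgn (nodes t) * evalT t x
  evalT-reverse (leaf a) x = ≈-sym (*-identityˡ _)
  evalT-reverse (t ∙ u) x = begin
    evalT t (λ v → evalT u (λ w → x (reverse (v ++ w)) - x (reverse (w ++ v))))
      ≈⟨ evalT-cong t (λ v _ → evalT-cong u λ w _ → flip v w) ⟩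
    evalT t (λ v → evalT u (λ w → - 1# * y (reverse v) (reverse w)))
      ≈⟨ evalT-cong t (λ v _ → evalT-* u (- 1#) _) ⟩
    evalT t (λ v → - 1# * evalT u (λ w → y (reverse v) (reverse w)))
      ≈⟨ evalT-* t (- 1#) _ ⟩
    - 1# * evalT t (λ v → evalT u (λ w → y (reverse v) (reverse w)))
      ≈⟨ *-congˡ (evalT-cong t λ v _ → evalT-reverse u (y (reverse v))) ⟩
    - 1# * evalT t (λ v → sgn (nodes u) * evalT u (y (reverse v)))
      ≈⟨ *-congˡ (evalT-* t _ _) ⟩
    - 1# * (sgn (nodes u) * evalT t (λ v → evalT u (y (reverse v))))
      ≈⟨ *-congˡ (*-congˡ (evalT-reverse t (λ v → evalT u (y v)))) ⟩
    - 1# * (sgn (nodes u) * (sgn (nodes t) * evalT (t ∙ u) x))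
      ≈⟨ *-congˡ (≈-trans (≈-sym (*-assoc _ _ _)) (*-congʳ (*-comm _ _))) ⟩
    - 1# * (sgn (nodes t) * sgn (nodes u) * evalT (t ∙ u) x)
      ≈⟨ *-assoc _ _ _ ⟨
    - 1# * (sgn (nodes t) * sgn (nodes u)) * evalT (t ∙ u) x
      ≈⟨ *-congʳ (*-congˡ (sgn-+ (nodes t) (nodes u))) ⟨
    - 1# * sgn (nodes t ℕ.+ nodes u) * evalT (t ∙ u) x
      ≈⟨ *-congʳ (≈-trans (-1*x≈-x _) (≈-sym (signK-suc (nodes t ℕ.+ nodes u) 1#))) ⟩
    sgn (suc (nodes t ℕ.+ nodes u)) * evalT (t ∙ u) x ∎
    where
    y : List A → List A → Carrier
    y v w = x (v ++ w) - x (w ++ v)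

    flip : ∀ v w → x (reverse (v ++ w)) - x (reverse (w ++ v)) ≈ - 1# * y (reverse v) (reverse w)
    flip v w rewrite Listₚ.reverse-++ v w | Listₚ.reverse-++ w v = begin
      p - q             ≈⟨ +-congʳ (-‿involutive p) ⟨
      - (- p) - q       ≈⟨ -‿+-comm (- p) q ⟩
      - (- p + q)       ≈⟨ -‿cong (+-comm (- p) q) ⟩
      - (q - p)         ≈⟨ -1*x≈-x _ ⟨
      - 1# * (q - p)    ∎
      where
      p = x (reverse w ++ reverse v)
      q = x (reverse v ++ reverse w)

  evalF-reverse : ∀ T x → evalF T (x ∘ reverse) ≈ sgn (nodesF T) * evalF (reverse T) x
  evalF-reverse [] x = ≈-sym (*-identityˡ _)
  evalF-reverse (t ∷ T) x = begin
    evalT t (λ v → evalF T (λ w → x (reverse (v ++ w))))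
      ≈⟨ evalT-cong t (λ v _ → ≈-trans
           (evalF-cong T λ {w} _ → ≈-reflexive (cong x (Listₚ.reverse-++ v w)))
           (evalF-reverse T (λ w → x (w ++ reverse v)))) ⟩
    evalT t (λ v → sgn (nodesF T) * evalF (reverse T) (λ w → x (w ++ reverse v)))
      ≈⟨ evalT-* t _ _ ⟩
    sgn (nodesF T) * evalT t (λ v → evalF (reverse T) (λ w → x (w ++ reverse v)))
      ≈⟨ *-congˡ (evalT-reverse t (λ v → evalF (reverse T) (λ w → x (w ++ v)))) ⟩
    sgn (nodesF T) * (sgn (nodes t) * evalT t (λ v → evalF (reverse T) (λ w → x (w ++ v))))
      ≈⟨ *-congˡ (*-congˡ (evalF-∷ʳ (reverse T) t x)) ⟨
    sgn (nodesF T) * (sgn (nodes t) * evalF (reverse T ++ [ t ]) x)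
      ≈⟨ ≈-trans (≈-sym (*-assoc _ _ _)) (*-congʳ (*-comm _ _)) ⟩
    sgn (nodes t) * sgn (nodesF T) * evalF (reverse T ++ [ t ]) x
      ≈⟨ *-cong (≈-sym (sgn-+ (nodes t) (nodesF T)))
                (≈-reflexive (cong (λ S → evalF S x) (≡.sym (Listₚ.unfold-reverse t T)))) ⟩
    sgn (nodes t ℕ.+ nodesF T) * evalF (reverse (t ∷ T)) x ∎

  -- The relation tu = ut + [t, u], multiplied on the right by the remaining trees.
  evalF-swap : ∀ t u T x → evalF (t ∷ u ∷ T) x ≈ evalF (u ∷ t ∷ T) x + evalF ((t ∙ u) ∷ T) x
  evalF-swap t u T x = ≈-sym (begin
    evalF (u ∷ t ∷ T) x + evalF ((t ∙ u) ∷ T) x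
      ≈⟨ +-congʳ (evalT-fubini u (evalT-linear t) _) ⟩
    evalT t (λ v → evalT u (λ w → evalF T (λ z → x (w ++ v ++ z)))) + evalF ((t ∙ u) ∷ T) x
      ≈⟨ evalT-+ t _ _ ⟨
    evalT t (λ v → evalT u (λ w → evalF T (λ z → x (w ++ v ++ z)))
                 + evalT u (λ w → evalF T (λ z → x ((v ++ w) ++ z)) - evalF T (λ z → x ((w ++ v) ++ z))))
      ≈⟨ evalT-cong t (λ v _ → ≈-trans (≈-sym (evalT-+ u _ _)) (evalT-cong u λ w _ → cancel v w)) ⟩
    evalF (t ∷ u ∷ T) x ∎)
    where
    assoc : ∀ v w → evalF T (λ z → x ((v ++ w) ++ z)) ≈ evalF T (λ z → x (v ++ w ++ z))
    assoc v w = evalF-cong T λ {z} _ → ≈-reflexive (cong x (Listₚ.++-assoc v w z))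

    cancel : ∀ v w → evalF T (λ z → x (w ++ v ++ z))
      + (evalF T (λ z → x ((v ++ w) ++ z)) - evalF T (λ z → x ((w ++ v) ++ z)))
      ≈ evalF T (λ z → x (v ++ w ++ z))
    cancel v w = ≈-trans (+-congˡ (+-cong (assoc v w) (-‿cong (assoc w v)))) (x+[y-x]≈y _ _)

  -- Straightening as in the Poincaré-Birkhoff-Witt theorem, by iterating `evalF-swap`.
  evalF-reorder : ∀ {P S T} (r : Reorder P S T) x →
    evalF S x ≈ evalF T x + ∑ (residuals r) (λ R → evalF R x)
  evalF-reorder done x = ≈-sym (+-identityʳ _)
  evalF-reorder (prep t {S} {T} r) x = begin
    evalT t (λ v → evalF S (λ w → x (v ++ w)))
      ≈⟨ evalT-cong t (λ v _ → evalF-reorder r _) ⟩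
    evalT t (λ v → evalF T (λ w → x (v ++ w)) + ∑ (residuals r) (λ R → evalF R (λ w → x (v ++ w))))
      ≈⟨ evalT-+ t _ _ ⟩
    evalF (t ∷ T) x + evalT t (λ v → ∑ (residuals r) (λ R → evalF R (λ w → x (v ++ w))))
      ≈⟨ +-congˡ (L-∑ (evalT-linear t) (residuals r) _) ⟩
    evalF (t ∷ T) x + ∑ (residuals r) (λ R → evalF (t ∷ R) x)
      ≈⟨ +-congˡ (≈-reflexive (∑-map (t ∷_) (residuals r) (λ R → evalF R x))) ⟨
    evalF (t ∷ T) x + ∑ (map (t ∷_) (residuals r)) (λ R → evalF R x) ∎
  evalF-reorder (swap t u T _) x = ≈-trans (evalF-swap t u T x) (+-congˡ (≈-sym (+-identityʳ _)))
  evalF-reorder (_then_ {R} {S} {T} r s) x = begin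
    evalF R x                    ≈⟨ evalF-reorder r x ⟩
    evalF S x + ρ                ≈⟨ +-congʳ (evalF-reorder s x) ⟩
    (evalF T x + σ) + ρ          ≈⟨ +-assoc _ _ _ ⟩
    evalF T x + (σ + ρ)          ≈⟨ +-congˡ (+-comm σ ρ) ⟩
    evalF T x + (ρ + σ)          ≈⟨ +-congˡ (∑-++ (residuals r) (residuals s) _) ⟨
    evalF T x + ∑ (residuals r ++ residuals s) (λ R → evalF R x) ∎
    where
    ρ = ∑ (residuals r) (λ R → evalF R x)
    σ = ∑ (residuals s) (λ R → evalF R x)

  module _ (col : A → ℕ) where

    -- Weaker than having the form `x ∘ sortBy col`: this property survives fixing a prefix or a
    -- suffix of the word, as the inductions below require.
    Respects : Fun (List A) → Set ℓ₁
    Respects y = ∀ {v w} → _≋_ col v w → y v ≈ y w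

    -- A tree with several colours has a node whose two subtrees are each of one colour, but of
    -- different ones. The bracket at that node already evaluates to 0, and linearity carries this
    -- up to the root.
    evalT-vanish : ∀ t {y} → ¬ Mono col t → Respects y → evalT t y ≈ 0#
    evalT-vanish (leaf a) ¬m resp = contradiction (refl ∷ []) ¬m
    evalT-vanish (t ∙ u) {y} ¬m resp with mono? col t | mono? col u
    ... | no ¬mt | _ = ≈-trans (evalT-cong t λ v _ → L-sub (evalT-linear u) _ _)
      (≈-trans (L-sub (evalT-linear t) _ _)
      (≈-trans (+-cong (evalT-vanish t ¬mt (λ p → evalT-cong u λ w _ → resp (≋-++ʳ col w p)))
                       (-‿cong (evalT-vanish t ¬mt (λ p → evalT-cong u λ w _ → resp (≋-++ˡ col w p)))))
               (-‿inverseʳ 0#)))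
    ... | yes _ | no ¬mu = ≈-trans (evalT-cong t λ v _ → ≈-trans (L-sub (evalT-linear u) _ _)
      (≈-trans (+-cong (evalT-vanish u ¬mu (λ p → resp (≋-++ˡ col v p)))
                       (-‿cong (evalT-vanish u ¬mu (λ p → resp (≋-++ʳ col v p)))))
               (-‿inverseʳ 0#))) (L-0 (evalT-linear t))
    -- The subtrees have one colour each and these differ, so vw and wv are equivalent under
    -- insertion and cancel.
    ... | yes mt | yes mu = ≈-trans (evalT-cong t λ v v↭ → ≈-trans (evalT-cong u λ w w↭ →
      ≈-trans (+-congʳ (resp (++-comm-≋ col v w (distinct v↭ w↭)))) (-‿inverseʳ _))
      (L-0 (evalT-linear u))) (L-0 (evalT-linear t))
      where
      distinct : ∀ {v w} → v ↭ leaves t → w ↭ leaves u → All (λ a → All (λ b → col a ≢ col b) w) v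
      distinct v↭ w↭ = All.map (λ p → All.map (λ q e → ¬m (mono-∙⁺ col {t} {u} mt mu
          (≡.trans (≡.sym p) (≡.trans e q)))) (↭ₚ.All-resp-↭ (↭-sym w↭) mu))
        (↭ₚ.All-resp-↭ (↭-sym v↭) mt)

    evalF-vanish : ∀ T {y} → ¬ Compat col T → Respects y → evalF T y ≈ 0#
    evalF-vanish [] ¬c resp = contradiction [] ¬c
    evalF-vanish (t ∷ T) {y} ¬c resp with mono? col t
    ... | no ¬m = evalT-vanish t ¬m λ p → evalF-cong T λ {w} _ → resp (≋-++ʳ col w p)
    ... | yes m = ≈-trans
      (evalT-cong t λ v _ → evalF-vanish T (λ c → ¬c (m ∷ c)) λ p → resp (≋-++ˡ col v p))
      (L-0 (evalT-linear t))

    sortF-↭ : ∀ T → sortF col T ↭ T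
    sortF-↭ = sortBy-↭ (col ∘ firstLeaf)

    sortResiduals : Forest → List Forest
    sortResiduals T = residuals (sort-reorder col T)

    evalF-sorted : ∀ T {x} → Compat col T → evalF (sortF col T) (x ∘ sortBy col) ≈ evalF (sortF col T) x
    evalF-sorted T {x} cT = evalF-cong (sortF col T) λ ws → ≈-reflexive (cong x (sortBy-fixed col
      (IsWord-sorted col (↭ₚ.All-resp-↭ (↭-sym (sortF-↭ T)) cT) (sortBy-sorted (col ∘ firstLeaf) T) ws)))

    -- Moving T to sorted position costs brackets of differently coloured trees, on which
    -- x ∘ sortBy col vanishes.
    evalF-sortBy : ∀ T x → evalF T (x ∘ sortBy col) ≈ when (does (compat? col T)) (evalF (sortF col T) x)
    evalF-sortBy T x with compat? col T
    ... | no ¬c = evalF-vanish T ¬c resp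
      where
      resp : Respects (x ∘ sortBy col)
      resp p = ≈-reflexive (cong x (≋⇒sortBy≡ col p))
    ... | yes cT = begin
      evalF T (x ∘ sortBy col)
        ≈⟨ evalF-reorder (sort-reorder col T) _ ⟩
      evalF (sortF col T) (x ∘ sortBy col) + ∑ (sortResiduals T) (λ R → evalF R (x ∘ sortBy col))
        ≈⟨ +-cong (evalF-sorted T cT) (∑-zero (sortResiduals T) λ {R} R∈ → evalF-vanish R
             (All.lookup (residuals-¬compat col (sort-reorder col T)) R∈)
             (λ p → ≈-reflexive (cong x (≋⇒sortBy≡ col p)))) ⟩
      evalF (sortF col T) x + 0#
        ≈⟨ +-identityʳ _ ⟩
      evalF (sortF col T) x ∎

-- The operator U and its action on forests.

module ShuffleOperator {c ℓ₁ ℓ₂} (K : OrderedField c ℓ₁ ℓ₂) (n : ℕ)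
                       (γ : List ℕ → OrderedField.Carrier K) where

  open FieldSums K
  open TreeEvaluation K {Fin n} public

  Word : Set
  Word = List (Fin n)

  colour : ∀ {k} → Vec (Fin k) n → Fin n → ℕ
  colour g i = toℕ (Vec.lookup g i)

  sortW : ∀ {k} → Vec (Fin k) n → Word → Word
  sortW g = sortBy (colour g)

  compatB : ∀ {k} → Vec (Fin k) n → Forest → Bool
  compatB g T = does (compat? (colour g) T)

  ∑γ : (∀ α → Vec (Fin (length α)) n → Carrier) → Carrier
  ∑γ f = ∑ (compositions n) λ α → γ α * ∑ (allVecs (length α) n) λ g → when (hasTypeB α g) (f α g)

  B : Fun Word → Fun Word
  B x r = ∑γ λ α g → x (sortW g r)

  -- Left multiplication by w₀ B_γ, acting on functions of the inverse words of permutations.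
  U : Fun Word → Fun Word
  U x r = B x (reverse r)

  Valid : Forest → Set
  Valid T = leavesF T ↭ allFin n

  -- For a valid forest this is n_α of a set composition whose blocks are the leaf sets of the
  -- trees; correspondingly `eigenvalue` is its ñ_γ, by `eigenvalue≈ñγ`.
  count : List ℕ → Forest → Carrier
  count α T = ∑ (allVecs (length α) n) λ g → when (hasTypeB α g) (when (compatB g T) 1#)

  weight : Forest → Carrier
  weight T = ∑γ λ α g → when (compatB g T) 1#

  eigenvalue : Forest → Carrier
  eigenvalue T = sgn (nodesF T) * weight T

  ∑γ-cong : ∀ {f f′} → (∀ {α} → α ∈ compositions n → ∀ g → f α g ≈ f′ α g) → ∑γ f ≈ ∑γ f′
  ∑γ-cong p = ∑-cong (compositions n) λ {α} α∈ → *-congˡ (∑-cong (allVecs (length α) n) λ {g} _ →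
    when-cong (hasTypeB α g) (p α∈ g))

  ∑γ-+ : ∀ f f′ → ∑γ (λ α g → f α g + f′ α g) ≈ ∑γ f + ∑γ f′
  ∑γ-+ f f′ = ≈-trans
    (∑-cong (compositions n) λ {α} _ → ≈-trans
      (*-congˡ (≈-trans (∑-cong (allVecs (length α) n) λ {g} _ → when-+ (hasTypeB α g))
                        (∑-+ (allVecs (length α) n) _ _)))
      (distribˡ (γ α) _ _))
    (∑-+ (compositions n) _ _)
    where
    when-+ : ∀ b {x y} → when b (x + y) ≈ when b x + when b y
    when-+ true  = ≈-refl
    when-+ false = ≈-sym (+-identityˡ 0#)

  ∑γ-*ʳ : ∀ f k → ∑γ (λ α g → f α g * k) ≈ ∑γ f * k
  ∑γ-*ʳ f k = ≈-sym (≈-trans (∑-*ʳ k (compositions n) _) (∑-cong (compositions n) λ {α} _ →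
    ≈-trans (*-assoc _ _ _) (*-congˡ (≈-trans (∑-*ʳ k (allVecs (length α) n) _)
      (∑-cong (allVecs (length α) n) λ {g} _ → when-*ʳ (hasTypeB α g))))))
    where
    when-*ʳ : ∀ b {x} → when b x * k ≈ when b (x * k)
    when-*ʳ true  = ≈-refl
    when-*ʳ false = zeroˡ k

  L-∑γ : ∀ {L : Fun Word → Carrier} → Linear L → (f : ∀ α → Vec (Fin (length α)) n → Fun Word) →
    L (λ r → ∑γ λ α g → f α g r) ≈ ∑γ λ α g → L (f α g)
  L-∑γ lin f = ≈-trans (L-∑ lin (compositions n) _) (∑-cong (compositions n) λ {α} _ →
    ≈-trans (L-* lin (γ α) _) (*-congˡ (≈-trans (L-∑ lin (allVecs (length α) n) _)
      (∑-cong (allVecs (length α) n) λ {g} _ → L-when lin (hasTypeB α g) _))))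

  U-linear : ∀ r → Linear (λ x → U x r)
  U-linear r = record
    { L-cong = λ p → ∑γ-cong λ _ g → p _
    ; L-+    = λ x y → ∑γ-+ (λ α g → x (sortW g (reverse r))) (λ α g → y (sortW g (reverse r)))
    ; L-*    = λ k x → ≈-trans (∑γ-cong λ _ _ → *-comm k _) (≈-trans (∑γ-*ʳ _ k) (*-comm _ k)) }

  evalF-B : ∀ T x → evalF T (B x) ≈ ∑γ λ α g → when (compatB g T) (evalF (sortF (colour g) T) x)
  evalF-B T x = ≈-trans (L-∑γ (evalF-linear T) _) (∑γ-cong λ _ g → evalF-sortBy (colour g) T x)

  evalF-U : ∀ T x → evalF T (U x) ≈ sgn (nodesF T) * evalF (reverse T) (B x)
  evalF-U T x = evalF-reverse T (B x)

  nodesF-↭ : ∀ {S T} → S ↭ T → nodesF S ≡ nodesF T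
  nodesF-↭ {S} {T} p = ℕₚ.+-cancelʳ-≡ (length S) (nodesF S) (nodesF T) (≡.trans (≡.sym (length-leavesF S))
    (≡.trans (↭ₚ.↭-length (leavesF-↭ p)) (≡.trans (length-leavesF T) (cong (nodesF T ℕ.+_) (≡.sym (↭ₚ.↭-length p))))))

  compatB-true : ∀ {k} (g : Vec (Fin k) n) {T} → Compat (colour g) T → compatB g T ≡ true
  compatB-true g c = dec-true (compat? (colour g) _) c

  compatB-false : ∀ {k} (g : Vec (Fin k) n) {T} → ¬ Compat (colour g) T → compatB g T ≡ false
  compatB-false g ¬c = dec-false (compat? (colour g) _) ¬c

  compatB-cong : ∀ {k} (g : Vec (Fin k) n) {S T} →
    (Compat (colour g) S → Compat (colour g) T) → (Compat (colour g) T → Compat (colour g) S) →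
    compatB g S ≡ compatB g T
  compatB-cong g {S} {T} f f⁻¹ with compat? (colour g) S
  ... | yes c = ≡.sym (compatB-true g (f c))
  ... | no ¬c = ≡.sym (compatB-false g (¬c ∘ f⁻¹))

  compatB-↭ : ∀ {k} (g : Vec (Fin k) n) {S T} → S ↭ T → compatB g S ≡ compatB g T
  compatB-↭ g p = compatB-cong g (↭ₚ.All-resp-↭ p) (↭ₚ.All-resp-↭ (↭-sym p))

  weight-↭ : ∀ {S T} → S ↭ T → weight S ≈ weight T
  weight-↭ p = ∑γ-cong λ _ g → ≈-reflexive (cong (λ b → when b 1#) (compatB-↭ g p))

  -- The corrections made when T is rewritten as its sorted form, for each colouring g compatible
  -- with T. Every forest R that occurs is incompatible with its g.
  defect : Forest → Fun Word → Carrier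
  defect T x = ∑γ λ α g → when (compatB g T) (∑ (sortResiduals (colour g) T) λ R → evalF R x)

  evalF-B-defect : ∀ T x → weight T * evalF T x ≈ evalF T (B x) + defect T x
  evalF-B-defect T x = begin
    weight T * evalF T x
      ≈⟨ ∑γ-*ʳ (λ α g → when (compatB g T) 1#) (evalF T x) ⟨
    (∑γ λ α g → when (compatB g T) 1# * evalF T x)
      ≈⟨ ∑γ-cong (λ _ g → pointwise g) ⟩
    (∑γ λ α g → when (compatB g T) (evalF (sortF (colour g) T) x)
              + when (compatB g T) (∑ (sortResiduals (colour g) T) λ R → evalF R x))
      ≈⟨ ∑γ-+ _ _ ⟩
    _ + defect T x
      ≈⟨ +-congʳ (evalF-B T x) ⟨
    evalF T (B x) + defect T x ∎
    where
    pointwise : ∀ {k} (g : Vec (Fin k) n) → when (compatB g T) 1# * evalF T x ≈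
      when (compatB g T) (evalF (sortF (colour g) T) x)
      + when (compatB g T) (∑ (sortResiduals (colour g) T) λ R → evalF R x)
    pointwise g with compatB g T
    ... | true  = ≈-trans (*-identityˡ _) (evalF-reorder (sort-reorder (colour g) T) x)
    ... | false = ≈-trans (zeroˡ _) (≈-sym (+-identityˡ 0#))

  -- Unlike evalF T, this is an exact eigenvector of the reversal of words.
  evalSym : Forest → Fun Word → Carrier
  evalSym T x = evalF T x + evalF (reverse T) x

  evalSym-linear : ∀ T → Linear (evalSym T)
  evalSym-linear T = record
    { L-cong = λ p → +-cong (L-cong (evalF-linear T) p) (L-cong (evalF-linear (reverse T)) p)
    ; L-+ = λ x y → ≈-trans (+-cong (L-+ (evalF-linear T) x y) (L-+ (evalF-linear (reverse T)) x y))
                            (+-interchange _ _ _ _)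
    ; L-* = λ k x → ≈-trans (+-cong (L-* (evalF-linear T) k x) (L-* (evalF-linear (reverse T)) k x))
                            (≈-sym (distribˡ k _ _)) }

  -- Reversal exchanges the two summands with one and the same sign, and both have the same weight
  -- because weights ignore the order of the trees. Only the defects of sorting remain.
  evalSym-U : ∀ T x → eigenvalue T * evalSym T x ≈
    evalSym T (U x) + sgn (nodesF T) * (defect T x + defect (reverse T) x)
  evalSym-U T x = begin
    s * weight T * evalSym T x
      ≈⟨ *-assoc _ _ _ ⟩
    s * (weight T * evalSym T x)
      ≈⟨ *-congˡ (≈-trans (distribˡ _ _ _) (+-congˡ (*-congʳ (weight-↭ (↭-sym T↭))))) ⟩
    s * (weight T * evalF T x + weight (reverse T) * evalF (reverse T) x)
      ≈⟨ *-congˡ (+-cong (evalF-B-defect T x) (evalF-B-defect (reverse T) x)) ⟩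
    s * ((evalF T (B x) + defect T x) + (evalF (reverse T) (B x) + defect (reverse T) x))
      ≈⟨ *-congˡ (+-interchange _ _ _ _) ⟩
    s * ((evalF T (B x) + evalF (reverse T) (B x)) + (defect T x + defect (reverse T) x))
      ≈⟨ distribˡ s _ _ ⟩
    s * (evalF T (B x) + evalF (reverse T) (B x)) + s * (defect T x + defect (reverse T) x)
      ≈⟨ +-congʳ (≈-trans (*-congˡ (+-comm _ _)) (distribˡ s _ _)) ⟩
    (s * evalF (reverse T) (B x) + s * evalF T (B x)) + s * (defect T x + defect (reverse T) x)
      ≈⟨ +-congʳ (+-cong (evalF-U T x) reversed) ⟨
    evalSym T (U x) + s * (defect T x + defect (reverse T) x) ∎
    where
    s  = sgn (nodesF T)
    T↭ = ↭ₚ.↭-reverse T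

    reversed : evalF (reverse T) (U x) ≈ s * evalF T (B x)
    reversed = ≈-trans (evalF-U (reverse T) x) (≈-reflexive
      (cong₂ (λ k S → sgn k * evalF S (B x)) (nodesF-↭ T↭) (Listₚ.reverse-involutive T)))

  -- Modulo coarser forests, evalSym R is twice evalF R.
  evalSym≈0⇒evalF≈0 : ∀ {d y} m R → length R ℕ.≤ m →
    (∀ R′ → R ⊑ R′ → d * evalSym R′ y ≈ 0#) → d * evalF R y ≈ 0#
  evalSym≈0⇒evalF≈0 {d} {y} m R len p = x+x≈0⇒x≈0 (begin
    d * evalF R y + d * evalF R y
      ≈⟨ distribˡ d _ _ ⟨
    d * (evalF R y + evalF R y)
      ≈⟨ *-congˡ (+-congˡ (evalF-reorder r y)) ⟩
    d * (evalF R y + (evalF (reverse R) y + ∑ (residuals r) λ R′ → evalF R′ y))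
      ≈⟨ *-congˡ (+-assoc _ _ _) ⟨
    d * (evalSym R y + ∑ (residuals r) λ R′ → evalF R′ y)
      ≈⟨ distribˡ d _ _ ⟩
    d * evalSym R y + d * ∑ (residuals r) (λ R′ → evalF R′ y)
      ≈⟨ 0-cong (p R ⊑-refl) (≈-trans (∑-* d (residuals r) _) (∑-zero (residuals r) (coarser m len))) ⟩
    0# ∎)
    where
    r = ↭⇒Reorder (↭-sym (↭ₚ.↭-reverse R))

    coarser : ∀ m → length R ℕ.≤ m → ∀ {R′} → R′ ∈ residuals r → d * evalF R′ y ≈ 0#
    coarser zero len R′∈ =
      contradiction (ℕₚ.<-≤-trans (All.lookup (residuals-length r) R′∈) len) ℕₚ.n≮0
    coarser (suc m) len {R′} R′∈ = evalSym≈0⇒evalF≈0 m R′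
      (ℕₚ.≤-pred (ℕₚ.<-≤-trans (All.lookup (residuals-length r) R′∈) len))
      λ R″ R′⊑R″ → p R″ (⊑-trans (All.lookup (residuals-⊑ r) R′∈) R′⊑R″)

  prodU : List Carrier → Fun Word → Fun Word
  prodU S x = foldr (λ k y r → U y r - k * y r) x S

  ─-lookup : ∀ {p q} {P : Pred Carrier p} {Q : Pred Carrier q} {S} (i : Any P S) → Any Q S →
    Any Q (S ─ i) ⊎ Q (Any.lookup i)
  ─-lookup (here _)  (here q)  = inj₂ q
  ─-lookup (here _)  (there j) = inj₁ j
  ─-lookup (there i) (here q)  = inj₁ (here q)
  ─-lookup (there i) (there j) with ─-lookup i j
  ... | inj₁ j′ = inj₁ (there j′)
  ... | inj₂ q  = inj₂ q

  length-─ : ∀ {p} {P : Pred Carrier p} {S} (i : Any P S) → length S ≡ suc (length (S ─ i))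
  length-─ (here _)  = refl
  length-─ (there i) = cong suc (length-─ i)

  -- The operators U - k commute, so the factor of any listed eigenvalue can be moved to the
  -- outside, where it meets the forest with that eigenvalue.
  prodU-─ : ∀ {p} {P : Pred Carrier p} {S} (i : Any P S) x r →
    prodU S x r ≈ U (prodU (S ─ i) x) r - Any.lookup i * prodU (S ─ i) x r
  prodU-─ (here _) x r = ≈-refl
  prodU-─ {S = k ∷ S} (there i) x r = begin
    U (prodU S x) r - k * prodU S x r
      ≈⟨ +-cong (L-cong (U-linear r) (prodU-─ i x)) (-‿cong (*-congˡ (prodU-─ i x r))) ⟩
    U (λ r → U y r - m * y r) r - k * (U y r - m * y r)
      ≈⟨ +-cong (≈-trans (L-sub (U-linear r) (U y) (λ r → m * y r)) (+-congˡ (-‿cong (L-* (U-linear r) m y))))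
                (-‿cong (x[y-z]≈xy-xz k _ _)) ⟩
    (U (U y) r - m * U y r) - (k * U y r - k * (m * y r))
      ≈⟨ exchange ⟩
    (U (U y) r - k * U y r) - (m * U y r - m * (k * y r))
      ≈⟨ +-cong (≈-trans (L-sub (U-linear r) (U y) (λ r → k * y r)) (+-congˡ (-‿cong (L-* (U-linear r) k y))))
                (-‿cong (x[y-z]≈xy-xz m _ _)) ⟨
    U (λ r → U y r - k * y r) r - m * (U y r - k * y r) ∎
    where
    y = prodU (S ─ i) x
    m = Any.lookup i

    exchange : ∀ {a} → (a - m * U y r) - (k * U y r - k * (m * y r)) ≈
                       (a - k * U y r) - (m * U y r - m * (k * y r))
    exchange {a} = begin
      (a - p) - (q - k * (m * y r))           ≈⟨ +-congˡ (-‿+-comm q _) ⟨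
      (a - p) + (- q - - (k * (m * y r)))     ≈⟨ +-assoc _ _ _ ⟩
      a + (- p + (- q - - (k * (m * y r))))   ≈⟨ +-congˡ (≈-sym (+-assoc _ _ _)) ⟩
      a + ((- p - q) - - (k * (m * y r)))     ≈⟨ +-congˡ (+-cong (+-comm _ _) (-‿cong (-‿cong (x*yz≈y*xz k m _)))) ⟩
      a + ((- q - p) - - (m * (k * y r)))     ≈⟨ +-congˡ (+-assoc _ _ _) ⟩
      a + (- q + (- p - - (m * (k * y r))))   ≈⟨ +-assoc _ _ _ ⟨
      (a - q) + (- p - - (m * (k * y r)))     ≈⟨ +-congˡ (-‿+-comm p _) ⟩
      (a - q) - (p - m * (k * y r))           ∎
      where
      p = m * U y r
      q = k * U y r

  -- Annihilation when γ is nonnegative.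

  module _ (γ≥0 : ∀ α → α ∈ compositions n → 0# ≤ γ α) where

    private
      when-nonneg : ∀ b {x} → 0# ≤ x → 0# ≤ when b x
      when-nonneg true  p = p
      when-nonneg false p = ≤-refl

    weight-nonneg : ∀ T → 0# ≤ weight T
    weight-nonneg T = ∑-nonneg (compositions n) λ {α} α∈ → *-nonneg (γ≥0 α α∈)
      (∑-nonneg (allVecs (length α) n) λ {g} _ →
        when-nonneg (hasTypeB α g) (when-nonneg (compatB g T) 0≤1))

    summand-anti : ∀ {k} b (g : Vec (Fin k) n) {S T} → S ⊑ T →
      when b (when (compatB g T) 1#) ≤ when b (when (compatB g S) 1#)
    summand-anti false g S⊑T = ≤-refl
    summand-anti true g {S} {T} S⊑T with compat? (colour g) T
    ... | no  _ = when-nonneg (compatB g S) 0≤1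
    ... | yes c = ≤-reflexive (≈-reflexive (cong (λ b → when b 1#)
                    (≡.sym (compatB-true g (compat-⇐ S⊑T (colour g) c)))))

    count-anti : ∀ α {S T} → S ⊑ T → count α T ≤ count α S
    count-anti α S⊑T = ∑-mono (allVecs (length α) n) λ {g} _ → summand-anti (hasTypeB α g) g S⊑T

    weight-anti : ∀ {S T} → S ⊑ T → weight T ≤ weight S
    weight-anti S⊑T = ∑-mono (compositions n) λ {α} α∈ → *-monoˡ-≤ (γ≥0 α α∈) (count-anti α S⊑T)

    -- The colouring g is counted for S but not for T, and alone contributes γ α; no other colouring
    -- is counted for T without being counted for S.
    weight-strict : ∀ {S T α g} → α ∈ compositions n → g ∈ allVecs (length α) n → hasTypeB α g ≡ true →
      S ⊑ T → Compat (colour g) S → ¬ Compat (colour g) T → weight T + γ α ≤ weight S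
    weight-strict {S} {T} {α} {g} α∈ g∈ type S⊑T cS ¬cT = ∑-mono-+ α∈
      (λ {β} β∈ → *-monoˡ-≤ (γ≥0 β β∈) (count-anti β S⊑T))
      (≤-respˡ-≈ (≈-trans (distribˡ _ _ _) (+-congˡ (*-identityʳ _)))
        (*-monoˡ-≤ (γ≥0 α α∈) (∑-mono-+ g∈ (λ {g} _ → summand-anti (hasTypeB α g) g S⊑T) one)))
      where
      one : when (hasTypeB α g) (when (compatB g T) 1#) + 1# ≤ when (hasTypeB α g) (when (compatB g S) 1#)
      one rewrite type | compatB-true g cS | compatB-false g ¬cT = ≤-reflexive (+-identityˡ 1#)

    -- A repeated eigenvalue along an edge with coefficient g forces g = 0: equal signs make the
    -- weights equal, opposite signs make them both zero.
    repeated⇒0 : ∀ {l r l′ g} j k → 0# ≤ l′ → 0# ≤ g → l′ ≤ r → r + g ≤ l →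
      sgn j * l′ ≈ sgn k * l → g ≈ 0#
    repeated⇒0 {l} {r} {l′} {g} j k 0≤l′ 0≤g l′≤r r+g≤l e = antisym (bound (signK-sign j) (signK-sign k)) 0≤g
      where
      e′ : signK K j l′ ≈ signK K k l
      e′ = ≈-trans (signK≈sgn* j l′) (≈-trans e (≈-sym (signK≈sgn* k l)))

      same : l′ ≈ l → g ≤ 0#
      same q = ≤-respˡ-≈ (x+y-x≈y r g) (≤-respʳ-≈ (-‿inverseʳ r)
        (+-mono-≤ (- r) (≤-trans r+g≤l (≤-trans (≤-reflexive (≈-sym q)) l′≤r))))

      opposite : l′ ≈ - l → g ≤ 0#
      opposite q = ≤-trans (≤-respˡ-≈ (+-identityˡ g) (+-mono-≤ g (≤-trans 0≤l′ l′≤r)))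
                           (≤-trans r+g≤l (0≤-x⇒x≤0 (≤-respʳ-≈ q 0≤l′)))

      bound : (∀ x → signK K j x ≡ x) ⊎ (∀ x → signK K j x ≡ - x) →
              (∀ x → signK K k x ≡ x) ⊎ (∀ x → signK K k x ≡ - x) → g ≤ 0#
      bound (inj₁ p) (inj₁ q) = same (≈-trans (≈-reflexive (≡.sym (p l′))) (≈-trans e′ (≈-reflexive (q l))))
      bound (inj₁ p) (inj₂ q) = opposite (≈-trans (≈-reflexive (≡.sym (p l′))) (≈-trans e′ (≈-reflexive (q l))))
      bound (inj₂ p) (inj₁ q) = opposite (≈-trans (≈-sym (-‿involutive l′))
        (-‿cong (≈-trans (≈-reflexive (≡.sym (p l′))) (≈-trans e′ (≈-reflexive (q l))))))
      bound (inj₂ p) (inj₂ q) = same (≈-trans (≈-sym (-‿involutive l′)) (≈-trans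
        (-‿cong (≈-trans (≈-reflexive (≡.sym (p l′))) (≈-trans e′ (≈-reflexive (q l))))) (-‿involutive l)))

    -- The scalar d accumulates the coefficients γ α met on the way to T. The alternative d ≈ 0
    -- stands in for a case distinction on γ α ≈ 0, which cannot be decided in K.
    ListsEigenvaluesBelow : List Carrier → Forest → Carrier → Set _
    ListsEigenvaluesBelow S T d =
      ∀ T′ → Valid T′ → weight T′ ≤ weight T → Any (_≈ eigenvalue T′) S ⊎ d ≈ 0#

    -- Using up the factor of the eigenvalue of T cancels the diagonal term. What is left are
    -- defects, that is, coarser forests with coefficient d * γ α, to which the shortened list
    -- applies. The bound m drives the recursion, since the factor is removed from the middle of S.
    prodU-annihilates : ∀ m S → length S ℕ.≤ m → ∀ T → Valid T → ∀ d → ListsEigenvaluesBelow S T d →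
      ∀ x → d * evalSym T (prodU S x) ≈ 0#
    prodU-annihilates m S len T vT d lists x with lists T vT ≤-refl
    ... | inj₂ d≈0 = *-zeroˡ-cong d≈0
    ... | inj₁ i = begin
      d * evalSym T (prodU S x)
        ≈⟨ *-congˡ (≈-trans (L-cong (evalSym-linear T) (prodU-─ i x)) (≈-trans
             (L-sub (evalSym-linear T) _ _) (+-congˡ (-‿cong (L-* (evalSym-linear T) k y))))) ⟩
      d * (evalSym T (U y) - k * evalSym T y)
        ≈⟨ *-congˡ (+-congˡ (-‿cong (≈-trans (*-congʳ k≈) (evalSym-U T y)))) ⟩
      d * (evalSym T (U y) - (evalSym T (U y) + s * δs))
        ≈⟨ *-congˡ (≈-trans (+-congˡ (≈-sym (-‿+-comm _ _))) (≈-trans (≈-sym (+-assoc _ _ _))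
             (≈-trans (+-congʳ (-‿inverseʳ _)) (≈-trans (+-identityˡ _) (-‿distribˡ-* s δs))))) ⟩
      d * (- s * δs)
        ≈⟨ x*yz≈y*xz d (- s) δs ⟩
      - s * (d * δs)
        ≈⟨ *-zeroʳ-cong (≈-trans (distribˡ d _ _)
             (0-cong (defect≈0 T ↭-refl) (defect≈0 (reverse T) (↭-sym (↭ₚ.↭-reverse T))))) ⟩
      0# ∎
      where
      k  = Any.lookup i
      y  = prodU (S ─ i) x
      s  = sgn (nodesF T)
      δs = defect T y + defect (reverse T) y

      k≈ : k ≈ eigenvalue T
      k≈ = Anyₚ.lookup-result i

      IH : ∀ m → length S ℕ.≤ m → ∀ R → Valid R → ∀ d → ListsEigenvaluesBelow (S ─ i) R d →
           d * evalSym R y ≈ 0#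
      IH zero    len R vR d l =
        contradiction (ℕₚ.≤-trans (ℕₚ.≤-reflexive (≡.sym (length-─ i))) len) ℕₚ.n≮0
      IH (suc m) len R vR d l = prodU-annihilates m (S ─ i)
        (ℕₚ.≤-pred (ℕₚ.≤-trans (ℕₚ.≤-reflexive (≡.sym (length-─ i))) len)) R vR d l x

      below : ∀ {R α g} → α ∈ compositions n → g ∈ allVecs (length α) n → hasTypeB α g ≡ true →
        T ⊑ R → Compat (colour g) T → ¬ Compat (colour g) R → ListsEigenvaluesBelow (S ─ i) R (d * γ α)
      below {α = α} α∈ g∈ type T⊑R cT ¬cR T′ vT′ T′≤R with lists T′ vT′ (≤-trans T′≤R (weight-anti T⊑R))
      ... | inj₂ d≈0 = inj₂ (*-zeroˡ-cong d≈0)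
      ... | inj₁ j with ─-lookup i j
      ...   | inj₁ j′ = inj₁ j′
      -- T′ has the very eigenvalue that was removed. Its weight is at most that of R, which lies γ
      -- α below that of T, so γ α vanishes.
      ...   | inj₂ e  = inj₂ (*-zeroʳ-cong (repeated⇒0 (nodesF T′) (nodesF T)
        (weight-nonneg T′) (γ≥0 α α∈) T′≤R (weight-strict α∈ g∈ type T⊑R cT ¬cR) (≈-trans (≈-sym e) k≈)))

      -- Incompatibility of g with R is inherited by every R′ coarser than R. So the drop by γ α is
      -- available for all the symmetrised forests needed to control `evalF R`.
      residual≈0 : ∀ {α g T₀} → α ∈ compositions n → g ∈ allVecs (length α) n → hasTypeB α g ≡ true →
        T ↭ T₀ → Compat (colour g) T₀ → ∀ {R} → R ∈ sortResiduals (colour g) T₀ → d * γ α * evalF R y ≈ 0#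
      residual≈0 {α} {g} {T₀} α∈ g∈ type T↭T₀ cT₀ {R} R∈ = evalSym≈0⇒evalF≈0 (length R) R ℕₚ.≤-refl λ R′ R⊑R′ →
        let T⊑R′ = ⊑-trans (↭⇒⊑ T↭T₀) (⊑-trans (All.lookup (residuals-⊑ (sort-reorder (colour g) T₀)) R∈) R⊑R′)
        in IH m len R′ (↭-trans (leaves-↭ T⊑R′) vT) (d * γ α)
             (below α∈ g∈ type T⊑R′ (↭ₚ.All-resp-↭ (↭-sym T↭T₀) cT₀)
               (All.lookup (residuals-¬compat (colour g) (sort-reorder (colour g) T₀)) R∈ ∘ compat-⇐ R⊑R′ (colour g)))

      defect≈0 : ∀ T₀ → T ↭ T₀ → d * defect T₀ y ≈ 0#
      defect≈0 T₀ T↭T₀ = ≈-trans (∑-* d (compositions n) _) (∑-zero (compositions n) λ {α} α∈ →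
        ≈-trans (≈-sym (*-assoc d (γ α) _)) (≈-trans (∑-* (d * γ α) (allVecs (length α) n) _)
          (∑-zero (allVecs (length α) n) λ {g} g∈ → term α∈ g∈)))
        where
        term : ∀ {α g} → α ∈ compositions n → g ∈ allVecs (length α) n →
          d * γ α * when (hasTypeB α g) (when (compatB g T₀) (∑ (sortResiduals (colour g) T₀) λ R → evalF R y)) ≈ 0#
        term {α} {g} α∈ g∈ with hasTypeB α g in type | compat? (colour g) T₀
        ... | false | _     = zeroʳ _
        ... | true  | no _  = zeroʳ _
        ... | true  | yes c = ≈-trans (∑-* (d * γ α) (sortResiduals (colour g) T₀) _)
          (∑-zero (sortResiduals (colour g) T₀) (residual≈0 α∈ g∈ type T↭T₀ c))

-- Repetition-free lists, trees on given leaves, and the refinement test.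

module _ {A : Set} where

  Unique-resp-↭ : ∀ {l m : List A} → l ↭ m → Unique l → Unique m
  Unique-resp-↭ p = PermutationSetoidProperties.Unique-resp-↭ (≡.setoid A) (↭.↭⇒↭ₛ p)

  unique∧set⇒↭ : ∀ {l m : List A} → Unique l → Unique m →
    (∀ {a} → a ∈ l → a ∈ m) → (∀ {a} → a ∈ m → a ∈ l) → l ↭ m
  unique∧set⇒↭ ul um f g = ∼bag⇒↭ (unique∧set⇒bag ul um (mk⇔ f g))

  unique-++⁻ : ∀ (l : List A) {m} → Unique (l ++ m) →
    Unique l × Unique m × (∀ {a} → a ∈ l → a ∉ m)
  unique-++⁻ []      u       = [] , u , λ ()
  unique-++⁻ (a ∷ l) (p ∷ u) with unique-++⁻ l u
  ... | ul , um , disj = Allₚ.++⁻ˡ l p ∷ ul , um , λ where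
    (here refl) a∈m → All.lookup (Allₚ.++⁻ʳ l p) a∈m refl
    (there a∈l) a∈m → disj a∈l a∈m

  index-unique : ∀ (T : List (Tree A)) → Unique (leavesF T) → ∀ {a}
    (p q : Any (λ t → a ∈ leaves t) T) → Any.index p ≡ Any.index q
  index-unique (t ∷ T) u (here p)  (here q)  = refl
  index-unique (t ∷ T) u (here p)  (there q) =
    contradiction (∈ₚ.∈-concatMap⁺ leaves q) (proj₂ (proj₂ (unique-++⁻ (leaves t) u)) p)
  index-unique (t ∷ T) u (there p) (here q)  =
    contradiction (∈ₚ.∈-concatMap⁺ leaves p) (proj₂ (proj₂ (unique-++⁻ (leaves t) u)) q)
  index-unique (t ∷ T) u (there p) (there q) =
    cong Fin.suc (index-unique T (proj₁ (proj₂ (unique-++⁻ (leaves t) u))) p q)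

  anyAt : ∀ (T : List (Tree A)) (j : Fin (length T)) {a} → a ∈ leaves (List.lookup T j) →
    Σ (Any (λ t → a ∈ leaves t) T) λ p → Any.index p ≡ j
  anyAt (t ∷ T) Fin.zero    a∈ = here a∈ , refl
  anyAt (t ∷ T) (Fin.suc j) a∈ with anyAt T j a∈
  ... | p , refl = there p , refl

  -- Any bracketing of a block would serve; the right-nested one is chosen.
  comb : A → List A → Tree A
  comb a []      = leaf a
  comb a (b ∷ l) = leaf a ∙ comb b l

  leaves-comb : ∀ a l → leaves (comb a l) ≡ a ∷ l
  leaves-comb a []      = refl
  leaves-comb a (b ∷ l) = cong (a ∷_) (leaves-comb b l)

  treeOn : (l : List A) → ∃ (_∈ l) → Tree A
  treeOn (a ∷ l) _ = comb a l

  leaves-treeOn : ∀ l (p : ∃ (_∈ l)) → leaves (treeOn l p) ≡ l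
  leaves-treeOn (a ∷ l) _ = leaves-comb a l

module _ {a} {A : Set a} where

  and-map⁺ : ∀ {P : A → Bool} l → (∀ {x} → x ∈ l → P x ≡ true) → and (map P l) ≡ true
  and-map⁺ []      p = refl
  and-map⁺ (x ∷ l) p rewrite p (here refl) = and-map⁺ l (p ∘ there)

  and-map⁻ : ∀ {P : A → Bool} l → and (map P l) ≡ true → ∀ {x} → x ∈ l → P x ≡ true
  and-map⁻ {P} (y ∷ l) e (here refl) with P y
  ... | true = refl
  and-map⁻ {P} (y ∷ l) e (there x∈)  with P y
  ... | true = and-map⁻ l e x∈

≡-from-⇔ : ∀ {b b′} → (b ≡ true → b′ ≡ true) → (b′ ≡ true → b ≡ true) → b ≡ b′
≡-from-⇔ {true}  {_}     f g = ≡.sym (f refl)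
≡-from-⇔ {false} {false} f g = refl
≡-from-⇔ {false} {true}  f g = g refl

module _ {m k n} (f : Vec (Fin m) n) (g : Vec (Fin k) n) where

  Refines : Set
  Refines = ∀ i i′ → Vec.lookup f i ≡ Vec.lookup f i′ → Vec.lookup g i ≡ Vec.lookup g i′

  refinesB⁺ : Refines → refinesB f g ≡ true
  refinesB⁺ r = and-map⁺ (allFin n) λ {i} _ → and-map⁺ (allFin n) λ {i′} _ → pair i i′
    where
    pair : ∀ i i′ → not (eqFinB (Vec.lookup f i) (Vec.lookup f i′)) ∨
                    eqFinB (Vec.lookup g i) (Vec.lookup g i′) ≡ true
    pair i i′ with Vec.lookup f i Fin.≟ Vec.lookup f i′
    ... | no  _ = refl
    ... | yes e = dec-true (Vec.lookup g i Fin.≟ Vec.lookup g i′) (r i i′ e)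

  refinesB⁻ : refinesB f g ≡ true → Refines
  refinesB⁻ b i i′ e
    with Vec.lookup f i Fin.≟ Vec.lookup f i′ | Vec.lookup g i Fin.≟ Vec.lookup g i′
       | and-map⁻ (allFin n) (and-map⁻ (allFin n) b (∈ₚ.∈-allFin i)) (∈ₚ.∈-allFin i′)
  ... | _     | yes e′ | _ = e′
  ... | no ¬e | no _   | _ = contradiction e ¬e

-- Eigenvalues indexed by set compositions, and their eigenvectors.

module Eigenvalues {c ℓ₁ ℓ₂} (K : OrderedField c ℓ₁ ℓ₂) (n : ℕ)
                   (γ : List ℕ → OrderedField.Carrier K) where

  open FieldSums K
  open ShuffleOperator K n γ

  ñγ≈ : ∀ m (f : Vec (Fin m) n) →
    ñγ K γ (m , f) ≈ sgn (n ℕ.∸ m) * ∑γ λ α g → when (refinesB f g) 1#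
  ñγ≈ m f = ≈-sym (≈-trans (∑-* s (compositions n) _) (∑-cong (compositions n) λ {α} _ → begin
    s * (γ α * N α)             ≈⟨ x*yz≈y*xz s (γ α) (N α) ⟩
    γ α * (s * N α)             ≈⟨ *-congˡ (*-congˡ (∑-cong (allVecs (length α) n) λ {g} _ →
                                     ≈-reflexive (≡.sym (when-∧ (hasTypeB α g) (refinesB f g) 1#)))) ⟩
    γ α * (s * ∑ (allVecs (length α) n) λ g → when (hasTypeB α g ∧ refinesB f g) 1#)
      ≈⟨ *-congˡ (*-congˡ (∑-length-filter (allVecs (length α) n))) ⟨
    γ α * (s * ℕ→K K (nα α (m , f)))
      ≈⟨ *-congˡ (signK≈sgn* (n ℕ.∸ m) _) ⟨
    γ α * ñα K α (m , f) ∎))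
    where
    s = sgn (n ℕ.∸ m)
    N : List ℕ → Carrier
    N α = ∑ (allVecs (length α) n) λ g → when (hasTypeB α g) (when (refinesB f g) 1#)

  valid⇒nodes : ∀ T → Valid T → nodesF T ≡ n ℕ.∸ length T
  valid⇒nodes T vT = ≡.sym (≡.trans
    (cong (ℕ._∸ length T) (≡.trans (≡.sym (Listₚ.length-tabulate id))
      (≡.trans (≡.sym (↭ₚ.↭-length vT)) (length-leavesF T))))
    (ℕₚ.m+n∸n≡m (nodesF T) (length T)))

  -- Each bracket lowers the number of trees by one, which matches the sign; the two refinement
  -- hypotheses match the counts. T and f are independent data because both passages are needed:
  -- from forests to set compositions for annihilation, and back for minimality.
  eigenvalue≈ñγ : ∀ T → Valid T → ∀ {m} (f : Vec (Fin m) n) → length T ≡ m →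
    (∀ {k} (g : Vec (Fin k) n) → Compat (colour g) T → Refines f g) →
    (∀ {k} (g : Vec (Fin k) n) → Refines f g → Compat (colour g) T) →
    eigenvalue T ≈ ñγ K γ (m , f)
  eigenvalue≈ñγ T vT f refl to from = ≈-trans
    (*-cong (≈-reflexive (cong sgn (valid⇒nodes T vT)))
            (∑γ-cong λ _ g → ≈-reflexive (cong (λ b → when b 1#) (agree g))))
    (≈-sym (ñγ≈ (length T) f))
    where
    agree : ∀ {k} (g : Vec (Fin k) n) → compatB g T ≡ refinesB f g
    agree g with compat? (colour g) T
    ... | yes c = ≡.sym (refinesB⁺ f g (to g c))
    ... | no ¬c = ≡-from-⇔ (λ ()) (λ e → contradiction (from g (refinesB⁻ f g e)) ¬c)

  module _ (T : Forest) (vT : Valid T) where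

    private
      unique : Unique (leavesF T)
      unique = Unique-resp-↭ (↭-sym vT) (Uniqueₚ.allFin⁺ n)

      mem : ∀ i → Any (λ t → i ∈ leaves t) T
      mem i = ∈ₚ.∈-concatMap⁻ leaves (↭ₚ.∈-resp-↭ (↭-sym vT) (∈ₚ.∈-allFin i))

    labels : Vec (Fin (length T)) n
    labels = Vec.tabulate (Any.index ∘ mem)

    private
      lookup-labels : ∀ i → Vec.lookup labels i ≡ Any.index (mem i)
      lookup-labels = Vecₚ.lookup∘tabulate (Any.index ∘ mem)

      label-at : ∀ j {i} → i ∈ leaves (List.lookup T j) → Vec.lookup labels i ≡ j
      label-at j {i} i∈ with anyAt T j i∈
      ... | p , refl = ≡.trans (lookup-labels i) (index-unique T unique (mem i) p)

    forest⇒setComp : SetComp n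
    forest⇒setComp = length T , labels

    forest⇒isSetComp : IsSetComp forest⇒setComp
    forest⇒isSetComp j = firstLeaf (List.lookup T j) , label-at j (firstLeaf∈leaves (List.lookup T j))

    forest⇒eigenvalue : eigenvalue T ≈ ñγ K γ forest⇒setComp
    forest⇒eigenvalue = eigenvalue≈ñγ T vT labels refl to from
      where
      to : ∀ {k} (g : Vec (Fin k) n) → Compat (colour g) T → Refines labels g
      to g c i i′ e = Finₚ.toℕ-injective (≡.trans (colour-at i)
        (≡.trans (cong (λ j → colour g (firstLeaf (List.lookup T j)))
                       (≡.trans (≡.sym (lookup-labels i)) (≡.trans e (lookup-labels i′))))
                 (≡.sym (colour-at i′))))
        where
        colour-at : ∀ i → colour g i ≡ colour g (firstLeaf (List.lookup T (Any.index (mem i))))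
        colour-at i = All.lookup (All.lookup c (∈ₚ.∈-lookup (Any.index (mem i)))) (Anyₚ.lookup-index (mem i))

      from : ∀ {k} (g : Vec (Fin k) n) → Refines labels g → Compat (colour g) T
      from g r = All.tabulate λ {t} t∈ → All.tabulate λ {a} a∈ → cong toℕ (r a (firstLeaf t)
        (≡.trans (label t∈ a∈) (≡.sym (label t∈ (firstLeaf∈leaves t)))))
        where
        label : ∀ {t a} (t∈ : t ∈ T) → a ∈ leaves t → Vec.lookup labels a ≡ Any.index t∈
        label t∈ a∈ = label-at (Any.index t∈) (subst (λ t → _ ∈ leaves t) (Anyₚ.lookup-index t∈) a∈)

  δw : Word → Fun Word
  δw u w = when (does (Listₚ.≡-dec Fin._≟_ w u)) 1#

  δw-≢ : ∀ {u w} → w ≢ u → δw u w ≡ 0#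
  δw-≢ {u} {w} w≢u = cong (λ b → when b 1#) (dec-false (Listₚ.≡-dec Fin._≟_ w u) w≢u)

  δw-≡ : ∀ {u w} → w ≡ u → δw u w ≡ 1#
  δw-≡ {u} {w} w≡u = cong (λ b → when b 1#) (dec-true (Listₚ.≡-dec Fin._≟_ w u) w≡u)

  δw-++ : ∀ {a b} v w → length v ≡ length a → δw (a ++ b) (v ++ w) ≈ δw a v * δw b w
  δw-++ {a} {b} v w len with Listₚ.≡-dec Fin._≟_ v a | Listₚ.≡-dec Fin._≟_ w b
  ... | yes refl | yes refl = ≈-trans (≈-reflexive (δw-≡ {v ++ w} refl)) (≈-sym (*-identityˡ 1#))
  ... | yes refl | no w≢b   = ≈-trans (≈-reflexive (δw-≢ (w≢b ∘ Listₚ.++-cancelˡ v w b))) (≈-sym (zeroʳ 1#))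
  ... | no v≢a   | _        = ≈-trans (≈-reflexive (δw-≢ (v≢a ∘ prefix v a len))) (≈-sym (zeroˡ _))
    where
    prefix : ∀ v a → length v ≡ length a → v ++ w ≡ a ++ b → v ≡ a
    prefix []      []      _   _ = refl
    prefix (x ∷ v) (y ∷ a) len e =
      cong₂ _∷_ (Listₚ.∷-injectiveˡ e) (prefix v a (ℕₚ.suc-injective len) (Listₚ.∷-injectiveʳ e))

  -- The leaf word has coefficient 1 in the expanded bracket: in vw - wv the second word begins with
  -- a leaf of u, while the leaf word begins with a leaf of t.
  evalT-δw : ∀ t → Unique (leaves t) → evalT t (δw (leaves t)) ≈ 1#
  evalT-δw (leaf a) u = ≈-reflexive (δw-≡ {[ a ]} refl)
  evalT-δw (t ∙ u) uniq = begin
    evalT t (λ v → evalT u (λ w → δw lt++lu (v ++ w) - δw lt++lu (w ++ v)))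
      ≈⟨ evalT-cong t (λ v v↭ → ≈-trans (evalT-cong u λ w w↭ → product v↭ w↭)
           (≈-trans (evalT-* u _ _) (≈-trans (*-congˡ (evalT-δw u uu)) (*-identityʳ _)))) ⟩
    evalT t (δw (leaves t))
      ≈⟨ evalT-δw t ut ⟩
    1# ∎
    where
    lt++lu = leaves t ++ leaves u
    split  = unique-++⁻ (leaves t) uniq
    ut     = proj₁ split
    uu     = proj₁ (proj₂ split)

    wrong-order : ∀ {v w} lt → leaves t ≡ lt → w ↭ leaves u → w ++ v ≢ lt ++ leaves u
    wrong-order {w = []} lt _ w↭ _
      with () ← ↭ₚ.∈-resp-↭ (↭-sym w↭) (firstLeaf∈leaves u)
    wrong-order {w = a ∷ w} [] e _ _ with () ← subst (firstLeaf t ∈_) e (firstLeaf∈leaves t)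
    wrong-order {w = a ∷ w} (b ∷ lt) e w↭ e′ = proj₂ (proj₂ split)
      (subst (a ∈_) (≡.sym e) (here (Listₚ.∷-injectiveˡ e′))) (↭ₚ.∈-resp-↭ w↭ (here refl))

    product : ∀ {v w} → v ↭ leaves t → w ↭ leaves u →
      δw lt++lu (v ++ w) - δw lt++lu (w ++ v) ≈ δw (leaves t) v * δw (leaves u) w
    product {v} {w} v↭ w↭ = ≈-trans
      (+-cong (δw-++ v w (↭ₚ.↭-length v↭))
              (≈-trans (-‿cong (≈-reflexive (δw-≢ (wrong-order (leaves t) refl w↭)))) -0≈0))
      (+-identityʳ _)

  evalF-δw : ∀ T → Unique (leavesF T) → evalF T (δw (leavesF T)) ≈ 1#
  evalF-δw [] u = ≈-refl
  evalF-δw (t ∷ T) u = ≈-trans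
    (evalT-cong t λ v v↭ → ≈-trans (evalF-cong T λ {w} _ → δw-++ v w (↭ₚ.↭-length v↭))
      (≈-trans (L-* (evalF-linear T) _ _) (≈-trans (*-congˡ (evalF-δw T uT)) (*-identityʳ _))))
    (evalT-δw t ut)
    where
    ut = proj₁ (unique-++⁻ (leaves t) u)
    uT = proj₁ (proj₂ (unique-++⁻ (leaves t) u))

  evalP : Poly K → Carrier → Carrier
  evalP []       e = 0#
  evalP (p ∷ ps) e = p + e * evalP ps e

  act : Poly K → Fun Word → Fun Word
  act []       x r = 0#
  act (p ∷ ps) x r = p * x r + U (act ps x) r

  module _ {m} (f : Vec (Fin m) n) (isF : IsSetComp (m , f)) where

    block : Fin m → Word
    block j = filter (λ i → Vec.lookup f i Fin.≟ j) (allFin n)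

    ∈-block⁺ : ∀ i → i ∈ block (Vec.lookup f i)
    ∈-block⁺ i = ∈ₚ.∈-filter⁺ (λ i′ → Vec.lookup f i′ Fin.≟ Vec.lookup f i) (∈ₚ.∈-allFin i) refl

    ∈-block⁻ : ∀ {i j} → i ∈ block j → Vec.lookup f i ≡ j
    ∈-block⁻ {j = j} i∈ = proj₂ (∈ₚ.∈-filter⁻ (λ i → Vec.lookup f i Fin.≟ j) {xs = allFin n} i∈)

    blockTree : Fin m → Tree (Fin n)
    blockTree j = treeOn (block j) (proj₁ (isF j) , subst (λ j → _ ∈ block j) (proj₂ (isF j)) (∈-block⁺ _))

    leaves-blockTree : ∀ j → leaves (blockTree j) ≡ block j
    leaves-blockTree j = leaves-treeOn (block j) _

    ∈-leaves⁻ : ∀ {i} j → i ∈ leaves (blockTree j) → Vec.lookup f i ≡ j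
    ∈-leaves⁻ j i∈ = ∈-block⁻ (subst (_ ∈_) (leaves-blockTree j) i∈)

    firstLeaf-blockTree : ∀ j → Vec.lookup f (firstLeaf (blockTree j)) ≡ j
    firstLeaf-blockTree j = ∈-leaves⁻ j (firstLeaf∈leaves (blockTree j))

    blockForest : Forest
    blockForest = map blockTree (allFin m)

    length-blockForest : length blockForest ≡ m
    length-blockForest = ≡.trans (Listₚ.length-map blockTree (allFin m)) (Listₚ.length-tabulate id)

    blockForest-valid : Valid blockForest
    blockForest-valid = unique∧set⇒↭
      (Uniqueₚ.concat⁺
        (Allₚ.map⁺ (Allₚ.map⁺ (All.universal (λ j → subst Unique (≡.sym (leaves-blockTree j))
          (Uniqueₚ.filter⁺ (λ i → Vec.lookup f i Fin.≟ j) (Uniqueₚ.allFin⁺ n))) (allFin m))))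
        (AllPairsₚ.map⁺ (AllPairsₚ.map⁺ (AllPairs.map disjoint (Uniqueₚ.allFin⁺ m)))))
      (Uniqueₚ.allFin⁺ n)
      (λ _ → ∈ₚ.∈-allFin _)
      (λ {i} _ → ∈ₚ.∈-concatMap⁺ leaves (Anyₚ.map⁺ (Any.map
        (λ { refl → subst (i ∈_) (≡.sym (leaves-blockTree (Vec.lookup f i))) (∈-block⁺ i) })
        (∈ₚ.∈-allFin (Vec.lookup f i)))))
      where
      disjoint : ∀ {j j′} → j ≢ j′ → Disjoint (leaves (blockTree j)) (leaves (blockTree j′))
      disjoint {j} {j′} j≢j′ (i∈ , i∈′) = j≢j′ (≡.trans (≡.sym (∈-leaves⁻ j i∈)) (∈-leaves⁻ j′ i∈′))

    blockForest-refines : ∀ {k} (g : Vec (Fin k) n) → Compat (colour g) blockForest → Refines f g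
    blockForest-refines g c i i′ e = Finₚ.toℕ-injective (≡.trans (mono i refl) (≡.sym (mono i′ (≡.sym e))))
      where
      mono : ∀ i′ → Vec.lookup f i′ ≡ Vec.lookup f i → colour g i′ ≡ colour g (firstLeaf (blockTree (Vec.lookup f i)))
      mono i′ e = All.lookup (All.lookup (Allₚ.map⁻ c) (∈ₚ.∈-allFin (Vec.lookup f i)))
        (subst (i′ ∈_) (≡.sym (leaves-blockTree _)) (subst (λ j → i′ ∈ block j) e (∈-block⁺ i′)))

    blockForest-compat : ∀ {k} (g : Vec (Fin k) n) → Refines f g → Compat (colour g) blockForest
    blockForest-compat g r = Allₚ.map⁺ (All.universal (λ j → All.tabulate λ {i} i∈ → cong toℕ
      (r i (firstLeaf (blockTree j)) (≡.trans (∈-leaves⁻ j i∈) (≡.sym (firstLeaf-blockTree j))))) (allFin m))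

    blockForest-eigenvalue : eigenvalue blockForest ≈ ñγ K γ (m , f)
    blockForest-eigenvalue = eigenvalue≈ñγ blockForest blockForest-valid f length-blockForest
      blockForest-refines blockForest-compat

    -- Tests whether the letters of every block occur in increasing order.
    φ : Fun Word
    φ w = δw (leavesF blockForest) (sortW f w)

    private
      Tf = blockForest

      strictly-sorted : AllPairs (λ t u → colour f (firstLeaf t) ℕ.< colour f (firstLeaf u)) Tf
      strictly-sorted = AllPairsₚ.map⁺ (AllPairs.map
        (λ j<j′ → ≡.subst₂ (λ j j′ → toℕ j ℕ.< toℕ j′)
          (≡.sym (firstLeaf-blockTree _)) (≡.sym (firstLeaf-blockTree _)) j<j′)
        (AllPairsₚ.tabulate⁺-< id))

    -- The colouring f is compatible with every reordering of its own blocks, and sorting by f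
    -- restores the block forest, in whose product the leaf word has coefficient 1.
    evalF-φ : ∀ {T} → T ↭ Tf → evalF T φ ≈ 1#
    evalF-φ {T} T↭ = begin
      evalF T φ
        ≈⟨ evalF-sortBy (colour f) T (δw (leavesF Tf)) ⟩
      when (compatB f T) (evalF (sortF (colour f) T) (δw (leavesF Tf)))
        ≈⟨ ≈-reflexive (cong₂ (λ b S → when b (evalF S (δw (leavesF Tf))))
             (compatB-true f (↭ₚ.All-resp-↭ (↭-sym T↭) (blockForest-compat f (λ _ _ e → e))))
             (sorted-unique (λ p q → ℕₚ.<⇒≱ q p) (sortBy-sorted (colour f ∘ firstLeaf) T)
               strictly-sorted (↭-trans (sortF-↭ (colour f) T) T↭))) ⟩
      evalF Tf (δw (leavesF Tf))
        ≈⟨ evalF-δw Tf (Unique-resp-↭ (↭-sym blockForest-valid) (Uniqueₚ.allFin⁺ n)) ⟩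
      1# ∎

    -- The span of the reorderings of blockForest is stable under U, and φ is constantly 1 on them.
    evalF-act-φ : ∀ Q {T} → T ↭ Tf → evalF T (act Q φ) ≈ evalP Q (eigenvalue Tf)
    evalF-act-φ [] {T} T↭ = L-0 (evalF-linear T)
    evalF-act-φ (p ∷ ps) {T} T↭ = begin
      evalF T (λ r → p * φ r + U y r)
        ≈⟨ L-+ (evalF-linear T) _ _ ⟩
      evalF T (λ r → p * φ r) + evalF T (U y)
        ≈⟨ +-cong (≈-trans (L-* (evalF-linear T) p φ) (≈-trans (*-congˡ (evalF-φ T↭)) (*-identityʳ p)))
                  (evalF-U T y) ⟩
      p + sgn (nodesF T) * evalF (reverse T) (B y)
        ≈⟨ +-congˡ (*-cong (≈-reflexive (cong sgn (nodesF-↭ T↭))) (evalF-B (reverse T) y)) ⟩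
      p + sgn (nodesF Tf) * (∑γ λ α g → when (compatB g (reverse T)) (evalF (sortF (colour g) (reverse T)) y))
        ≈⟨ +-congˡ (*-congˡ (∑γ-cong λ _ g → ≈-trans (when-cong (compatB g (reverse T))
             (evalF-act-φ ps (↭-trans (sortF-↭ (colour g) (reverse T)) rT↭)))
             (≈-trans (when-* (compatB g (reverse T)) _)
               (*-congʳ (≈-reflexive (cong (λ b → when b 1#) (compatB-↭ g rT↭))))))) ⟩
      p + sgn (nodesF Tf) * (∑γ λ α g → when (compatB g Tf) 1# * q)
        ≈⟨ +-congˡ (≈-trans (*-congˡ (∑γ-*ʳ _ q)) (≈-sym (*-assoc _ _ _))) ⟩
      p + eigenvalue Tf * q ∎
      where
      y   = act ps φ
      q   = evalP ps (eigenvalue Tf)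
      rT↭ = ↭-trans (↭ₚ.↭-reverse T) T↭

-- The descent test, permutations, and the words of their inverses.

mutual
  -- The unnamed local function of desSubB, recovered by unification.
  desGo : ∀ {n} → Vec (Fin n) n → List ℕ → ℕ → List (Fin n) → Bool
  desGo = _

  desSubB≡desGo : ∀ {n} (w : Vec (Fin n) n) α → desSubB w α ≡ desGo w α 1 (Vec.toList w)
  desSubB≡desGo w α with 1 | Vec.toList w
  ... | i | l = refl

Inj : ∀ {n} → Vec (Fin n) n → Set
Inj w = ∀ i j → Vec.lookup w i ≡ Vec.lookup w j → i ≡ j

lookup-ext : ∀ {a} {A : Set a} {n} (v w : Vec A n) → (∀ i → Vec.lookup v i ≡ Vec.lookup w i) → v ≡ w
lookup-ext v w p = ≡.trans (≡.sym (Vecₚ.tabulate∘lookup v))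
  (≡.trans (Vecₚ.tabulate-cong p) (Vecₚ.tabulate∘lookup w))

eqVecB⇒≡ : ∀ {m n} (v w : Vec (Fin m) n) → eqVecB v w ≡ true → v ≡ w
eqVecB⇒≡ Vec.[]       Vec.[]       e = refl
eqVecB⇒≡ (x Vec.∷ v) (y Vec.∷ w) e with x Finₚ.≟ y
... | yes refl = cong (x Vec.∷_) (eqVecB⇒≡ v w e)

eqVecB-refl : ∀ {m n} (v : Vec (Fin m) n) → eqVecB v v ≡ true
eqVecB-refl Vec.[]       = refl
eqVecB-refl (x Vec.∷ v) rewrite dec-true (x Finₚ.≟ x) refl = eqVecB-refl v

eqVecB-≢ : ∀ {m n} {v w : Vec (Fin m) n} → v ≢ w → eqVecB v w ≡ false
eqVecB-≢ {v = v} {w} v≢w with eqVecB v w in e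
... | true  = contradiction (eqVecB⇒≡ v w e) v≢w
... | false = refl

∈-allVecs : ∀ {m n} (v : Vec (Fin m) n) → v ∈ allVecs m n
∈-allVecs Vec.[] = here refl
∈-allVecs {m} {suc n} (x Vec.∷ v) = ∈ₚ.∈-concatMap⁺ (λ x → map (x Vec.∷_) (allVecs m n))
  (Any.map (λ { refl → ∈ₚ.∈-map⁺ (x Vec.∷_) (∈-allVecs v) }) (∈ₚ.∈-allFin x))

allVecs-unique : ∀ m n → Unique (allVecs m n)
allVecs-unique m zero    = [] ∷ []
allVecs-unique m (suc n) = Uniqueₚ.concat⁺
  (Allₚ.map⁺ (All.universal (λ x → Uniqueₚ.map⁺ Vecₚ.∷-injectiveʳ (allVecs-unique m n)) (allFin m)))
  (AllPairsₚ.map⁺ (AllPairs.map disjoint (Uniqueₚ.allFin⁺ m)))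
  where
  disjoint : ∀ {x y} → x ≢ y → Disjoint (map (x Vec.∷_) (allVecs m n)) (map (y Vec.∷_) (allVecs m n))
  disjoint {x} {y} x≢y (v∈ , v∈′) with ∈ₚ.∈-map⁻ (x Vec.∷_) v∈ | ∈ₚ.∈-map⁻ (y Vec.∷_) v∈′
  ... | _ , _ , refl | _ , _ , e = x≢y (Vecₚ.∷-injectiveˡ e)

isInjB⁺ : ∀ {n} (w : Vec (Fin n) n) → Inj w → isInjB w ≡ true
isInjB⁺ {n} w inj = and-map⁺ (allFin n) λ {i} _ → and-map⁺ (allFin n) λ {j} _ → pair i j
  where
  pair : ∀ i j → not (eqFinB (Vec.lookup w i) (Vec.lookup w j)) ∨ eqFinB i j ≡ true
  pair i j with Vec.lookup w i Finₚ.≟ Vec.lookup w j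
  ... | no  _ = refl
  ... | yes e = dec-true (i Finₚ.≟ j) (inj i j e)

isInjB⁻ : ∀ {n} (w : Vec (Fin n) n) → isInjB w ≡ true → Inj w
isInjB⁻ {n} w b i j e
  with Vec.lookup w i Finₚ.≟ Vec.lookup w j | i Finₚ.≟ j
     | and-map⁻ (allFin n) (and-map⁻ (allFin n) b (∈ₚ.∈-allFin i)) (∈ₚ.∈-allFin j)
... | _     | yes i≡j | _ = i≡j
... | no ¬e | no _    | _ = contradiction e ¬e

∈-perms⁺ : ∀ {n} {w : Vec (Fin n) n} → Inj w → w ∈ perms n
∈-perms⁺ {w = w} inj = ∈ₚ.∈-filter⁺ (λ w → isInjB w Boolₚ.≟ true) (∈-allVecs w) (isInjB⁺ w inj)

∈-perms⁻ : ∀ {n} {w : Vec (Fin n) n} → w ∈ perms n → Inj w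
∈-perms⁻ {n} {w} w∈ = isInjB⁻ w (proj₂ (∈ₚ.∈-filter⁻ (λ w → isInjB w Boolₚ.≟ true) {xs = allVecs n n} w∈))

perms-unique : ∀ n → Unique (perms n)
perms-unique n = Uniqueₚ.filter⁺ (λ w → isInjB w Boolₚ.≟ true) (allVecs-unique n n)

lookup-∘ₚ : ∀ {n} (σ τ : Vec (Fin n) n) i → Vec.lookup (σ ∘ₚ τ) i ≡ Vec.lookup σ (Vec.lookup τ i)
lookup-∘ₚ σ τ = Vecₚ.lookup∘tabulate _

-- The value j is a junk value: it occurs only if w is not injective.
preimage : ∀ {n} → Vec (Fin n) n → Fin n → Fin n
preimage w j with Finₚ.any? (λ i → Vec.lookup w i Finₚ.≟ j)
... | yes (i , _) = i
... | no _        = j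

inv : ∀ {n} → Vec (Fin n) n → Vec (Fin n) n
inv w = Vec.tabulate (preimage w)

-- Pigeonhole: if j were missed, deleting it from the codomain would embed a finite set into a
-- smaller one.
injective⇒preimage : ∀ {n} (w : Vec (Fin n) n) → Inj w → ∀ j → ¬ (∀ i → Vec.lookup w i ≢ j)
injective⇒preimage {suc n} w inj j none = contradiction
  (Finₚ.injective⇒≤ {f = λ i → Fin.punchOut (none i ∘ ≡.sym)}
    (λ {i} {i′} e → inj i i′ (Finₚ.punchOut-injective (none i ∘ ≡.sym) (none i′ ∘ ≡.sym) e)))
  ℕₚ.1+n≰n

module _ {n} {w : Vec (Fin n) n} (w∈ : w ∈ perms n) where

  lookup-inv : ∀ j → Vec.lookup w (Vec.lookup (inv w) j) ≡ j
  lookup-inv j rewrite Vecₚ.lookup∘tabulate (preimage w) j with Finₚ.any? (λ i → Vec.lookup w i Finₚ.≟ j)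
  ... | yes (_ , e) = e
  ... | no none     = contradiction (λ i e → none (i , e)) (injective⇒preimage w (∈-perms⁻ w∈) j)

  inv-lookup : ∀ i → Vec.lookup (inv w) (Vec.lookup w i) ≡ i
  inv-lookup i = ∈-perms⁻ w∈ _ i (lookup-inv (Vec.lookup w i))

  inv∈perms : inv w ∈ perms n
  inv∈perms = ∈-perms⁺ λ i j e → ≡.trans (≡.sym (lookup-inv i)) (≡.trans (cong (Vec.lookup w) e) (lookup-inv j))

  inv≡ : ∀ v → (∀ i → Vec.lookup w (Vec.lookup v i) ≡ i) → inv w ≡ v
  inv≡ v p = lookup-ext (inv w) v λ i → ∈-perms⁻ w∈ _ _ (≡.trans (lookup-inv i) (≡.sym (p i)))

∘ₚ∈perms : ∀ {n} {σ τ : Vec (Fin n) n} → σ ∈ perms n → τ ∈ perms n → σ ∘ₚ τ ∈ perms n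
∘ₚ∈perms {σ = σ} {τ} σ∈ τ∈ = ∈-perms⁺ λ i j e → ∈-perms⁻ τ∈ i j (∈-perms⁻ σ∈ _ _
  (≡.trans (≡.sym (lookup-∘ₚ σ τ i)) (≡.trans e (lookup-∘ₚ σ τ j))))

∘ₚ-assoc : ∀ {n} (ρ σ τ : Vec (Fin n) n) → (ρ ∘ₚ σ) ∘ₚ τ ≡ ρ ∘ₚ (σ ∘ₚ τ)
∘ₚ-assoc ρ σ τ = lookup-ext _ _ λ i → ≡.trans (lookup-∘ₚ (ρ ∘ₚ σ) τ i)
  (≡.trans (lookup-∘ₚ ρ σ _) (≡.sym (≡.trans (lookup-∘ₚ ρ (σ ∘ₚ τ) i) (cong (Vec.lookup ρ) (lookup-∘ₚ σ τ i)))))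

module _ {n} {σ τ ρ : Vec (Fin n) n} where

  solveˡ : σ ∈ perms n → σ ∘ₚ τ ≡ ρ → τ ≡ inv σ ∘ₚ ρ
  solveˡ σ∈ refl = lookup-ext _ _ λ i → ≡.sym (≡.trans (lookup-∘ₚ (inv σ) (σ ∘ₚ τ) i)
    (≡.trans (cong (Vec.lookup (inv σ)) (lookup-∘ₚ σ τ i)) (inv-lookup σ∈ _)))

  solveʳ : τ ∈ perms n → σ ∘ₚ τ ≡ ρ → σ ≡ ρ ∘ₚ inv τ
  solveʳ τ∈ refl = lookup-ext _ _ λ i → ≡.sym (≡.trans (lookup-∘ₚ (σ ∘ₚ τ) (inv τ) i)
    (≡.trans (lookup-∘ₚ σ τ _) (cong (Vec.lookup σ) (lookup-inv τ∈ i))))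

σ∘inv[σ]∘ρ : ∀ {n} {σ : Vec (Fin n) n} ρ → σ ∈ perms n → σ ∘ₚ (inv σ ∘ₚ ρ) ≡ ρ
σ∘inv[σ]∘ρ {σ = σ} ρ σ∈ = lookup-ext _ _ λ i → ≡.trans (lookup-∘ₚ σ (inv σ ∘ₚ ρ) i)
  (≡.trans (cong (Vec.lookup σ) (lookup-∘ₚ (inv σ) ρ i)) (lookup-inv σ∈ _))

ρ∘inv[τ]∘τ : ∀ {n} ρ {τ : Vec (Fin n) n} → τ ∈ perms n → (ρ ∘ₚ inv τ) ∘ₚ τ ≡ ρ
ρ∘inv[τ]∘τ ρ {τ} τ∈ = lookup-ext _ _ λ i → ≡.trans (lookup-∘ₚ (ρ ∘ₚ inv τ) τ i)
  (≡.trans (lookup-∘ₚ ρ (inv τ) _) (cong (Vec.lookup ρ) (inv-lookup τ∈ i)))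

w₀∈perms : ∀ n → w₀ n ∈ perms n
w₀∈perms n = ∈-perms⁺ λ i j e → ≡.trans (≡.sym (Finₚ.opposite-involutive i)) (≡.trans
  (cong Fin.opposite (≡.trans (≡.sym (Vecₚ.lookup∘tabulate Fin.opposite i))
    (≡.trans e (Vecₚ.lookup∘tabulate Fin.opposite j)))) (Finₚ.opposite-involutive j))

inv-w₀ : ∀ n → inv (w₀ n) ≡ w₀ n
inv-w₀ n = inv≡ (w₀∈perms n) (w₀ n) λ i → ≡.trans (Vecₚ.lookup∘tabulate Fin.opposite _)
  (≡.trans (cong Fin.opposite (Vecₚ.lookup∘tabulate Fin.opposite i)) (Finₚ.opposite-involutive i))

ι : ∀ {n} → Vec (Fin n) n
ι = Vec.tabulate (λ i → i)

ι∈perms : ∀ {n} → ι {n} ∈ perms n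
ι∈perms = ∈-perms⁺ λ i j e →
  ≡.trans (≡.sym (Vecₚ.lookup∘tabulate _ i)) (≡.trans e (Vecₚ.lookup∘tabulate _ j))

toList-lookup : ∀ {a} {A : Set a} {n} (v : Vec A n) → Vec.toList v ≡ map (Vec.lookup v) (allFin n)
toList-lookup {n = n} v = ≡.trans (toList-tabulate v) (≡.sym (Listₚ.map-tabulate id (Vec.lookup v)))
  where
  toList-tabulate : ∀ {a} {A : Set a} {n} (v : Vec A n) → Vec.toList v ≡ List.tabulate (Vec.lookup v)
  toList-tabulate Vec.[]      = refl
  toList-tabulate (x Vec.∷ v) = cong (x ∷_) (toList-tabulate v)

list⇒vec : ∀ {a} {A : Set a} {n} (l : List A) → length l ≡ n → Σ (Vec A n) λ v → Vec.toList v ≡ l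
list⇒vec l refl = Vec.fromList l , Vecₚ.toList∘fromList l

toList-inj : ∀ {a} {A : Set a} {n} (v w : Vec A n) → Vec.toList v ≡ Vec.toList w → v ≡ w
toList-inj Vec.[]      Vec.[]      e = refl
toList-inj (x Vec.∷ v) (y Vec.∷ w) e =
  cong₂ Vec._∷_ (Listₚ.∷-injectiveˡ e) (toList-inj v w (Listₚ.∷-injectiveʳ e))

∈-toList⁻ : ∀ {a} {A : Set a} {n} (v : Vec A n) {x} → x ∈ Vec.toList v → ∃ λ i → Vec.lookup v i ≡ x
∈-toList⁻ (y Vec.∷ v) (here refl) = Fin.zero , refl
∈-toList⁻ (y Vec.∷ v) (there x∈)  with ∈-toList⁻ v x∈
... | i , e = Fin.suc i , e

-- The letter a stands at position ρ(a). Hence left multiplication rearranges positions, w₀ acting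
-- as reversal, and right multiplication relabels letters.
word : ∀ {n} → Vec (Fin n) n → List (Fin n)
word ρ = Vec.toList (inv ρ)

module _ {n} {ρ : Vec (Fin n) n} (ρ∈ : ρ ∈ perms n) where

  word-↭ : word ρ ↭ allFin n
  word-↭ = unique∧set⇒↭
    (subst Unique (≡.sym (toList-lookup (inv ρ)))
      (Uniqueₚ.map⁺ (λ {i} {j} → ∈-perms⁻ (inv∈perms ρ∈) i j) (Uniqueₚ.allFin⁺ n)))
    (Uniqueₚ.allFin⁺ n)
    (λ _ → ∈ₚ.∈-allFin _)
    (λ {i} _ → subst (i ∈_) (≡.sym (toList-lookup (inv ρ)))
      (subst (_∈ map (Vec.lookup (inv ρ)) (allFin n)) (inv-lookup ρ∈ i)
        (∈ₚ.∈-map⁺ (Vec.lookup (inv ρ)) (∈ₚ.∈-allFin (Vec.lookup ρ i)))))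

  word-sorted : AllPairs (λ a b → toℕ (Vec.lookup ρ a) ℕ.< toℕ (Vec.lookup ρ b)) (word ρ)
  word-sorted = subst (AllPairs _) (≡.sym (toList-lookup (inv ρ))) (AllPairsₚ.map⁺
    (AllPairs.map (λ {i} {j} → ≡.subst₂ (λ i j → toℕ i ℕ.< toℕ j)
      (≡.sym (lookup-inv ρ∈ i)) (≡.sym (lookup-inv ρ∈ j))) (AllPairsₚ.tabulate⁺-< id)))

word-injective : ∀ {n} {ρ τ : Vec (Fin n) n} → ρ ∈ perms n → τ ∈ perms n → word ρ ≡ word τ → ρ ≡ τ
word-injective {ρ = ρ} {τ} ρ∈ τ∈ e = lookup-ext ρ τ λ i → ≡.trans
  (≡.sym (lookup-inv τ∈ (Vec.lookup ρ i)))
  (cong (Vec.lookup τ) (≡.trans (cong (λ v → Vec.lookup v (Vec.lookup ρ i)) (≡.sym (toList-inj _ _ e))) (inv-lookup ρ∈ i)))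

word-surjective : ∀ {n} {s : List (Fin n)} → s ↭ allFin n → Σ (Vec (Fin n) n) λ τ → τ ∈ perms n × word τ ≡ s
word-surjective {n} {s} s↭
  with list⇒vec {n = n} s (≡.trans (↭ₚ.↭-length s↭) (Listₚ.length-tabulate id))
... | v , refl = τ , τ∈ , cong Vec.toList (inv≡ τ∈ v λ i → ≡.trans (lookup-τ _) (unique-position i))
  where
  pos : ∀ a → ∃ λ i → Vec.lookup v i ≡ a
  pos a = ∈-toList⁻ v (↭ₚ.∈-resp-↭ (↭-sym s↭) (∈ₚ.∈-allFin a))

  τ = Vec.tabulate (proj₁ ∘ pos)

  lookup-τ : ∀ a → Vec.lookup τ a ≡ proj₁ (pos a)
  lookup-τ = Vecₚ.lookup∘tabulate (proj₁ ∘ pos)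

  v∘τ : ∀ a → Vec.lookup v (Vec.lookup τ a) ≡ a
  v∘τ a = ≡.trans (cong (Vec.lookup v) (lookup-τ a)) (proj₂ (pos a))

  τ∈ : τ ∈ perms n
  τ∈ = ∈-perms⁺ λ i j e → ≡.trans (≡.sym (v∘τ i)) (≡.trans (cong (Vec.lookup v) e) (v∘τ j))

  unique-position : ∀ i → proj₁ (pos (Vec.lookup v i)) ≡ i
  unique-position i = ≡.trans (≡.sym (lookup-τ _)) (≡.trans
    (cong (Vec.lookup τ) (≡.trans (cong (Vec.lookup v) (≡.sym (lookup-inv τ∈ i))) (v∘τ _))) (lookup-inv τ∈ i))

-- Block colourings and descent sets.

expand : ∀ k → (Fin k → ℕ) → List (Fin k)
expand zero    c = []
expand (suc k) c = replicate (c Fin.zero) Fin.zero ++ map Fin.suc (expand k (c ∘ Fin.suc))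

occurrences : ∀ {k} → Fin k → List (Fin k) → ℕ
occurrences j l = length (filter (Fin._≟ j) l)

expand-cong : ∀ k {c c′ : Fin k → ℕ} → (∀ j → c j ≡ c′ j) → expand k c ≡ expand k c′
expand-cong zero    p = refl
expand-cong (suc k) p = cong₂ (λ m l → replicate m Fin.zero ++ map Fin.suc l)
  (p Fin.zero) (expand-cong k (p ∘ Fin.suc))

expand-zero : ∀ k → expand k (λ _ → 0) ≡ []
expand-zero zero    = refl
expand-zero (suc k) = cong (map Fin.suc) (expand-zero k)

-- No letter below a occurs, so the additional copy of a comes first.
expand-bump : ∀ k {c c′ : Fin k → ℕ} a → c′ a ≡ suc (c a) → (∀ j → j ≢ a → c′ j ≡ c j) →
  (∀ j → toℕ j ℕ.< toℕ a → c j ≡ 0) → expand k c′ ≡ a ∷ expand k c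
expand-bump (suc k) Fin.zero e same below rewrite e =
  cong (λ l → Fin.zero ∷ replicate _ Fin.zero ++ map Fin.suc l)
    (expand-cong k (λ j → same (Fin.suc j) (λ ())))
expand-bump (suc k) (Fin.suc a) e same below
  rewrite same Fin.zero (λ ()) | below Fin.zero z<s =
  cong (map Fin.suc) (expand-bump k a e
    (λ j j≢a → same (Fin.suc j) (j≢a ∘ Finₚ.suc-injective)) (λ j j<a → below (Fin.suc j) (s<s j<a)))

occurrences-here : ∀ {k} (a : Fin k) l → occurrences a (a ∷ l) ≡ suc (occurrences a l)
occurrences-here a l = cong length (Listₚ.filter-accept (Fin._≟ a) refl)

occurrences-there : ∀ {k} {a j : Fin k} l → a ≢ j → occurrences j (a ∷ l) ≡ occurrences j l
occurrences-there {j = j} l a≢j = cong length (Listₚ.filter-reject (Fin._≟ j) a≢j)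

occurrences-none : ∀ {k} {j : Fin k} {l} → All (_≢ j) l → occurrences j l ≡ 0
occurrences-none {j = j} p = cong length (Listₚ.filter-none (Fin._≟ j) p)

occurrences-++ : ∀ {k} (j : Fin k) l m → occurrences j (l ++ m) ≡ occurrences j l ℕ.+ occurrences j m
occurrences-++ j l m = ≡.trans (cong length (Listₚ.filter-++ (Fin._≟ j) l m)) (Listₚ.length-++ (filter (Fin._≟ j) l))

occurrences-↭ : ∀ {k} (j : Fin k) {l m} → l ↭ m → occurrences j l ≡ occurrences j m
occurrences-↭ j p = ↭ₚ.↭-length (↭ₚ.filter-↭ (Fin._≟ j) p)

sorted⇒expand : ∀ {k} {l : List (Fin k)} → AllPairs (λ a b → toℕ a ℕ.≤ toℕ b) l →
  l ≡ expand k (λ j → occurrences j l)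
sorted⇒expand {k} [] = ≡.sym (expand-zero k)
sorted⇒expand {k} {a ∷ l} (p ∷ ps) = ≡.trans (cong (a ∷_) (sorted⇒expand ps)) (≡.sym
  (expand-bump k a (occurrences-here a l) (λ j j≢a → occurrences-there l (j≢a ∘ ≡.sym))
    (λ j j<a → occurrences-none (All.map (λ { a≤b refl → ℕₚ.<⇒≱ j<a a≤b }) p))))

occurrences-expand : ∀ k c j → occurrences j (expand k c) ≡ c j
occurrences-expand (suc k) c j = ≡.trans
  (occurrences-++ j (replicate (c Fin.zero) Fin.zero) (map Fin.suc (expand k (c ∘ Fin.suc)))) (split j)
  where
  zeros : ∀ m → occurrences {suc k} Fin.zero (replicate m Fin.zero) ≡ m
  zeros zero    = refl
  zeros (suc m) = ≡.trans (occurrences-here Fin.zero (replicate m Fin.zero)) (cong suc (zeros m))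

  shifted : ∀ j l → occurrences (Fin.suc j) (map Fin.suc l) ≡ occurrences {k} j l
  shifted j [] = refl
  shifted j (a ∷ l) with a Fin.≟ j
  ... | yes _ = cong suc (shifted j l)
  ... | no  _ = shifted j l

  split : ∀ j → occurrences j (replicate (c Fin.zero) Fin.zero)
              ℕ.+ occurrences j (map Fin.suc (expand k (c ∘ Fin.suc))) ≡ c j
  split Fin.zero = ≡.trans (cong₂ ℕ._+_ (zeros (c Fin.zero))
      (occurrences-none (Allₚ.map⁺ (All.universal (λ _ ()) (expand k (c ∘ Fin.suc))))))
    (ℕₚ.+-identityʳ _)
  split (Fin.suc j) = ≡.trans (cong₂ ℕ._+_
      (occurrences-none {l = replicate (c Fin.zero) Fin.zero} (Allₚ.replicate⁺ (c Fin.zero) (λ ())))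
      (shifted j (expand k (c ∘ Fin.suc))))
    (occurrences-expand k (c ∘ Fin.suc) j)

-- The same word with natural numbers as letters, so that the recursion on α does not change the
-- type of the letters.
expandℕ : List ℕ → List ℕ
expandℕ []      = []
expandℕ (a ∷ α) = replicate a 0 ++ map suc (expandℕ α)

expand-toℕ : ∀ α → map toℕ (expand (length α) (List.lookup α)) ≡ expandℕ α
expand-toℕ []      = refl
expand-toℕ (a ∷ α) = ≡.trans (Listₚ.map-++ toℕ (replicate a Fin.zero) _)
  (cong₂ _++_ (Listₚ.map-replicate toℕ a Fin.zero)
    (≡.trans (≡.sym (Listₚ.map-∘ (expand (length α) (List.lookup α))))
      (≡.trans (Listₚ.map-∘ (expand (length α) (List.lookup α))) (cong (map suc) (expand-toℕ α)))))

length-expandℕ : ∀ α → length (expandℕ α) ≡ sum α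
length-expandℕ []      = refl
length-expandℕ (a ∷ α) = ≡.trans (Listₚ.length-++ (replicate a 0))
  (cong₂ ℕ._+_ (Listₚ.length-replicate a) (≡.trans (Listₚ.length-map suc (expandℕ α)) (length-expandℕ α)))

length-expand : ∀ α → length (expand (length α) (List.lookup α)) ≡ sum α
length-expand α = ≡.trans (≡.sym (Listₚ.length-map toℕ (expand (length α) (List.lookup α))))
  (≡.trans (cong length (expand-toℕ α)) (length-expandℕ α))

compsF-sum : ∀ f n {α} → α ∈ compsF f n → sum α ≡ n
compsF-sum f       zero    (here refl) = refl
compsF-sum (suc f) (suc n) α∈
  with k , k∈ , α∈′ ← find (∈ₚ.∈-concatMap⁻ (λ k → map (suc k ∷_) (compsF f (n ℕ.∸ k))) {xs = upTo (suc n)} α∈)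
  with β , β∈ , refl ← ∈ₚ.∈-map⁻ (suc k ∷_) α∈′ =
  cong suc (≡.trans (cong (k ℕ.+_) (compsF-sum f (n ℕ.∸ k) β∈)) (ℕₚ.m+[n∸m]≡n (ℕₚ.≤-pred (∈ₚ.∈-upTo⁻ k∈))))

-- i is the 1-based position of the head, as in desSubB.
Steps : (ℕ → Bool) → ℕ → List ℕ → Set
Steps M i (e ∷ e′ ∷ l) = ((M i ≡ true × e ℕ.< e′) ⊎ (M i ≡ false × e ≡ e′)) × Steps M (suc i) (e′ ∷ l)
Steps M i _            = ⊤

steps-map-suc : ∀ {M M′} i l → (∀ j → i ℕ.≤ j → M j ≡ M′ j) → Steps M i l → Steps M′ i (map suc l)
steps-map-suc i []       p s = tt
steps-map-suc i (e ∷ []) p s = tt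
steps-map-suc i (e ∷ e′ ∷ l) p (inj₁ (m , e<e′) , s) =
  inj₁ (≡.trans (≡.sym (p i ℕₚ.≤-refl)) m , s<s e<e′) , steps-map-suc (suc i) (e′ ∷ l) (λ j → p j ∘ ℕₚ.<⇒≤) s
steps-map-suc i (e ∷ e′ ∷ l) p (inj₂ (m , e≡e′) , s) =
  inj₂ (≡.trans (≡.sym (p i ℕₚ.≤-refl)) m , cong suc e≡e′) , steps-map-suc (suc i) (e′ ∷ l) (λ j → p j ∘ ℕₚ.<⇒≤) s

-- The a zeros occupy the positions s + 1, ..., s + a, and the word rises only after the last of
-- them, since every later letter is a successor. The alternative `l ≡ []` is the final block, whose
-- end does not belong to D(α).
steps-replicate : ∀ {M} a s l → (∀ i → s ℕ.< i → i ℕ.< s ℕ.+ a → M i ≡ false) → M (s ℕ.+ a) ≡ true ⊎ l ≡ [] →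
  Steps M (suc (s ℕ.+ a)) (map suc l) → Steps M (suc s) (replicate a 0 ++ map suc l)
steps-replicate zero s l inside end st = subst (λ s → Steps _ (suc s) (map suc l)) (ℕₚ.+-identityʳ s) st
steps-replicate (suc zero) s []      inside end st = tt
steps-replicate (suc zero) s (e ∷ l) inside (inj₁ m) st rewrite ℕₚ.+-comm s 1 = inj₁ (m , z<s) , st
steps-replicate {M} (suc (suc a)) s l inside end st =
  inj₂ (inside (suc s) ℕₚ.≤-refl (subst (suc s ℕ.<_) (≡.sym (ℕₚ.+-suc s (suc a))) (s<s (ℕₚ.m<m+n s z<s))) , refl) ,
  steps-replicate (suc a) (suc s) l
    (λ i s<i i< → inside i (ℕₚ.<⇒≤ s<i) (subst (i ℕ.<_) (≡.sym (ℕₚ.+-suc s (suc a))) i<))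
    (subst (λ m → M m ≡ true ⊎ l ≡ []) (ℕₚ.+-suc s (suc a)) end)
    (subst (λ m → Steps M (suc m) (map suc l)) (ℕₚ.+-suc s (suc a)) st)

memℕB-partialSums : ∀ {i} s α → i ℕ.< s → memℕB i (partialSums s α) ≡ false
memℕB-partialSums s []          i<s = refl
memℕB-partialSums s (a ∷ [])    i<s = refl
memℕB-partialSums {i} s (a ∷ b ∷ α) i<s =
  cong₂ _∨_ (dec-false (i ℕ.≟ s ℕ.+ a) (ℕₚ.<⇒≢ (ℕₚ.<-≤-trans i<s (ℕₚ.m≤m+n s a))))
            (memℕB-partialSums (s ℕ.+ a) (b ∷ α) (ℕₚ.<-≤-trans i<s (ℕₚ.m≤m+n s a)))

steps-expandℕ : ∀ s α → Steps (λ i → memℕB i (partialSums s α)) (suc s) (expandℕ α)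
steps-expandℕ s []          = tt
steps-expandℕ s (a ∷ [])    = steps-replicate a s [] (λ _ _ _ → refl) (inj₂ refl) tt
steps-expandℕ s (a ∷ b ∷ α) = steps-replicate a s (expandℕ (b ∷ α)) inside
  (inj₁ (cong (_∨ memℕB (s ℕ.+ a) (partialSums (s ℕ.+ a) (b ∷ α))) (dec-true (s ℕ.+ a ℕ.≟ s ℕ.+ a) refl)))
  (steps-map-suc (suc (s ℕ.+ a)) (expandℕ (b ∷ α)) after (steps-expandℕ (s ℕ.+ a) (b ∷ α)))
  where
  inside : ∀ i → s ℕ.< i → i ℕ.< s ℕ.+ a → memℕB i (partialSums s (a ∷ b ∷ α)) ≡ false
  inside i _ i< rewrite dec-false (i ℕ.≟ s ℕ.+ a) (ℕₚ.<⇒≢ i<) = memℕB-partialSums (s ℕ.+ a) (b ∷ α) i<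

  after : ∀ j → s ℕ.+ a ℕ.< j → memℕB j (partialSums (s ℕ.+ a) (b ∷ α)) ≡ memℕB j (partialSums s (a ∷ b ∷ α))
  after j j> rewrite dec-false (j ℕ.≟ s ℕ.+ a) (ℕₚ.>⇒≢ j>) = refl

∧-true⁻ : ∀ {b b′} → b ∧ b′ ≡ true → b ≡ true × b′ ≡ true
∧-true⁻ {true} {true} refl = refl , refl

does-true⁻ : ∀ {p} {P : Set p} (P? : Dec P) → does P? ≡ true → P
does-true⁻ (yes p) _ = p

module _ {n} (w : Vec (Fin n) n) (α : List ℕ) (col : Fin n → ℕ) (pos : Fin n → Fin n) where

  -- Weak in the positions, because the descent test excludes strict descents only; `sorted-unique`
  -- later confronts it with the strict version coming from the sort.
  WeakLex : Fin n → Fin n → Set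
  WeakLex = Lex col (λ a b → toℕ (pos a) ℕ.≤ toℕ (pos b))

  -- At a position in D(α) the colour rises, whatever `pos` does. At any other position the colour
  -- stays, and the absence of a descent supplies the second component of `Lex`.
  desGo⇒Linked : ∀ i s → Steps (λ i → memℕB i (D α)) i (map col s) →
    desGo w α i (map pos s) ≡ true → Linked WeakLex s
  desGo⇒Linked i []      st e = []
  desGo⇒Linked i (a ∷ []) st e = [-]
  desGo⇒Linked i (a ∷ b ∷ s) (step , st) e =
    related step ∷ desGo⇒Linked (suc i) (b ∷ s) st (proj₂ (∧-true⁻ e))
    where
    related : (memℕB i (D α) ≡ true × col a ℕ.< col b) ⊎ (memℕB i (D α) ≡ false × col a ≡ col b) → WeakLex a b
    related (inj₁ (_ , a<b)) = inj₁ a<b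
    related (inj₂ (m , a≡b)) = inj₂ (a≡b , ℕₚ.≮⇒≥ λ b<a → case ≡.trans (≡.sym (proj₁ (∧-true⁻ e)))
      (cong₂ (λ p q → not p ∨ q) (dec-true (toℕ (pos b) ℕ.<? toℕ (pos a)) b<a) m) of λ ())

  Linked⇒desGo : ∀ i s → Steps (λ i → memℕB i (D α)) i (map col s) →
    Linked WeakLex s → desGo w α i (map pos s) ≡ true
  Linked⇒desGo i []      st l = refl
  Linked⇒desGo i (a ∷ []) st l = refl
  Linked⇒desGo i (a ∷ b ∷ s) (inj₁ (m , a<b) , st) (_ ∷ l)
    rewrite m | Boolₚ.∨-zeroʳ (not (ltFinB (pos b) (pos a))) = Linked⇒desGo (suc i) (b ∷ s) st l
  Linked⇒desGo i (a ∷ b ∷ s) (inj₂ (m , a≡b) , st) (inj₁ a<b ∷ l) = contradiction a≡b (ℕₚ.<⇒≢ a<b)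
  Linked⇒desGo i (a ∷ b ∷ s) (inj₂ (m , a≡b) , st) (inj₂ (_ , a≤b) ∷ l)
    rewrite m | dec-false (toℕ (pos b) ℕ.<? toℕ (pos a)) (ℕₚ.≤⇒≯ a≤b) = Linked⇒desGo (suc i) (b ∷ s) st l

Lex-trans : ∀ {A : Set} (col : A → ℕ) {ℓ} {R : A → A → Set ℓ} →
  (∀ {a b c} → R a b → R b c → R a c) → ∀ {a b c} → Lex col R a b → Lex col R b c → Lex col R a c
Lex-trans col tr (inj₁ p)       (inj₁ q)        = inj₁ (ℕₚ.<-trans p q)
Lex-trans col tr (inj₁ p)       (inj₂ (q , _))  = inj₁ (ℕₚ.<-≤-trans p (ℕₚ.≤-reflexive q))
Lex-trans col tr (inj₂ (p , _)) (inj₁ q)        = inj₁ (ℕₚ.≤-<-trans (ℕₚ.≤-reflexive p) q)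
Lex-trans col tr (inj₂ (p , r)) (inj₂ (q , r′)) = inj₂ (≡.trans p q , tr r r′)

length-filter-map : ∀ {A B : Set} {P : B → Set} (P? : ∀ b → Dec (P b)) (f : A → B) l →
  length (filter P? (map f l)) ≡ length (filter (λ a → P? (f a)) l)
length-filter-map P? f [] = refl
length-filter-map P? f (a ∷ l) with does (P? (f a))
... | true  = cong suc (length-filter-map P? f l)
... | false = length-filter-map P? f l

hasTypeB⁻ : ∀ {n} α (g : Vec (Fin (length α)) n) → hasTypeB α g ≡ true → ∀ j → blockSize g j ≡ List.lookup α j
hasTypeB⁻ α g e j = does-true⁻ (blockSize g j ℕ.≟ List.lookup α j)
  (and-map⁻ (allFin (length α)) e (∈ₚ.∈-allFin j))

hasTypeB⁺ : ∀ {n} α (g : Vec (Fin (length α)) n) → (∀ j → blockSize g j ≡ List.lookup α j) → hasTypeB α g ≡ true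
hasTypeB⁺ α g p = and-map⁺ (allFin (length α)) λ {j} _ → dec-true (blockSize g j ℕ.≟ List.lookup α j) (p j)

blockSize≡occurrences : ∀ {k n} (g : Vec (Fin k) n) {s} → s ↭ allFin n → ∀ j →
  blockSize g j ≡ occurrences j (map (Vec.lookup g) s)
blockSize≡occurrences {n = n} g s↭ j = ≡.trans
  (≡.sym (length-filter-map (Fin._≟ j) (Vec.lookup g) (allFin n)))
  (≡.sym (occurrences-↭ j (↭ₚ.map⁺ (Vec.lookup g) s↭)))

-- Only one colouring of type α can stably sort r into the word s: it colours the letters
-- of s in order, and it does sort r into s iff the positions in r increase along each colour class.
module _ {n} {τ : Vec (Fin n) n} (τ∈ : τ ∈ perms n) {α} (α∈ : α ∈ compositions n) where

  private
    E : List (Fin (length α))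
    E = expand (length α) (List.lookup α)

    Ev : Σ (Vec (Fin (length α)) n) λ v → Vec.toList v ≡ E
    Ev = list⇒vec E (≡.trans (length-expand α) (compsF-sum n n α∈))

    map-word : ∀ {k} (g : Vec (Fin k) n) → map (Vec.lookup g) (word τ) ≡ Vec.toList (Vec.map (Vec.lookup g) (inv τ))
    map-word g = ≡.sym (Vecₚ.toList-map (Vec.lookup g) (inv τ))

  blockColouring : Vec (Fin (length α)) n
  blockColouring = Vec.tabulate (λ a → Vec.lookup (proj₁ Ev) (Vec.lookup τ a))

  map-blockColouring : map (Vec.lookup blockColouring) (word τ) ≡ E
  map-blockColouring = ≡.trans (map-word blockColouring) (≡.trans (cong Vec.toList
    (lookup-ext _ (proj₁ Ev) λ i → ≡.trans (Vecₚ.lookup-map i (Vec.lookup blockColouring) (inv τ))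
      (≡.trans (Vecₚ.lookup∘tabulate (λ a → Vec.lookup (proj₁ Ev) (Vec.lookup τ a)) _) (cong (Vec.lookup (proj₁ Ev)) (lookup-inv τ∈ i)))))
    (proj₂ Ev))

  blockColouring-type : hasTypeB α blockColouring ≡ true
  blockColouring-type = hasTypeB⁺ α blockColouring λ j → ≡.trans
    (blockSize≡occurrences blockColouring (word-↭ τ∈) j)
    (≡.trans (cong (occurrences j) map-blockColouring) (occurrences-expand (length α) (List.lookup α) j))

  blockColouring-unique : ∀ g r → hasTypeB α g ≡ true → word τ ≡ sortBy (toℕ ∘ Vec.lookup g) r → g ≡ blockColouring
  blockColouring-unique g r type e = lookup-ext g blockColouring λ a → ≡.trans
    (≡.sym (≡.trans (Vecₚ.lookup-map (Vec.lookup τ a) (Vec.lookup g) (inv τ))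
                    (cong (Vec.lookup g) (inv-lookup τ∈ a))))
    (≡.trans (cong (λ v → Vec.lookup v (Vec.lookup τ a)) vec-≡) (≡.sym (Vecₚ.lookup∘tabulate _ a)))
    where
    sorted : AllPairs (λ x y → toℕ x ℕ.≤ toℕ y) (map (Vec.lookup g) (word τ))
    sorted = AllPairsₚ.map⁺ (subst (AllPairs _) (≡.sym e) (sortBy-sorted (toℕ ∘ Vec.lookup g) r))

    list-≡ : map (Vec.lookup g) (word τ) ≡ E
    list-≡ = ≡.trans (sorted⇒expand sorted) (expand-cong (length α) λ j →
      ≡.trans (≡.sym (blockSize≡occurrences g (word-↭ τ∈) j)) (hasTypeB⁻ α g type j))

    vec-≡ : Vec.map (Vec.lookup g) (inv τ) ≡ proj₁ Ev
    vec-≡ = toList-inj _ _ (≡.trans (≡.sym (map-word g)) (≡.trans list-≡ (≡.sym (proj₂ Ev))))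

  module _ (v : Vec (Fin n) n) (pos : Fin n → Fin n) (v≡ : Vec.toList v ≡ map pos (word τ))
           {r} (r↭ : r ↭ allFin n) (r-sorted : AllPairs (λ a b → toℕ (pos a) ℕ.< toℕ (pos b)) r) where

    private
      col : Fin n → ℕ
      col = toℕ ∘ Vec.lookup blockColouring

      steps : Steps (λ i → memℕB i (D α)) 1 (map col (word τ))
      steps = subst (Steps _ 1) (≡.sym (≡.trans (Listₚ.map-∘ (word τ))
        (≡.trans (cong (map toℕ) map-blockColouring) (expand-toℕ α)))) (steps-expandℕ 0 α)

      clash : ∀ {a b} → Lex col (λ a b → toℕ (pos a) ℕ.< toℕ (pos b)) a b → WeakLex v α col pos b a → ⊥
      clash p        (inj₁ q)       = ℕₚ.<⇒≱ q (Lex⇒≤ col (λ a b → toℕ (pos a) ℕ.< toℕ (pos b)) p)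
      clash (inj₁ p) (inj₂ (q , _)) = ℕₚ.<⇒≢ p (≡.sym q)
      clash (inj₂ (_ , p)) (inj₂ (_ , q)) = ℕₚ.<⇒≱ p q

    desSubB≡sorts : does (Listₚ.≡-dec Fin._≟_ (word τ) (sortBy col r)) ≡ desSubB v α
    desSubB≡sorts = ≡.trans (≡-from-⇔ to from) (≡.sym (≡.trans (desSubB≡desGo v α) (cong (desGo v α 1) v≡)))
      where
      to : does (Listₚ.≡-dec Fin._≟_ (word τ) (sortBy col r)) ≡ true → desGo v α 1 (map pos (word τ)) ≡ true
      to _ with Listₚ.≡-dec Fin._≟_ (word τ) (sortBy col r)
      to _ | yes e = Linked⇒desGo v α col pos 1 (word τ) steps (Linkedₚ.AllPairs⇒Linked
        (AllPairs.map weaken (subst (AllPairs _) (≡.sym e) (sortBy-lex col _ r-sorted))))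
        where
        weaken : ∀ {a b} → Lex col (λ a b → toℕ (pos a) ℕ.< toℕ (pos b)) a b → WeakLex v α col pos a b
        weaken (inj₁ p)       = inj₁ p
        weaken (inj₂ (p , q)) = inj₂ (p , ℕₚ.<⇒≤ q)

      from : desGo v α 1 (map pos (word τ)) ≡ true → does (Listₚ.≡-dec Fin._≟_ (word τ) (sortBy col r)) ≡ true
      from e = dec-true (Listₚ.≡-dec Fin._≟_ (word τ) (sortBy col r)) (≡.sym (sorted-unique clash
        (sortBy-lex col _ r-sorted)
        (Linkedₚ.Linked⇒AllPairs (Lex-trans col ℕₚ.≤-trans) (desGo⇒Linked v α col pos 1 (word τ) steps e))
        (↭-trans (sortBy-↭ col r) (↭-trans r↭ (↭-sym (word-↭ τ∈))))))

AllPairs-reverse : ∀ {A : Set} {ℓ} {R : A → A → Set ℓ} {l} → AllPairs R l → AllPairs (λ a b → R b a) (reverse l)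
AllPairs-reverse [] = []
AllPairs-reverse {R = R} (_∷_ {x = a} {xs = l} p ps) = subst (AllPairs _) (≡.sym (Listₚ.unfold-reverse a l))
  (AllPairsₚ.++⁺ (AllPairs-reverse ps) ([] ∷ [])
    (All.map (_∷ []) (↭ₚ.All-resp-↭ (↭-sym (↭ₚ.↭-reverse l)) p)))

opposite-anti : ∀ {n} {i j : Fin n} → toℕ i ℕ.< toℕ j → toℕ (Fin.opposite j) ℕ.< toℕ (Fin.opposite i)
opposite-anti {n} {i} {j} i<j rewrite Finₚ.opposite-prop i | Finₚ.opposite-prop j =
  ℕₚ.∸-monoʳ-< (s<s i<j) (Finₚ.toℕ<n j)

-- Left multiplication by w₀ B_γ as the operator U.

module GroupAlgebra {c ℓ₁ ℓ₂} (K : OrderedField c ℓ₁ ℓ₂) (n : ℕ)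
                    (γ : List ℕ → OrderedField.Carrier K) where

  open FieldSums K
  open ShuffleOperator K n γ
  open Eigenvalues K n γ

  private
    Perm = Vec (Fin n) n

    infixl 7 _⋆_
    _⋆_ : GA K n → GA K n → GA K n
    _⋆_ = _*GA_ K

  ⋆-left : ∀ a b {ρ} → ρ ∈ perms n → (a ⋆ b) ρ ≈ ∑ (perms n) λ σ → a σ * b (inv σ ∘ₚ ρ)
  ⋆-left a b {ρ} ρ∈ = ≈-trans (sumK-concatMap (perms n) (perms n) _) (∑-cong (perms n) λ {σ} σ∈ → ≈-trans
    (∑-single (perms-unique n) (∘ₚ∈perms (inv∈perms σ∈) ρ∈) λ {τ} _ τ≢ → ≈-reflexive
      (cong (λ b′ → when b′ (a σ * b τ)) (eqVecB-≢ (τ≢ ∘ solveˡ σ∈))))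
    (≈-reflexive (cong (λ b′ → when b′ (a σ * b (inv σ ∘ₚ ρ)))
      (≡.trans (cong (λ ρ′ → eqVecB ρ′ ρ) (σ∘inv[σ]∘ρ ρ σ∈)) (eqVecB-refl ρ)))))

  ⋆-right : ∀ a b {ρ} → ρ ∈ perms n → (a ⋆ b) ρ ≈ ∑ (perms n) λ τ → a (ρ ∘ₚ inv τ) * b τ
  ⋆-right a b {ρ} ρ∈ = ≈-trans (sumK-concatMap (perms n) (perms n) _) (≈-trans
    (∑-swap (perms n) (perms n) _) (∑-cong (perms n) λ {τ} τ∈ → ≈-trans
    (∑-single (perms-unique n) (∘ₚ∈perms ρ∈ (inv∈perms τ∈)) λ {σ} _ σ≢ → ≈-reflexive
      (cong (λ b′ → when b′ (a σ * b τ)) (eqVecB-≢ (σ≢ ∘ solveʳ τ∈))))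
    (≈-reflexive (cong (λ b′ → when b′ (a (ρ ∘ₚ inv τ) * b τ))
      (≡.trans (cong (λ ρ′ → eqVecB ρ′ ρ) (ρ∘inv[τ]∘τ ρ τ∈)) (eqVecB-refl ρ))))))

  δ-⋆ : ∀ b {σ} → σ ∈ perms n → (δ K (w₀ n) ⋆ b) σ ≈ b (w₀ n ∘ₚ σ)
  δ-⋆ b {σ} σ∈ = ≈-trans (⋆-left (δ K (w₀ n)) b σ∈) (≈-trans
    (∑-single (perms-unique n) (w₀∈perms n) λ {u} _ u≢ →
      *-zeroˡ-cong (≈-reflexive (cong (λ b′ → when b′ 1#) (eqVecB-≢ (u≢ ∘ ≡.sym)))))
    (≈-trans (*-congʳ (≈-reflexive (cong (λ b′ → when b′ 1#) (eqVecB-refl (w₀ n)))))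
      (≈-trans (*-identityˡ _) (≈-reflexive (cong (λ u → b (u ∘ₚ σ)) (inv-w₀ n))))))

  Bγ≈ : ∀ w → Bγ K n γ w ≈ ∑ (compositions n) λ α → γ α * when (desSubB w α) 1#
  Bγ≈ w = go (compositions n)
    where
    go : ∀ l → foldr (λ α acc → _+GA_ K (_·GA_ K (γ α) (Bα K α)) acc) (0GA K) l w ≈
               ∑ l λ α → γ α * when (desSubB w α) 1#
    go []      = ≈-refl
    go (α ∷ l) = +-congˡ (go l)

  w₀Bγ : GA K n
  w₀Bγ = δ K (w₀ n) ⋆ Bγ K n γ

  -- The right side is the coefficient of w₀ B_α at ρ τ⁻¹; the left side counts the colourings that
  -- sort the reversed word of ρ into the word of τ. Only the block colouring of τ can be counted.
  descent-kernel : ∀ {ρ τ α} → ρ ∈ perms n → τ ∈ perms n → α ∈ compositions n →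
    (∑ (allVecs (length α) n) λ g → when (hasTypeB α g)
      (δw (sortW g (reverse (word ρ))) (word τ))) ≈
    when (desSubB (w₀ n ∘ₚ (ρ ∘ₚ inv τ)) α) 1#
  descent-kernel {ρ} {τ} {α} ρ∈ τ∈ α∈ = ≈-trans
    (∑-single (allVecs-unique (length α) n) (∈-allVecs g₀) λ {g} _ → others g)
    (≈-reflexive (≡.trans (cong (λ b → when b (δw (sortW g₀ r) (word τ))) (blockColouring-type τ∈ α∈))
      (cong (λ b → when b 1#) (desSubB≡sorts τ∈ α∈ v pos v≡ r↭ r-sorted))))
    where
    r  = reverse (word ρ)
    g₀ = blockColouring τ∈ α∈
    v  = w₀ n ∘ₚ (ρ ∘ₚ inv τ)

    pos : Fin n → Fin n
    -- The letter a has position ρ(a) in `word ρ`, hence the opposite position in the reversed word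
    -- r.
    pos = Fin.opposite ∘ Vec.lookup ρ

    lookup-v : ∀ i → Vec.lookup v i ≡ pos (Vec.lookup (inv τ) i)
    lookup-v i = ≡.trans (lookup-∘ₚ (w₀ n) (ρ ∘ₚ inv τ) i) (≡.trans (Vecₚ.lookup∘tabulate Fin.opposite _)
      (cong Fin.opposite (lookup-∘ₚ ρ (inv τ) i)))

    v≡ : Vec.toList v ≡ map pos (word τ)
    v≡ = ≡.trans (cong Vec.toList (lookup-ext v (Vec.map pos (inv τ)) λ i →
           ≡.trans (lookup-v i) (≡.sym (Vecₚ.lookup-map i pos (inv τ)))))
         (Vecₚ.toList-map pos (inv τ))

    r↭ : r ↭ allFin n
    r↭ = ↭-trans (↭ₚ.↭-reverse (word ρ)) (word-↭ ρ∈)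

    r-sorted : AllPairs (λ a b → toℕ (pos a) ℕ.< toℕ (pos b)) r
    r-sorted = AllPairs.map opposite-anti (AllPairs-reverse (word-sorted ρ∈))

    others : ∀ g → g ≢ g₀ → when (hasTypeB α g) (δw (sortW g r) (word τ)) ≈ 0#
    others g g≢ with hasTypeB α g in type
    ... | false = ≈-refl
    ... | true  = ≈-reflexive (δw-≢ (λ e → g≢ (blockColouring-unique τ∈ α∈ g r type e)))

  -- After the descent condition is replaced by a sum over colourings, the sum over τ selects the
  -- one permutation whose word is the sorted word. X is a function on all words, as U requires;
  -- only its values at words of permutations are tied to x.
  w₀Bγ-⋆ : ∀ {x X} → (∀ {τ} → τ ∈ perms n → x τ ≈ X (word τ)) →
    ∀ {ρ} → ρ ∈ perms n → (w₀Bγ ⋆ x) ρ ≈ U X (word ρ)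
  w₀Bγ-⋆ {x} {X} x≈X {ρ} ρ∈ = begin
    (w₀Bγ ⋆ x) ρ
      ≈⟨ ⋆-right w₀Bγ x ρ∈ ⟩
    (∑ (perms n) λ τ → w₀Bγ (ρ ∘ₚ inv τ) * x τ)
      ≈⟨ ∑-cong (perms n) (λ {τ} τ∈ → *-cong
           (≈-trans (δ-⋆ (Bγ K n γ) (∘ₚ∈perms ρ∈ (inv∈perms τ∈))) (Bγ≈ _)) (x≈X τ∈)) ⟩
    (∑ (perms n) λ τ → (∑ (compositions n) λ α → γ α * des α τ) * X (word τ))
      ≈⟨ ∑-cong (perms n) (λ {τ} _ → ∑-*ʳ (X (word τ)) (compositions n) _) ⟩
    (∑ (perms n) λ τ → ∑ (compositions n) λ α → γ α * des α τ * X (word τ))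
      ≈⟨ ∑-swap (perms n) (compositions n) _ ⟩
    (∑ (compositions n) λ α → ∑ (perms n) λ τ → γ α * des α τ * X (word τ))
      ≈⟨ ∑-cong (compositions n) (λ {α} α∈ → ≈-trans (∑-cong (perms n) λ {τ} _ → *-assoc _ _ _)
           (≈-trans (≈-sym (∑-* (γ α) (perms n) _)) (*-congˡ (by-colouring α∈)))) ⟩
    U X (word ρ) ∎
    where
    r = reverse (word ρ)

    des : List ℕ → Perm → Carrier
    des α τ = when (desSubB (w₀ n ∘ₚ (ρ ∘ₚ inv τ)) α) 1#

    at-word : ∀ {s} → s ↭ allFin n → (∑ (perms n) λ τ → δw s (word τ) * X (word τ)) ≈ X s
    at-word s↭ with word-surjective s↭
    ... | τ , τ∈ , refl = ≈-trans
      (∑-single (perms-unique n) τ∈ λ σ∈ σ≢ → *-zeroˡ-cong (≈-reflexive (δw-≢ (σ≢ ∘ word-injective σ∈ τ∈))))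
      (≈-trans (*-congʳ (≈-reflexive (δw-≡ {word τ} refl))) (*-identityˡ _))

    by-colouring : ∀ {α} → α ∈ compositions n → (∑ (perms n) λ τ → des α τ * X (word τ)) ≈
      ∑ (allVecs (length α) n) λ g → when (hasTypeB α g) (X (sortW g r))
    by-colouring {α} α∈ = begin
      (∑ (perms n) λ τ → des α τ * X (word τ))
        ≈⟨ ∑-cong (perms n) (λ {τ} τ∈ → ≈-trans (*-congʳ (≈-sym (descent-kernel ρ∈ τ∈ α∈)))
             (∑-*ʳ (X (word τ)) (allVecs (length α) n) _)) ⟩
      (∑ (perms n) λ τ → ∑ (allVecs (length α) n) λ g → when (hasTypeB α g) (δw (sortW g r) (word τ)) * X (word τ))
        ≈⟨ ∑-swap (perms n) (allVecs (length α) n) _ ⟩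
      (∑ (allVecs (length α) n) λ g → ∑ (perms n) λ τ → when (hasTypeB α g) (δw (sortW g r) (word τ)) * X (word τ))
        ≈⟨ ∑-cong (allVecs (length α) n) (λ {g} _ → colouring g) ⟩
      (∑ (allVecs (length α) n) λ g → when (hasTypeB α g) (X (sortW g r))) ∎
      where
      colouring : ∀ g → (∑ (perms n) λ τ → when (hasTypeB α g) (δw (sortW g r) (word τ)) * X (word τ)) ≈
        when (hasTypeB α g) (X (sortW g r))
      colouring g with hasTypeB α g
      ... | true  = at-word (↭-trans (sortBy-↭ (colour g) r) (↭-trans (↭ₚ.↭-reverse (word ρ)) (word-↭ ρ∈)))
      ... | false = ∑-zero (perms n) (λ _ → zeroˡ _)

  1GA≈δw : ∀ {ρ} → ρ ∈ perms n → 1GA K ρ ≈ δw (word ι) (word ρ)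
  1GA≈δw {ρ} ρ∈ with eqVecB ι ρ in e
  ... | true  = ≈-reflexive (≡.sym (δw-≡ (cong word (≡.sym (eqVecB⇒≡ ι ρ e)))))
  ... | false = ≈-reflexive (≡.sym (δw-≢ λ e′ → case ≡.trans (≡.sym e) (≡.trans
    (cong (eqVecB (ι {n})) (word-injective ρ∈ ι∈perms e′)) (eqVecB-refl (ι {n}))) of λ ()))

  evalGA≈act : ∀ Q {ρ} → ρ ∈ perms n → evalGA K Q w₀Bγ ρ ≈ act Q (δw (word ι)) (word ρ)
  evalGA≈act []       ρ∈ = ≈-refl
  evalGA≈act (p ∷ ps) ρ∈ = +-cong (*-congˡ (1GA≈δw ρ∈)) (w₀Bγ-⋆ {X = act ps (δw (word ι))} (evalGA≈act ps) ρ∈)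

  -- The product of Q(w₀ B_γ) with the element given by x on words of permutations, in the form of
  -- `⋆-right`.
  translate : Poly K → Fun Word → GA K n
  translate Q x ρ = ∑ (perms n) λ τ → x (word τ) * evalGA K Q w₀Bγ (ρ ∘ₚ inv τ)

  -- Left multiplication commutes with right translations, so that evalGA Q w₀Bγ determines act Q.
  act≈translate : ∀ Q x {ρ} → ρ ∈ perms n → translate Q x ρ ≈ act Q x (word ρ)
  act≈translate []       x ρ∈ = ∑-zero (perms n) (λ _ → zeroʳ _)
  act≈translate (p ∷ ps) x {ρ} ρ∈ = begin
    (∑ (perms n) λ τ → x (word τ) * (p * 1GA K (ρ ∘ₚ inv τ) + (w₀Bγ ⋆ E) (ρ ∘ₚ inv τ)))
      ≈⟨ ∑-cong (perms n) (λ _ → distribˡ _ _ _) ⟩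
    (∑ (perms n) λ τ → x (word τ) * (p * 1GA K (ρ ∘ₚ inv τ)) + x (word τ) * (w₀Bγ ⋆ E) (ρ ∘ₚ inv τ))
      ≈⟨ ∑-+ (perms n) _ _ ⟩
    (∑ (perms n) λ τ → x (word τ) * (p * 1GA K (ρ ∘ₚ inv τ)))
      + (∑ (perms n) λ τ → x (word τ) * (w₀Bγ ⋆ E) (ρ ∘ₚ inv τ))
      ≈⟨ +-cong unit (≈-trans product (w₀Bγ-⋆ {X = act ps x} (act≈translate ps x) ρ∈)) ⟩
    p * x (word ρ) + U (act ps x) (word ρ) ∎
    where
    E = evalGA K ps w₀Bγ

    ρ∘inv[ρ] : ρ ∘ₚ inv ρ ≡ ι
    ρ∘inv[ρ] = lookup-ext _ _ λ i → ≡.trans (lookup-∘ₚ ρ (inv ρ) i)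
      (≡.trans (lookup-inv ρ∈ i) (≡.sym (Vecₚ.lookup∘tabulate _ i)))

    ρ≡τ : ∀ {τ} → τ ∈ perms n → ι ≡ ρ ∘ₚ inv τ → τ ≡ ρ
    ρ≡τ {τ} τ∈ e = lookup-ext _ _ λ i → ≡.trans (≡.sym (Vecₚ.lookup∘tabulate (λ i → i) _))
      (≡.trans (cong (λ u → Vec.lookup u (Vec.lookup τ i)) e)
        (≡.trans (lookup-∘ₚ ρ (inv τ) _) (cong (Vec.lookup ρ) (inv-lookup τ∈ i))))

    unit : (∑ (perms n) λ τ → x (word τ) * (p * 1GA K (ρ ∘ₚ inv τ))) ≈ p * x (word ρ)
    unit = ≈-trans
      (∑-single (perms-unique n) ρ∈ λ τ∈ τ≢ → *-zeroʳ-cong (*-zeroʳ-cong (≈-reflexive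
        (cong (λ b → when b 1#) (eqVecB-≢ (τ≢ ∘ ρ≡τ τ∈))))))
      (≈-trans (*-congˡ (≈-trans (*-congˡ (≈-reflexive (cong (λ b → when b 1#)
        (≡.trans (cong (eqVecB (ι {n})) ρ∘inv[ρ]) (eqVecB-refl (ι {n})))))) (*-identityʳ p))) (*-comm _ p))

    product : (∑ (perms n) λ τ → x (word τ) * (w₀Bγ ⋆ E) (ρ ∘ₚ inv τ)) ≈ (w₀Bγ ⋆ translate ps x) ρ
    product = begin
      (∑ (perms n) λ τ → x (word τ) * (w₀Bγ ⋆ E) (ρ ∘ₚ inv τ))
        ≈⟨ ∑-cong (perms n) (λ {τ} τ∈ → ≈-trans (*-congˡ (⋆-left w₀Bγ E (∘ₚ∈perms ρ∈ (inv∈perms τ∈))))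
             (≈-trans (∑-* (x (word τ)) (perms n) _) (∑-cong (perms n) λ {σ} _ → ≈-trans
               (x*yz≈y*xz (x (word τ)) (w₀Bγ σ) _) (*-congˡ (*-congˡ (≈-reflexive
                 (cong E (≡.sym (∘ₚ-assoc (inv σ) ρ (inv τ)))))))))) ⟩
      (∑ (perms n) λ τ → ∑ (perms n) λ σ → w₀Bγ σ * (x (word τ) * E ((inv σ ∘ₚ ρ) ∘ₚ inv τ)))
        ≈⟨ ∑-swap (perms n) (perms n) _ ⟩
      (∑ (perms n) λ σ → ∑ (perms n) λ τ → w₀Bγ σ * (x (word τ) * E ((inv σ ∘ₚ ρ) ∘ₚ inv τ)))
        ≈⟨ ∑-cong (perms n) (λ {σ} _ → ∑-* (w₀Bγ σ) (perms n) _) ⟨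
      (∑ (perms n) λ σ → w₀Bγ σ * translate ps x (inv σ ∘ₚ ρ))
        ≈⟨ ⋆-left w₀Bγ (translate ps x) ρ∈ ⟨
      (w₀Bγ ⋆ translate ps x) ρ ∎

  -- `evalGA` is Q(U) applied to the unit alone, whereas the test functions φ require Q(U) to vanish
  -- on arbitrary functions.
  evalGA≈0⇒act≈0 : ∀ Q → _≈GA_ K (evalGA K Q w₀Bγ) (0GA K) → ∀ x {r} → r ↭ allFin n → act Q x r ≈ 0#
  evalGA≈0⇒act≈0 Q Q≈0 x r↭ with word-surjective r↭
  ... | ρ , ρ∈ , refl = ≈-trans (≈-sym (act≈translate Q x ρ∈))
    (∑-zero (perms n) λ τ∈ → *-zeroʳ-cong (Q≈0 _ (∘ₚ∈perms ρ∈ (inv∈perms τ∈))))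

-- Products of linear factors, division by x - k, and the number of roots.

module Polynomials {c ℓ₁ ℓ₂} (K : OrderedField c ℓ₁ ℓ₂) (n : ℕ)
                   (γ : List ℕ → OrderedField.Carrier K) where

  open FieldSums K
  open ShuffleOperator K n γ
  open Eigenvalues K n γ

  act-addP : ∀ p q x r → act (addP K p q) x r ≈ act p x r + act q x r
  act-addP []      q       x r = ≈-sym (+-identityˡ _)
  act-addP (a ∷ p) []      x r = ≈-sym (+-identityʳ _)
  act-addP (a ∷ p) (b ∷ q) x r = begin
    (a + b) * x r + U (act (addP K p q) x) r
      ≈⟨ +-cong (distribʳ (x r) a b) (≈-trans (L-cong (U-linear r) (act-addP p q x))
           (L-+ (U-linear r) (act p x) (act q x))) ⟩
    (a * x r + b * x r) + (U (act p x) r + U (act q x) r)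
      ≈⟨ +-interchange _ _ _ _ ⟩
    act (a ∷ p) x r + act (b ∷ q) x r ∎

  act-scale : ∀ k p x r → act (map (λ a → k * a) p) x r ≈ k * act p x r
  act-scale k []      x r = ≈-sym (zeroʳ k)
  act-scale k (a ∷ p) x r = ≈-trans
    (+-cong (*-assoc k a (x r))
      (≈-trans (L-cong (U-linear r) (act-scale k p x)) (L-* (U-linear r) k (act p x))))
    (≈-sym (distribˡ k _ _))

  act-linMul : ∀ k p x r → act (linMul K k p) x r ≈ U (act p x) r - k * act p x r
  act-linMul k p x r = ≈-trans (act-addP (0# ∷ p) (map (λ a → - k * a) p) x r)
    (+-cong (≈-trans (+-congʳ (zeroˡ (x r))) (+-identityˡ _))
            (≈-trans (act-scale (- k) p x r) (≈-sym (-‿distribˡ-* k _))))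

  act-prodLin : ∀ ks x r → act (prodLin K ks) x r ≈ prodU ks x r
  act-prodLin [] x r = ≈-trans (+-cong (*-identityˡ (x r)) (L-0 (U-linear r))) (+-identityʳ (x r))
  act-prodLin (k ∷ ks) x r = ≈-trans (act-linMul k (prodLin K ks) x r)
    (+-cong (L-cong (U-linear r) (act-prodLin ks x)) (-‿cong (*-congˡ (act-prodLin ks x r))))

  linMul-monic : ∀ k cs → Σ (Poly K) λ ds →
    linMul K k (cs ++ [ 1# ]) ≡ ds ++ [ 1# ] × length ds ≡ suc (length cs)
  linMul-monic k cs = go 0# cs
    where
    -- The entry a comes from the shifted copy of the polynomial: 0 at the start, afterwards the
    -- preceding coefficient.
    go : ∀ a cs → Σ (Poly K) λ ds →
      addP K (a ∷ cs ++ [ 1# ]) (map (λ c → - k * c) (cs ++ [ 1# ])) ≡ ds ++ [ 1# ] × length ds ≡ suc (length cs)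
    go a []       = [ a + - k * 1# ] , refl , refl
    go a (b ∷ cs) with go b cs
    ... | ds , e , len = (a + - k * b) ∷ ds , cong ((a + - k * b) ∷_) e , cong suc len

  prodLin-monic : ∀ ks → Σ (Poly K) λ cs → prodLin K ks ≡ cs ++ [ 1# ] × length cs ≡ length ks
  prodLin-monic []       = [] , refl , refl
  prodLin-monic (k ∷ ks) with prodLin-monic ks
  ... | cs , e , len with linMul-monic k cs
  ...   | ds , e′ , len′ = ds , ≡.trans (cong (linMul K k) e) e′ , ≡.trans len′ (cong suc len)

  -- Horner's scheme: the coefficients of the quotient by x - k are the values at k of the tails of
  -- the coefficient list. The leading 1 is left implicit in both polynomials.
  monicQuotient : Carrier → Carrier → Poly K → Poly K
  monicQuotient k d []       = []
  monicQuotient k d (e ∷ ds) = evalP (e ∷ ds ++ [ 1# ]) k ∷ monicQuotient k e ds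

  length-monicQuotient : ∀ k d ds → length (monicQuotient k d ds) ≡ length ds
  length-monicQuotient k d []       = refl
  length-monicQuotient k d (e ∷ ds) = cong suc (length-monicQuotient k e ds)

  -- Synthetic division by x - k, written without subtraction.
  monicQuotient-eval : ∀ k d ds x → evalP (d ∷ ds ++ [ 1# ]) x + k * evalP (monicQuotient k d ds ++ [ 1# ]) x ≈
    evalP (d ∷ ds ++ [ 1# ]) k + x * evalP (monicQuotient k d ds ++ [ 1# ]) x
  monicQuotient-eval k d [] x = begin
    (d + x * one x) + k * one x  ≈⟨ +-congˡ (*-congˡ (one≈ x k)) ⟩
    (d + x * one x) + k * one k  ≈⟨ +-assoc _ _ _ ⟩
    d + (x * one x + k * one k)  ≈⟨ +-congˡ (+-comm _ _) ⟩
    d + (k * one k + x * one x)  ≈⟨ +-assoc _ _ _ ⟨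
    (d + k * one k) + x * one x  ∎
    where
    one : Carrier → Carrier
    one y = 1# + y * 0#
    one≈ : ∀ y z → one y ≈ one z
    one≈ y z = +-congˡ (≈-trans (zeroʳ y) (≈-sym (zeroʳ z)))
  monicQuotient-eval k d (e ∷ ds) x = begin
    (d + x * p x) + k * (p k + x * q)       ≈⟨ +-congˡ (≈-trans (distribˡ k _ _) (+-congˡ (x*yz≈y*xz k x q))) ⟩
    (d + x * p x) + (k * p k + x * (k * q)) ≈⟨ ≈-trans (+-interchange _ _ _ _) (+-congˡ (≈-sym (distribˡ x _ _))) ⟩
    (d + k * p k) + x * (p x + k * q)       ≈⟨ +-congˡ (*-congˡ (monicQuotient-eval k e ds x)) ⟩
    (d + k * p k) + x * (p k + x * q)       ∎
    where
    p : Carrier → Carrier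
    p = evalP (e ∷ ds ++ [ 1# ])
    q = evalP (monicQuotient k e ds ++ [ 1# ]) x

  x*y≈z*y⇒y≈0 : ∀ {x y z} → ¬ (x ≈ z) → x * y ≈ z * y → y ≈ 0#
  x*y≈z*y⇒y≈0 {x} {y} {z} x≉z e with inverse (x - z) (x≉z ∘ x-y≈0⇒x≈y x z)
  ... | h , inv = begin
    y                  ≈⟨ *-identityˡ y ⟨
    1# * y             ≈⟨ *-congʳ inv ⟨
    (x - z) * h * y    ≈⟨ *-congʳ (*-comm _ h) ⟩
    h * (x - z) * y    ≈⟨ *-assoc h _ y ⟩
    h * ((x - z) * y)  ≈⟨ *-zeroʳ-cong (≈-trans ([y-z]x≈yx-zx y x z) (≈-trans (+-congʳ e) (-‿inverseʳ _))) ⟩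
    0#                 ∎

  -- After division by x - k the other roots, being different from k, are roots of the quotient,
  -- whose degree is one less.
  roots≤degree : ∀ ks ds → AllPairs (λ x y → ¬ (x ≈ y)) ks →
    All (λ k → evalP (ds ++ [ 1# ]) k ≈ 0#) ks → length ks ℕ.≤ length ds
  roots≤degree []       ds       _        _        = z≤n
  roots≤degree (k ∷ ks) []       _        (r ∷ _)  =
    contradiction (≈-trans (≈-sym r) (≈-trans (+-congˡ (zeroʳ k)) (+-identityʳ 1#))) 0≉1
  roots≤degree (k ∷ ks) (d ∷ ds) (a ∷ as) (r ∷ rs) = s≤s (ℕₚ.≤-trans
    (roots≤degree ks (monicQuotient k d ds) as (All.zipWith (λ (k≉x , rx) → x*y≈z*y⇒y≈0 k≉x (begin
      k * evalP (monicQuotient k d ds ++ [ 1# ]) _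
        ≈⟨ ≈-trans (+-congʳ rx) (+-identityˡ _) ⟨
      evalP (d ∷ ds ++ [ 1# ]) _ + k * evalP (monicQuotient k d ds ++ [ 1# ]) _
        ≈⟨ monicQuotient-eval k d ds _ ⟩
      evalP (d ∷ ds ++ [ 1# ]) k + _ * evalP (monicQuotient k d ds ++ [ 1# ]) _
        ≈⟨ ≈-trans (+-congʳ r) (+-identityˡ _) ⟩
      _ * evalP (monicQuotient k d ds ++ [ 1# ]) _ ∎)) (a , rs)))
    (ℕₚ.≤-reflexive (length-monicQuotient k d ds)))

  evalP-cong : ∀ Q {x y} → x ≈ y → evalP Q x ≈ evalP Q y
  evalP-cong []      x≈y = ≈-refl
  evalP-cong (p ∷ Q) x≈y = +-congˡ (*-cong x≈y (evalP-cong Q x≈y))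

-- The minimal polynomial of w₀ B_γ.

theorem10p5 : ∀ {c ℓ₁ ℓ₂} (K : OrderedField c ℓ₁ ℓ₂) (n : ℕ)
    (γ : List ℕ → OrderedField.Carrier K) →
    (∀ α → α ∈ compositions n → OrderedField._≤_ K (OrderedField.0# K) (γ α)) →
    (ks : List (OrderedField.Carrier K)) →
    AllPairs (λ x y → ¬ OrderedField._≈_ K x y) ks →
    All (λ k → Σ (SetComp n) λ F → IsSetComp F × OrderedField._≈_ K k (ñγ K γ F)) ks →
    (∀ (F : SetComp n) → IsSetComp F → Any (λ k → OrderedField._≈_ K k (ñγ K γ F)) ks) →
    IsMinPoly K (prodLin K ks) (_*GA_ K (δ K (w₀ n)) (Bγ K n γ))
theorem10p5 K n γ γ≥0 ks distinct attained complete with Polynomials.prodLin-monic K n γ ks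
... | cs , monic , degree = cs , monic , annihilates , minimal
  where
  open FieldSums K
  open ShuffleOperator K n γ
  open Eigenvalues K n γ
  open GroupAlgebra K n γ
  open Polynomials K n γ

  annihilates : _≈GA_ K (evalGA K (prodLin K ks) w₀Bγ) (0GA K)
  annihilates ρ ρ∈ = begin
    evalGA K (prodLin K ks) w₀Bγ ρ               ≈⟨ evalGA≈act (prodLin K ks) ρ∈ ⟩
    act (prodLin K ks) (δw (word ι)) (word ρ)    ≈⟨ act-prodLin ks (δw (word ι)) (word ρ) ⟩
    y (word ρ)                                   ≈⟨ ≈-reflexive (evalF-map-leaf (word ρ) y) ⟨
    evalF R y                                    ≈⟨ *-identityˡ _ ⟨
    1# * evalF R y                               ≈⟨ evalSym≈0⇒evalF≈0 (length R) R ℕₚ.≤-refl killed ⟩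
    0#                                           ∎
    where
    y = prodU ks (δw (word ι))
    -- The product of single leaves is the word itself, so evaluation at a word is a case of
    -- evaluation at a forest.
    R = map leaf (word ρ)

    killed : ∀ T → R ⊑ T → 1# * evalSym T y ≈ 0#
    killed T R⊑T = prodU-annihilates γ≥0 (length ks) ks ℕₚ.≤-refl T
      (↭-trans (leaves-↭ R⊑T) (↭-trans (↭-reflexive (leavesF-map-leaf (word ρ))) (word-↭ ρ∈))) 1#
      -- The scalar is still 1 here, and `complete` lists the eigenvalue of every valid forest
      -- through its set composition.
      (λ T′ vT′ _ → inj₁ (Any.map (λ e → ≈-trans e (≈-sym (forest⇒eigenvalue T′ vT′)))
        (complete (forest⇒setComp T′ vT′) (forest⇒isSetComp T′ vT′))))
      (δw (word ι))

  minimal : ∀ ds → _≈GA_ K (evalGA K (ds ++ [ 1# ]) w₀Bγ) (0GA K) → length cs ℕ.≤ length ds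
  minimal ds Q≈0 = ℕₚ.≤-trans (ℕₚ.≤-reflexive degree) (roots≤degree ks ds distinct (All.map root attained))
    where
    Q = ds ++ [ 1# ]

    root : ∀ {k} → (Σ (SetComp n) λ F → IsSetComp F × k ≈ ñγ K γ F) → evalP Q k ≈ 0#
    root {k} ((m , f) , isF , k≈) = begin
      evalP Q k                    ≈⟨ evalP-cong Q (≈-trans k≈ (≈-sym (blockForest-eigenvalue f isF))) ⟩
      evalP Q (eigenvalue T)       ≈⟨ evalF-act-φ f isF Q ↭-refl ⟨
      -- Only arrangements of all the letters occur in T, and these are the words on which Q(U) is
      -- known to vanish.
      evalF T (act Q (φ f isF))    ≈⟨ evalF-cong T (λ w → evalGA≈0⇒act≈0 Q Q≈0 (φ f isF)
                                        (↭-trans (IsWord⇒↭ w) (blockForest-valid f isF))) ⟩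
      evalF T (λ _ → 0#)           ≈⟨ L-0 (evalF-linear T) ⟩
      0#                           ∎
      where
      T = blockForest f isF
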